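{- Let $w\in S_\infty$, let $k\leq l$, and let $\eta=\eta_1+2\eta_2$ be a multi-set with $|\eta_1|+2|\eta_2|=k+l$ such that either $l>k=|\eta_2|+1$ or $l=k=|\eta_2|+2$. Then $m^{k,l}_\eta(w)=1$ if $\eta\in B_{k,l}(w)$, and $m^{k,l}_\eta(w)=0$ otherwise.
   Context: Permutations in $S_\infty$ compose as functions, $s_i$ is the transposition of $i,i+1$, $\ell(w)$ is the length. For $l\geq1$, $w^l$ is the increasing ordering of $w(1),\dots,w(l)$; $A_l(w)$ is the set of strictly increasing sequences $\alpha$ of $l$ positive integers with $\alpha_j\leq w^l_j$ for all $j$ (identified with sets); $s_i\alpha$ is the increasing sequence with entry set $\{s_i(\alpha_j)\}$; $A_{l,i}(w)=\{\alpha\in A_l(w):s_i\alpha\notin A_l(w)\}$. $x^\alpha=\prod_jx_{\alpha_j}$; a multi-set with multiplicities at most 2 is $\eta=\eta_1+2\eta_2$ ($\eta_1,\eta_2$ disjoint sets of elements of multiplicity 1, 2), $x^\eta=\prod_{j\in\eta_1}x_j\prod_{j\in\eta_2}x_j^2$. $T_l=t_1\cdots t_l$. $\pi_if=(x_if-x_{i+1}s_if)/(x_i-x_{i+1})$ with $s_i$ swapping $x_i,x_{i+1}$. For $\ell(s_iw)>\ell(w)$, $N_{w,i}=\prod_{l\geq1}\prod_{\alpha\in A_{l,i}(w)}(1-x^{s_i\alpha}T_l)$; $P_{\mathrm{Id}}=1$, $P_{s_iw}=\pi_i(P_wN_{w,i})$ whenever $\ell(s_iw)>\ell(w)$ (well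 defined). $m^{k,l}_\eta(w)$ is minus the coefficient of $x^\eta T_kT_l$ in $P_w$ (as a polynomial in $x$ and the $T_l$'s). For sets, $\alpha+\beta$ is multi-set union. $B_{k,l}(w)$ is the set of $\eta$ for which there exist $\alpha,\tilde\alpha\in A_l(w)$, $\beta,\tilde\beta\in A_k(w)$ with $\eta=\alpha+\beta=\tilde\alpha+\tilde\beta$ and $\alpha\neq\tilde\alpha$, $\alpha\neq\tilde\beta$, $\beta\neq\tilde\alpha$, $\beta\neq\tilde\beta$. -}

module Defs where

open import Data.Bool using (Bool; true; false; if_then_else_; _∧_; not)
open import Data.Nat using (ℕ; zero; suc; _≡ᵇ_; _<ᵇ_; _≤ᵇ_; _⊔_; _∸_)
import Data.Nat as ℕ
open import Data.Integer as ℤ using (ℤ)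
open import Data.List using (List; []; _∷_; map; filter; foldr; length; upTo; concat; concatMap; _++_; replicate; sum)
open import Data.List.Relation.Unary.All using (All)
open import Data.List.Relation.Unary.Linked using (Linked)
open import Data.List.Membership.Propositional using (_∈_)
open import Data.Product using (_×_; _,_; ∃-syntax; proj₁; proj₂)
open import Relation.Binary.PropositionalEquality using (_≡_; _≢_)
open import Relation.Nullary using (¬_)
open import Relation.Nullary.Decidable using (⌊_⌋)
open import Function using (_∘_)

-- Permutations of S_∞ given by words in the simple transpositions.
-- A word  i₁ ∷ i₂ ∷ … ∷ iᵣ  (all iⱼ ≥ 1) denotes  s_{i₁} ∘ s_{i₂} ∘ … ∘ s_{iᵣ}.
-- Natural number 0 is never used as a value (permutations act on ℕ⁺ and fix 0).

s : ℕ → ℕ → ℕ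
s i j = if j ≡ᵇ i then suc i else (if j ≡ᵇ suc i then i else j)

perm : List ℕ → ℕ → ℕ
perm []      j = j
perm (i ∷ u) j = s i (perm u j)

filterᵇ : {A : Set} → (A → Bool) → List A → List A
filterᵇ p []       = []
filterᵇ p (x ∷ xs) = if p x then x ∷ filterᵇ p xs else filterᵇ p xs

maxL : List ℕ → ℕ
maxL = foldr _⊔_ 0

range1 : ℕ → List ℕ
range1 n = map suc (upTo n)

invs : (ℕ → ℕ) → ℕ → ℕ
invs f n = length (filterᵇ (λ p → f (proj₂ p) <ᵇ f (proj₁ p))
  (concatMap (λ a → map (λ b → a , b) (filterᵇ (λ b → a <ᵇ b) (range1 n))) (range1 n)))

-- Coxeter length ℓ(w) = number of inversions.  The permutation denoted by the word u
-- fixes every integer > maxL u + 1, so it suffices to count on positions 1..maxL u + 1.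
ℓ : List ℕ → ℕ
ℓ u = invs (perm u) (suc (maxL u))

ReducedWord : List ℕ → Set
ReducedWord u = All (λ i → 1 ℕ.≤ i) u × length u ≡ ℓ u

insert : ℕ → List ℕ → List ℕ
insert x []       = x ∷ []
insert x (y ∷ ys) = if x ≤ᵇ y then x ∷ y ∷ ys else y ∷ insert x ys

sort : List ℕ → List ℕ
sort = foldr insert []

wˡ : List ℕ → ℕ → List ℕ
wˡ w l = sort (map (perm w) (range1 l))

strictInc : List ℕ → Bool
strictInc []           = true
strictInc (x ∷ [])     = true
strictInc (x ∷ y ∷ ys) = (x <ᵇ y) ∧ strictInc (y ∷ ys)

allPos : List ℕ → Bool
allPos = foldr (λ x b → (1 ≤ᵇ x) ∧ b) true

ptwLe : List ℕ → List ℕ → Bool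
ptwLe []       []       = true
ptwLe (x ∷ xs) (y ∷ ys) = (x ≤ᵇ y) ∧ ptwLe xs ys
ptwLe _        _        = false

inA : List ℕ → ℕ → List ℕ → Bool
inA w l α = (length α ≡ᵇ l) ∧ strictInc α ∧ allPos α ∧ ptwLe α (wˡ w l)

choose : ℕ → List ℕ → List (List ℕ)
choose zero    _        = [] ∷ []
choose (suc k) []       = []
choose (suc k) (x ∷ xs) = map (x ∷_) (choose k xs) ++ choose (suc k) xs

-- enumeration of A_l(w): every α ∈ A_l(w) has entries ≤ max(w^l)
enumA : List ℕ → ℕ → List (List ℕ)
enumA w l = filterᵇ (inA w l) (choose l (range1 (maxL (wˡ w l))))

sα : ℕ → List ℕ → List ℕ
sα i α = sort (map (s i) α)

enumAli : List ℕ → ℕ → ℕ → List (List ℕ)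
enumAli w l i = filterᵇ (λ α → not (inA w l (sα i α))) (enumA w l)

-- Polynomials in x₁, x₂, … and T₁, T₂, … with integer coefficients.
-- An exponent vector is a list whose entry at position n is the exponent of the
-- n-th variable (position 0 is never used); missing entries are 0.
-- A polynomial is a formal sum (list) of terms  c · x^e · T^f ; it is not normalised:
-- coefficients are extracted by summing over all terms with the given monomial.

Exp : Set
Exp = List ℕ

addE : Exp → Exp → Exp
addE []       f        = f
addE (x ∷ e)  []       = x ∷ e
addE (x ∷ e)  (y ∷ f)  = (x ℕ.+ y) ∷ addE e f

getE : Exp → ℕ → ℕ
getE []      _       = 0
getE (x ∷ e) zero    = x
getE (x ∷ e) (suc n) = getE e n

setE : Exp → ℕ → ℕ → Exp
setE []      zero    v = v ∷ []
setE []      (suc n) v = 0 ∷ setE [] n v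
setE (x ∷ e) zero    v = v ∷ e
setE (x ∷ e) (suc n) v = x ∷ setE e n v

eqE : Exp → Exp → Bool
eqE []      []      = true
eqE []      (y ∷ f) = (y ≡ᵇ 0) ∧ eqE [] f
eqE (x ∷ e) []      = (x ≡ᵇ 0) ∧ eqE e []
eqE (x ∷ e) (y ∷ f) = (x ≡ᵇ y) ∧ eqE e f

unitE : ℕ → Exp
unitE n = replicate n 0 ++ (1 ∷ [])

monE : List ℕ → Exp
monE = foldr (addE ∘ unitE) []

Term : Set
Term = ℤ × Exp × Exp        -- coefficient, x-exponents, T-exponents

Poly : Set
Poly = List Term

oneP : Poly
oneP = (ℤ.+ 1 , [] , []) ∷ []

_+P_ : Poly → Poly → Poly
_+P_ = _++_

_*P_ : Poly → Poly → Poly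
p *P q = concatMap (λ t → map (λ u → mulT t u) q) p
  where
    mulT : Term → Term → Term
    mulT (c , e , f) (d , e′ , f′) = (c ℤ.* d) , addE e e′ , addE f f′

prodP : List Poly → Poly
prodP = foldr _*P_ oneP

coeff : Poly → Exp → Exp → ℤ
coeff []                 e f = ℤ.+ 0
coeff ((c , e′ , f′) ∷ p) e f =
  if eqE e e′ ∧ eqE f f′ then c ℤ.+ coeff p e f else coeff p e f

-- The divided difference π_i f = (x_i f − x_{i+1} s_i f)/(x_i − x_{i+1}), computed on
-- a monomial  m = x_i^a x_{i+1}^b · r  (r free of x_i, x_{i+1}):
--   a ≥ b :  π_i m =   Σ_{j=0}^{a−b}   x_i^{a−j}   x_{i+1}^{b+j}         · r
--   a < b :  π_i m = − Σ_{j=0}^{b−a−2} x_i^{a+1+j} x_{i+1}^{b−1−j}       · r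
-- and extended linearly (T-variables are scalars).
πT : ℕ → Term → Poly
πT i (c , e , f) with getE e i | getE e (suc i)
... | a | b = if b ≤ᵇ a
  then map (λ j → c , setE (setE e i (a ∸ j)) (suc i) (b ℕ.+ j) , f) (upTo (suc (a ∸ b)))
  else map (λ j → ℤ.- c , setE (setE e i (suc a ℕ.+ j)) (suc i) ((b ∸ 1) ∸ j) , f)
           (upTo ((b ∸ a) ∸ 1))

πP : ℕ → Poly → Poly
πP i = concatMap (πT i)

-- N_{w,i} = Π_{l ≥ 1} Π_{α ∈ A_{l,i}(w)} (1 − x^{s_i α} T_l).
-- For l ≥ max(i, maxL w) + 1 one has w^l = (1,…,l), so A_l(w) = {(1,…,l)} and
-- A_{l,i}(w) = ∅; hence the product over l may be truncated at that bound.
N : List ℕ → ℕ → Poly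
N w i = prodP (map (λ l → prodP (map (λ α → oneP +P ((ℤ.- ℤ.+ 1 , monE (sα i α) , unitE l) ∷ []))
                                     (enumAli w l i)))
                   (range1 (suc (suc (maxL (i ∷ w))))))

-- P along a word: P_Id = 1,  P_{s_i u} = π_i (P_u N_{u,i}).
-- For a reduced word this is P_w of the permutation w = perm word (P_w is well defined,
-- i.e. independent of the reduced word).
P : List ℕ → Poly
P []      = oneP
P (i ∷ u) = πP i (P u *P N u i)

IsSet : List ℕ → Set
IsSet α = Linked ℕ._<_ α × All (λ j → 1 ℕ.≤ j) α

Disjoint : List ℕ → List ℕ → Set
Disjoint η₁ η₂ = ∀ j → j ∈ η₁ → ¬ (j ∈ η₂)

cnt : ℕ → List ℕ → ℕ
cnt j α = length (filterᵇ (λ x → x ≡ᵇ j) α)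

multη : List ℕ → List ℕ → ℕ → ℕ
multη η₁ η₂ j = cnt j η₁ ℕ.+ 2 ℕ.* cnt j η₂

m : ℕ → ℕ → List ℕ → List ℕ → List ℕ → ℤ
m k l η₁ η₂ w = ℤ.- coeff (P w) (addE (monE η₁) (addE (monE η₂) (monE η₂))) (addE (unitE k) (unitE l))

InA : List ℕ → ℕ → List ℕ → Set
InA w l α = inA w l α ≡ true

InB : ℕ → ℕ → List ℕ → List ℕ → List ℕ → Set
InB k l w η₁ η₂ = ∃[ α ] ∃[ α̃ ] ∃[ β ] ∃[ β̃ ]
  ( InA w l α × InA w l α̃ × InA w k β × InA w k β̃
  × (∀ j → cnt j α ℕ.+ cnt j β ≡ multη η₁ η₂ j)
  × (∀ j → cnt j α̃ ℕ.+ cnt j β̃ ≡ multη η₁ η₂ j)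
  × α ≢ α̃ × α ≢ β̃ × β ≢ α̃ × β ≢ β̃ )

-- Dividing P_w by ∏ (1 − x^α T_l) gives the generating series of key polynomials, so the
-- T_k T_l part of P_w is minus the excess of pairs (α , β) ∈ A_l(w) × A_k(w) with α + β = η
-- (unordered pairs when k = l) over the coefficient of a key polynomial.  The proof works with the
-- recursion itself: P_w is 1 modulo T-degree 2, hence for the T_k T_l parts
--   P_{s_i w} = π_i P_w − Σ x^{α + s_i β},  the sum over pairs α ∈ A_{l,i}(w), β ∈ A_{k,i}(w).
-- Induct on the length of w.  Comparing exponents at i and i+1, the only case in which
-- anything changes is η(i) = η(i+1) = 1.  The number of squared variables of η allows at most one
-- pair in the sum, and coefficients at exponents with more squares vanish.  If the pair is
-- present, counting the elements ≤ i shows that η has no splitting in A(w), whereas it has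
-- two in A(s_i w).  If it is absent, two splittings in A(s_i w) yield two in A(w): a
-- splitting that leaves A(w) on moving by s_i is replaced by exchanging i or i+1 with a
-- suitable other element, found by walking away from i and using w^k ⊆ w^l.
module Submission where

open import Defs
open import Data.Nat using (ℕ; _≤_; _<_; _+_; _*_)
open import Data.Integer using (ℤ)
open import Data.List using (List; length)
open import Data.Product using (_×_)
open import Data.Sum using (_⊎_)
open import Relation.Binary.PropositionalEquality using (_≡_)
open import Relation.Nullary using (¬_)

open import Data.Bool using (Bool; true; false; if_then_else_; _∧_; not; T)
open import Data.Bool.Properties using (∧-zeroʳ; ∧-assoc)
open import Data.Empty using (⊥; ⊥-elim)
open import Data.Fin using (Fin; toℕ; fromℕ<)
open import Data.Fin.Properties using (toℕ-fromℕ<; all?)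
import Data.Integer as ℤ
import Data.Integer.Properties as ℤP
import Data.Integer.Tactic.RingSolver as ℤR
open import Data.List using ([]; _∷_; map; upTo; concatMap; _++_)
open import Data.List.Properties using (length-map; length-upTo; map-++; map-∘)
open import Data.List.Membership.Propositional using (_∈_)
open import Data.List.Membership.Propositional.Properties using (∈-map⁺; ∈-map⁻; ∈-++⁺ˡ; ∈-++⁺ʳ; ∈-++⁻; ∈-∃++; ∈-upTo⁺; ∈-upTo⁻)
open import Data.List.Relation.Unary.All as All using (All; []; _∷_)
import Data.List.Relation.Unary.All.Properties as AllP
open import Data.List.Relation.Unary.AllPairs using (AllPairs; []; _∷_)
import Data.List.Relation.Unary.AllPairs.Properties as APP
open import Data.List.Relation.Unary.Any using (here; there)
open import Data.List.Relation.Unary.Linked.Properties using (Linked⇒AllPairs)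
open import Data.List.Relation.Unary.Unique.Propositional using (Unique)
open import Data.List.Relation.Unary.Unique.Propositional.Properties using (map⁺; ++⁺; upTo⁺)
open import Data.Nat using (zero; suc; z≤n; s≤s; _∸_; _≡ᵇ_; _<ᵇ_; _≤ᵇ_; _⊔_; _⊓_)
open import Data.Nat.ListAction using (sum)
open import Data.Nat.Properties
open import Data.Nat.Tactic.RingSolver using (solve-∀)
open import Data.Product using (_,_; ∃-syntax; proj₁; proj₂)
open import Data.Product.Properties using (,-injectiveʳ)
open import Data.Sum using (inj₁; inj₂; [_,_]′)
open import Data.Unit using (tt)
open import Function using (_∘_; id)
open import Relation.Binary using (tri<; tri≈; tri>)
open import Relation.Binary.PropositionalEquality using (_≢_; _≗_; refl; sym; trans; cong; cong₂; subst; subst₂; ≢-sym; module ≡-Reasoning)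
open import Relation.Nullary using (Dec; yes; no)
open import Relation.Nullary.Decidable using (toWitness)

-- Each factor of N_{w,i} carries exponents (0 , 1) at i, i+1, and π_i kills such a monomial; this
-- is why P_w has no terms of T-degree 1. A product of two factors carries (0 , 2), and π_i
-- (x_{i+1}²) = - x_i x_{i+1}: hence the sign of the sum in the recursion and the special role of
-- the exponents (1 , 1). Before π_i is applied, a pair in that sum splits an exponent with one
-- square more than η. A squared variable lies in both parts, so k squares determine the part of
-- size k, and when k = l already k - 1 squares determine the unordered pair. The two values of |η₂|
-- in the theorem lie one below the range in which the coefficients vanish. Sets are handled as
-- indicator functions: the componentwise order becomes an inequality between partial sums, and
-- passing from w to s_i w alters only the partial sum that counts the elements ≤ i of w^l. Whether
-- a set stays in A_l thus depends on a single inequality.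

T→≡ : ∀ {b} → T b → b ≡ true
T→≡ {true} _ = refl

≡→T : ∀ {b} → b ≡ true → T b
≡→T refl = tt

¬T→≡ : ∀ {b} → ¬ T b → b ≡ false
¬T→≡ {true}  n = ⊥-elim (n tt)
¬T→≡ {false} _ = refl

≡ᵇ-true : ∀ {a b} → a ≡ b → (a ≡ᵇ b) ≡ true
≡ᵇ-true {a} {b} p = T→≡ (≡⇒≡ᵇ a b p)

≡ᵇ-false : ∀ {a b} → a ≢ b → (a ≡ᵇ b) ≡ false
≡ᵇ-false {a} {b} n = ¬T→≡ (λ t → n (≡ᵇ⇒≡ a b t))

≡ᵇ-sound : ∀ {a b} → (a ≡ᵇ b) ≡ true → a ≡ b
≡ᵇ-sound {a} {b} p = ≡ᵇ⇒≡ a b (≡→T p)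

≤1-cases : ∀ {n} → n ≤ 1 → n ≡ 0 ⊎ n ≡ 1
≤1-cases z≤n       = inj₁ refl
≤1-cases (s≤s z≤n) = inj₂ refl

-- Partial sums over the arguments below a bound

S : (ℕ → ℕ) → ℕ → ℕ
S χ zero    = 0
S χ (suc t) = S χ t + χ t

S-cong : ∀ {f g} → f ≗ g → ∀ t → S f t ≡ S g t
S-cong h zero    = refl
S-cong h (suc t) = cong₂ _+_ (S-cong h t) (h t)

S-mono : ∀ {f g} → (∀ j → f j ≤ g j) → ∀ t → S f t ≤ S g t
S-mono h zero    = z≤n
S-mono h (suc t) = +-mono-≤ (S-mono h t) (h t)

S-monoʳ : ∀ f {a t} → a ≤ t → S f a ≤ S f t
S-monoʳ f {t = zero}  z≤n = z≤n
S-monoʳ f {a} {suc t} a≤t with m≤n⇒m<n∨m≡n a≤t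
... | inj₁ (s≤s a≤) = ≤-trans (S-monoʳ f a≤) (m≤m+n _ _)
... | inj₂ refl     = ≤-refl

S-+ : ∀ f g t → S (λ j → f j + g j) t ≡ S f t + S g t
S-+ f g zero    = refl
S-+ f g (suc t) rewrite S-+ f g t = lem (S f t) (S g t) (f t) (g t)
  where
  lem : ∀ a b c d → a + b + (c + d) ≡ a + c + (b + d)
  lem = solve-∀

-- From a to t the sum of f grows by no more than that of g; the additive form avoids truncated
-- subtraction. This is how w^k ⊆ w^l enters.
S-minor : ∀ {f g} → (∀ j → f j ≤ g j) → ∀ {a t} → a ≤ t → S g a + S f t ≤ S g t + S f a
S-minor {f} {g} h {a} {t} a≤t = go a≤t
  where
  lem : ∀ a b c → a + (b + c) ≡ a + b + c
  lem = solve-∀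
  lem′ : ∀ a b c → a + b + c ≡ a + c + b
  lem′ = solve-∀
  go : ∀ {t} → a ≤ t → S g a + S f t ≤ S g t + S f a
  go {zero}  z≤n = ≤-refl
  go {suc t} a≤t with m≤n⇒m<n∨m≡n a≤t
  ... | inj₁ (s≤s a≤) = begin
      S g a + (S f t + f t)  ≡⟨ lem (S g a) (S f t) (f t) ⟩
      S g a + S f t + f t    ≤⟨ +-mono-≤ (go a≤) (h t) ⟩
      S g t + S f a + g t    ≡⟨ lem′ (S g t) (S f a) (g t) ⟩
      S g t + g t + S f a    ∎ where open ≤-Reasoning
  ... | inj₂ refl     = ≤-refl

-- Transpositions and their effect on partial sums

tr : ℕ → ℕ → ℕ → ℕ
tr a b j = if j ≡ᵇ a then b else (if j ≡ᵇ b then a else j)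

tr-l : ∀ a b → tr a b a ≡ b
tr-l a b rewrite ≡ᵇ-true {a} refl = refl

tr-r : ∀ a b → tr a b b ≡ a
tr-r a b with b ≡ᵇ a in eq
... | true  = ≡ᵇ-sound {b} eq
... | false rewrite ≡ᵇ-true {b} refl = refl

tr-o : ∀ {a b j} → j ≢ a → j ≢ b → tr a b j ≡ j
tr-o p q rewrite ≡ᵇ-false p | ≡ᵇ-false q = refl

data TrView (a b : ℕ) : ℕ → Set where
  atL : TrView a b a
  atR : TrView a b b
  off : ∀ {j} → j ≢ a → j ≢ b → TrView a b j

trView : ∀ a b j → TrView a b j
trView a b j with j ≟ a
... | yes refl = atL
... | no p with j ≟ b
...   | yes refl = atR
...   | no q     = off p q

tr-invol : ∀ a b j → tr a b (tr a b j) ≡ j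
tr-invol a b j with trView a b j
... | atL     = trans (cong (tr a b) (tr-l a b)) (tr-r a b)
... | atR     = trans (cong (tr a b) (tr-r a b)) (tr-l a b)
... | off p q = trans (cong (tr a b) (tr-o p q)) (tr-o p q)

module _ (χ : ℕ → ℕ) {a b : ℕ} (a<b : a < b) where
  S-tr-lo : ∀ {t} → t ≤ a → S (χ ∘ tr a b) t ≡ S χ t
  S-tr-lo {zero}  _ = refl
  S-tr-lo {suc t} h = cong₂ _+_ (S-tr-lo (<⇒≤ h))
    (cong χ (tr-o (<⇒≢ h) (<⇒≢ (<-trans h a<b))))

  S-tr-mid : ∀ {t} → a < t → t ≤ b → S (χ ∘ tr a b) t + χ a ≡ S χ t + χ b
  S-tr-mid {suc t} (s≤s a≤t) t<b with m≤n⇒m<n∨m≡n a≤t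
  ... | inj₂ refl = begin
      S (χ ∘ tr a b) a + χ (tr a b a) + χ a ≡⟨ cong₂ (λ u v → u + χ v + χ a) (S-tr-lo ≤-refl) (tr-l a b) ⟩
      S χ a + χ b + χ a                     ≡⟨ lem (S χ a) (χ b) (χ a) ⟩
      S χ a + χ a + χ b                     ∎
    where
    open ≡-Reasoning
    lem : ∀ x y z → x + y + z ≡ x + z + y
    lem = solve-∀
  ... | inj₁ a<t = begin
      S (χ ∘ tr a b) t + χ (tr a b t) + χ a ≡⟨ cong (λ v → S (χ ∘ tr a b) t + χ v + χ a) (tr-o (>⇒≢ a<t) (<⇒≢ t<b)) ⟩
      S (χ ∘ tr a b) t + χ t + χ a          ≡⟨ lem (S (χ ∘ tr a b) t) (χ t) (χ a) ⟩
      S (χ ∘ tr a b) t + χ a + χ t          ≡⟨ cong (_+ χ t) (S-tr-mid a<t (<⇒≤ t<b)) ⟩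
      S χ t + χ b + χ t                     ≡⟨ lem (S χ t) (χ b) (χ t) ⟩
      S χ t + χ t + χ b                     ∎
    where
    open ≡-Reasoning
    lem : ∀ x y z → x + y + z ≡ x + z + y
    lem = solve-∀

  S-tr-hi : ∀ {t} → b < t → S (χ ∘ tr a b) t ≡ S χ t
  S-tr-hi {suc t} (s≤s b≤t) with m≤n⇒m<n∨m≡n b≤t
  ... | inj₂ refl = trans (cong (λ v → S (χ ∘ tr a b) b + χ v) (tr-r a b)) (S-tr-mid a<b ≤-refl)
  ... | inj₁ b<t  = cong₂ _+_ (S-tr-hi b<t) (cong χ (tr-o (>⇒≢ (<-trans a<b b<t)) (>⇒≢ b<t)))

-- Indicator functions of the l-subsets of ℕ⁺ lying componentwise below the set with
-- indicator function ω, in terms of the counting functions S.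
record 𝒜 (ω : ℕ → ℕ) (l : ℕ) (χ : ℕ → ℕ) : Set where
  constructor mk𝒜
  field
    bin : ∀ j → χ j ≤ 1
    lo  : ∀ t → S ω t ≤ S χ t
    hi  : ∀ t → S χ t ≤ l
    at0 : χ 0 ≡ 0
open 𝒜 public

𝒜-cong : ∀ {ω l χ ξ} → χ ≗ ξ → 𝒜 ω l χ → 𝒜 ω l ξ
𝒜-cong {ω} {l} h A = mk𝒜 (λ j → subst (_≤ 1) (h j) (bin A j))
  (λ t → subst (S ω t ≤_) (S-cong h t) (lo A t))
  (λ t → subst (_≤ l) (S-cong h t) (hi A t))
  (trans (sym (h 0)) (at0 A))

-- The exchange changes only the partial sums at t with a < t ≤ b, by χ b - χ a, so only there does
-- the lower bound need a hypothesis.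
𝒜-tr : ∀ {ω l χ a b} → 𝒜 ω l χ → 1 ≤ a → a < b →
  (∀ {t} → a < t → t ≤ b → S ω t + χ a ≤ S χ t + χ b) → 𝒜 ω l (χ ∘ tr a b)
𝒜-tr {ω} {l} {χ} {a} {b} A 1≤a a<b h = mk𝒜 (λ j → bin A (tr a b j)) lo′ hi′
  (trans (cong χ (tr-o (<⇒≢ 1≤a) (<⇒≢ (<-trans 1≤a a<b)))) (at0 A))
  where
  lo′ : ∀ t → S ω t ≤ S (χ ∘ tr a b) t
  lo′ t with t ≤? a | t ≤? b
  ... | yes p | _     = subst (S ω t ≤_) (sym (S-tr-lo χ a<b p)) (lo A t)
  ... | no _  | no q  = subst (S ω t ≤_) (sym (S-tr-hi χ a<b (≰⇒> q))) (lo A t)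
  ... | no p  | yes q = +-cancelʳ-≤ (χ a) _ _
    (subst (S ω t + χ a ≤_) (sym (S-tr-mid χ a<b (≰⇒> p) q)) (h (≰⇒> p) q))
  hi′ : ∀ t → S (χ ∘ tr a b) t ≤ l
  hi′ t with t ≤? b
  ... | yes q = ≤-trans (S-monoʳ (χ ∘ tr a b) {t} {suc b} (m≤n⇒m≤1+n q))
                  (subst (_≤ l) (sym (S-tr-hi χ a<b ≤-refl)) (hi A (suc b)))
  ... | no q  = subst (_≤ l) (sym (S-tr-hi χ a<b (≰⇒> q))) (hi A t)

𝒜-tr-down : ∀ {ω l χ a b} → 𝒜 ω l χ → 1 ≤ a → a < b → χ a ≤ χ b → 𝒜 ω l (χ ∘ tr a b)
𝒜-tr-down A 1≤a a<b h = 𝒜-tr A 1≤a a<b (λ {t} _ _ → +-mono-≤ (lo A t) h)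

s-l : ∀ i → s i i ≡ suc i
s-l i = tr-l i (suc i)

s-r : ∀ i → s i (suc i) ≡ i
s-r i = tr-r i (suc i)

s-invol : ∀ i j → s i (s i j) ≡ j
s-invol i = tr-invol i (suc i)

-- ω ∘ s i is the indicator function of (s_i w)^l when ω is the one of w^l; i precedes i+1 in w.
module Step {i : ℕ} (1≤i : 1 ≤ i) {ω : ℕ → ℕ} {l : ℕ}
            (ω≤1 : ∀ j → ω j ≤ 1) (ω-desc : ω (suc i) ≤ ω i) where

  ω′ : ℕ → ℕ
  ω′ = ω ∘ s i

  S-away : ∀ t → t ≢ suc i → S ω′ t ≡ S ω t
  S-away t ne with t ≤? i
  ... | yes p = S-tr-lo ω (n<1+n i) p
  ... | no p  = S-tr-hi ω (n<1+n i) (≤∧≢⇒< (≰⇒> p) (≢-sym ne))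

  S-at : S ω′ (suc i) ≡ S ω i + ω (suc i)
  S-at = cong₂ _+_ (S-tr-lo ω (n<1+n i) ≤-refl) (cong ω (s-l i))

  S-at2 : S ω′ (suc (suc i)) ≡ S ω (suc (suc i))
  S-at2 = S-away _ λ ()

  weaken : ∀ {χ} → 𝒜 ω l χ → 𝒜 ω′ l χ
  weaken {χ} A = mk𝒜 (bin A) lo′ (hi A) (at0 A)
    where
    lo′ : ∀ t → S ω′ t ≤ S χ t
    lo′ t with t ≟ suc i
    ... | no ne    = subst (_≤ S χ t) (sym (S-away t ne)) (lo A t)
    ... | yes refl = subst (_≤ S χ t) (sym S-at) (≤-trans (+-monoʳ-≤ (S ω i) ω-desc) (lo A (suc i)))

  strengthen : ∀ {χ} → 𝒜 ω′ l χ → S ω (suc i) ≤ S χ (suc i) → 𝒜 ω l χ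
  strengthen {χ} A h = mk𝒜 (bin A) lo′ (hi A) (at0 A)
    where
    lo′ : ∀ t → S ω t ≤ S χ t
    lo′ t with t ≟ suc i
    ... | no ne    = subst (_≤ S χ t) (S-away t ne) (lo A t)
    ... | yes refl = h

  𝒜? : ∀ {χ} → 𝒜 ω′ l χ → Dec (𝒜 ω l χ)
  𝒜? {χ} A with S ω (suc i) ≤? S χ (suc i)
  ... | yes p = yes (strengthen A p)
  ... | no p  = no (λ A′ → p (lo A′ (suc i)))

  -- The inequality at `suc i` is the only one at stake. It follows from that at `i` unless ω
  -- contains i and χ does not; then χ omits i+1 as well, and the inequality at `suc (suc i)` gives
  -- it.
  strengthen-desc : ∀ {χ} → 𝒜 ω′ l χ → χ (suc i) ≤ χ i → 𝒜 ω l χ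
  strengthen-desc {χ} A h = strengthen A (go (≤1-cases (ω≤1 i)) (≤1-cases (bin A i)))
    where
    go : ω i ≡ 0 ⊎ ω i ≡ 1 → χ i ≡ 0 ⊎ χ i ≡ 1 → S ω i + ω i ≤ S χ i + χ i
    lo-i : S ω i ≤ S χ i
    lo-i = subst (_≤ S χ i) (S-away i (<⇒≢ (n<1+n i))) (lo A i)
    go (inj₁ p) _ = +-mono-≤ lo-i (subst (_≤ χ i) (sym p) z≤n)
    go (inj₂ p) (inj₂ q) = +-mono-≤ lo-i (subst₂ _≤_ (sym p) (sym q) ≤-refl)
    go (inj₂ p) (inj₁ q) = begin
      S ω (suc i)                ≤⟨ m≤m+n _ (ω (suc i)) ⟩
      S ω (suc (suc i))          ≡⟨ S-at2 ⟨
      S ω′ (suc (suc i))         ≤⟨ lo A (suc (suc i)) ⟩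
      S χ i + χ i + χ (suc i)    ≤⟨ +-monoʳ-≤ (S χ (suc i)) (subst (χ (suc i) ≤_) q h) ⟩
      S χ i + χ i + 0            ≡⟨ +-identityʳ _ ⟩
      S χ i + χ i                ∎ where open ≤-Reasoning

  private
    full : ∀ {χ} → (∀ j → χ j ≤ 1) → S ω (suc (suc i)) ≤ S χ (suc (suc i)) → ω (suc i) ≡ 1 →
      S ω i + 1 + χ i ≤ S χ (suc (suc i))
    full {χ} b1 h p = begin
      S ω i + 1 + χ i             ≤⟨ +-monoʳ-≤ (S ω i + 1) (b1 i) ⟩
      S ω i + 1 + 1               ≡⟨ cong₂ (λ u v → S ω i + u + v) ωi (sym p) ⟩
      S ω i + ω i + ω (suc i)     ≤⟨ h ⟩
      S χ (suc (suc i))           ∎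
      where
      open ≤-Reasoning
      ωi : 1 ≡ ω i
      ωi = ≤-antisym (subst (_≤ ω i) p ω-desc) (ω≤1 i)

  -- ω′ contains i only if ω contains both i and i+1. If it does not, the bound at `i` suffices; if
  -- it does, the bound at `suc (suc i)` leaves enough room.
  swap′ : ∀ {χ} → 𝒜 ω′ l χ → 𝒜 ω′ l (χ ∘ s i)
  swap′ {χ} A = 𝒜-tr A 1≤i (n<1+n i) λ {t} p q → subst (λ t → S ω′ t + χ i ≤ S χ t + χ (suc i)) (≤-antisym p q)
    (subst (λ u → u + χ i ≤ S χ (suc (suc i))) (sym S-at) (go (≤1-cases (ω≤1 (suc i)))))
    where
    lo-i : S ω i ≤ S χ i
    lo-i = subst (_≤ S χ i) (S-away i (<⇒≢ (n<1+n i))) (lo A i)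
    go : ω (suc i) ≡ 0 ⊎ ω (suc i) ≡ 1 → S ω i + ω (suc i) + χ i ≤ S χ (suc (suc i))
    go (inj₁ p) = begin
      S ω i + ω (suc i) + χ i  ≡⟨ cong (λ u → S ω i + u + χ i) p ⟩
      S ω i + 0 + χ i          ≡⟨ cong (_+ χ i) (+-identityʳ _) ⟩
      S ω i + χ i              ≤⟨ +-monoˡ-≤ (χ i) lo-i ⟩
      S χ (suc i)              ≤⟨ m≤m+n _ _ ⟩
      S χ (suc (suc i))        ∎ where open ≤-Reasoning
    go (inj₂ p) = subst (λ u → S ω i + u + χ i ≤ S χ (suc (suc i))) (sym p)
      (full (bin A) (subst (_≤ S χ (suc (suc i))) S-at2 (lo A (suc (suc i)))) p)

  -- For large l the set w^l contains i+1, so A_{l,i}(w) is empty; this is what makes the truncated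
  -- product over l harmless.
  swap-full : ∀ {χ} → 𝒜 ω l χ → ω (suc i) ≡ 1 → 𝒜 ω l (χ ∘ s i)
  swap-full {χ} A p = 𝒜-tr A 1≤i (n<1+n i) λ {t} q r → subst (λ t → S ω t + χ i ≤ S χ t + χ (suc i)) (≤-antisym q r)
    (≤-trans (+-monoˡ-≤ (χ i) (+-monoʳ-≤ (S ω i) (ω≤1 i))) (full (bin A) (lo A _) p))

  leaves : ∀ {χ} → 𝒜 ω l χ → ¬ 𝒜 ω l (χ ∘ s i) → χ i ≡ 1 × χ (suc i) ≡ 0
  leaves {χ} A n with χ i ≤? χ (suc i)
  ... | yes p = ⊥-elim (n (𝒜-tr-down A 1≤i (n<1+n i) p))
  ... | no p with ≤1-cases (bin A i) | ≤1-cases (bin A (suc i))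
  ...   | inj₁ q | _      = ⊥-elim (p (subst (_≤ χ (suc i)) (sym q) z≤n))
  ...   | inj₂ q | inj₂ r = ⊥-elim (p (≤-reflexive (trans q (sym r))))
  ...   | inj₂ q | inj₁ r = q , r

  -- Moving i up to i+1 lowers only the number of elements ≤ i, by at most one. If this leads out of
  -- A_l(w), that number was already the least possible.
  tight : ∀ {χ} → 𝒜 ω l χ → ¬ 𝒜 ω l (χ ∘ s i) → S χ (suc i) ≤ S ω (suc i)
  tight {χ} A n with S χ (suc i) ≤? S ω (suc i)
  ... | yes p = p
  ... | no p  = ⊥-elim (n (𝒜-tr A 1≤i (n<1+n i) λ {t} q r →
    subst (λ t → S ω t + χ i ≤ S χ t + χ (suc i)) (≤-antisym q r) (begin
      S ω (suc i) + χ i  ≤⟨ +-monoʳ-≤ (S ω (suc i)) (bin A i) ⟩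
      S ω (suc i) + 1    ≡⟨ +-comm _ 1 ⟩
      suc (S ω (suc i))  ≤⟨ ≰⇒> p ⟩
      S χ (suc i)        ≤⟨ m≤m+n _ _ ⟩
      S χ (suc i) + χ (suc i) ∎)))
    where open ≤-Reasoning

-- Splittings of an exponent into elements of A_l(w) and A_k(w)

record Split (ωk ωl : ℕ → ℕ) (k l : ℕ) (e α β : ℕ → ℕ) : Set where
  constructor mkSplit
  field
    inL : 𝒜 ωl l α
    inK : 𝒜 ωk k β
    tot : ∀ j → α j + β j ≡ e j
open Split public

Distinct : (α β α̃ β̃ : ℕ → ℕ) → Set
Distinct α β α̃ β̃ = ¬ α ≗ α̃ × ¬ α ≗ β̃ × ¬ β ≗ α̃ × ¬ β ≗ β̃

TwoSplits : (ωk ωl : ℕ → ℕ) (k l : ℕ) (e : ℕ → ℕ) → Set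
TwoSplits ωk ωl k l e = ∃[ α ] ∃[ β ] ∃[ α̃ ] ∃[ β̃ ]
  (Split ωk ωl k l e α β × Split ωk ωl k l e α̃ β̃ × Distinct α β α̃ β̃)

differ : ∀ {f g : ℕ → ℕ} j {a b} → f j ≡ a → g j ≡ b → a ≢ b → ¬ f ≗ g
differ j p q n h = n (trans (sym p) (trans (h j) q))

0≢1 : 0 ≢ 1
0≢1 ()

1≢0 : 1 ≢ 0
1≢0 ()

module Walk {ωk ωl : ℕ → ℕ} {k l : ℕ} (ωk≤ωl : ∀ j → ωk j ≤ ωl j)
            {α β : ℕ → ℕ} (A : 𝒜 ωl l α) (B : 𝒜 ωk k β) where

  -- An element that α has and β lacks, together with the slack that `𝒜-tr` asks of the set whose
  -- element moves up: of β when its c is exchanged for b above, of α when its b is exchanged for i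
  -- above.
  Above Below : ℕ → Set
  Above c = ∃[ b ] (c < b × α b ≡ 1 × β b ≡ 0 × (∀ {t} → c < t → t ≤ b → S ωk t + 1 ≤ S β t))
  Below i = ∃[ b ] (b < i × α b ≡ 1 × β b ≡ 0 × (∀ {t} → b < t → t ≤ i → S ωl t + 1 ≤ S α t))

  private
    clash : ∀ {x y z} → x + 1 ≤ y → y ≡ z → z ≤ x → ⊥
    clash {x} {y} p refl q = <-irrefl refl (<-≤-trans (subst (_≤ y) (+-comm x 1) p) q)

    advance : ∀ {a b c d x y} → x ≤ y → a + d + 1 ≤ b + c → a + x + d + 1 ≤ b + y + c
    advance {a} {b} {c} {d} {x} {y} x≤y h = begin
      a + x + d + 1    ≡⟨ lem₁ a x d ⟩
      a + d + 1 + x    ≤⟨ +-mono-≤ h x≤y ⟩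
      b + c + y        ≡⟨ lem₂ b c y ⟩
      b + y + c        ∎
      where
      open ≤-Reasoning
      lem₁ : ∀ a x d → a + x + d + 1 ≡ a + d + 1 + x
      lem₁ = solve-∀
      lem₂ : ∀ b c y → b + c + y ≡ b + y + c
      lem₂ = solve-∀

    retreat : ∀ {a b c d x y} → y ≤ x → c + (b + x) + 1 ≤ d + (a + y) → c + b + 1 ≤ d + a
    retreat {a} {b} {c} {d} {x} {y} y≤x h = +-cancelʳ-≤ x _ _ (begin
      c + b + 1 + x    ≡⟨ lem₁ c b x ⟩
      c + (b + x) + 1  ≤⟨ h ⟩
      d + (a + y)      ≤⟨ +-monoʳ-≤ d (+-monoʳ-≤ a y≤x) ⟩
      d + (a + x)      ≡⟨ +-assoc d a x ⟨
      d + a + x        ∎)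
      where
      open ≤-Reasoning
      lem₁ : ∀ c b x → c + b + 1 + x ≡ c + (b + x) + 1
      lem₁ = solve-∀

    exchange? : ∀ {x y} → x ≤ 1 → y ≤ 1 → (x ≡ 1 × y ≡ 0) ⊎ x ≤ y
    exchange? z≤n       _         = inj₂ z≤n
    exchange? (s≤s z≤n) z≤n       = inj₁ (refl , refl)
    exchange? (s≤s z≤n) (s≤s z≤n) = inj₂ ≤-refl

    ≤-from-≰ : ∀ {x y} → ¬ (x + 1 ≤ y) → y ≤ x
    ≤-from-≰ {x} {y} n = ≤-pred (subst (y <_) (+-comm x 1) (≰⇒> n))

  -- Invariant `J`: β has more elements than α from c up to below t. By `strict` such a surplus
  -- forces slack of β at t. There is no slack at E, where all k elements of w^k have been counted,
  -- so the surplus cannot persist and the walk meets an element of α outside β.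
  up : ∀ c → S α c ≤ S ωl c → α c ≡ 0 → β c ≡ 1 → ∀ {E} → k ≤ S ωk E →
    Above c
  up c tight αc βc {E} end = go E (suc c) ≤-refl (m≤n+m E (suc c))
    (≤-reflexive (subst₂ (λ u v → S α c + u + S β c + 1 ≡ S β c + v + S α c) (sym αc) (sym βc)
      (lem (S α c) (S β c))))
    (λ p q → ⊥-elim (<-irrefl refl (<-≤-trans p (≤-pred q))))
    where
    lem : ∀ x y → x + 0 + y + 1 ≡ y + 1 + x
    lem = solve-∀
    strict : ∀ t → c ≤ t → S α t + S β c + 1 ≤ S β t + S α c → S ωk t + 1 ≤ S β t
    strict t c≤t J with S ωk t + 1 ≤? S β t
    ... | yes p = p
    -- Without slack, S α c + S β t ≤ S ωl c + S ωk t ≤ S ωl t + S ωk c ≤ S α t + S β c, against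
    -- `J`.
    ... | no n  = ⊥-elim (clash J (+-comm (S β t) (S α c))
      (≤-trans (+-mono-≤ tight (≤-from-≰ n)) (≤-trans (S-minor ωk≤ωl c≤t) (+-mono-≤ (lo A t) (lo B c)))))
    go : ∀ n t → c < t → E ≤ t + n → S α t + S β c + 1 ≤ S β t + S α c →
      (∀ {t′} → c < t′ → t′ < t → S ωk t′ + 1 ≤ S β t′) →
      Above c
    go zero t c<t E≤ J old = ⊥-elim (clash (strict t (<⇒≤ c<t) J) refl
      (≤-trans (hi B t) (≤-trans end (S-monoʳ ωk (subst (E ≤_) (+-identityʳ t) E≤)))))
    go (suc n) t c<t E≤ J old = case (exchange? (bin A t) (bin B t))
      where
      now : ∀ {t′} → c < t′ → t′ ≤ t → S ωk t′ + 1 ≤ S β t′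
      now c<t′ t′≤t with m≤n⇒m<n∨m≡n t′≤t
      ... | inj₁ t′<t = old c<t′ t′<t
      ... | inj₂ refl = strict t (<⇒≤ c<t) J
      case : (α t ≡ 1 × β t ≡ 0) ⊎ α t ≤ β t → Above c
      case (inj₁ (p , q)) = t , c<t , p , q , now
      case (inj₂ p) = go n (suc t) (m<n⇒m<1+n c<t) (subst (E ≤_) (+-suc t n) E≤) (advance {S α t} {S β t} {S α c} {S β c} p J)
        (λ u v → now u (≤-pred v))

  -- Mirror image of `up`: β has more elements than α from t up to i, β is tight at `suc i`, and the
  -- slack obtained is that of α. At 0 slack is impossible, which bounds the walk.
  down : ∀ i → S β (suc i) ≤ S ωk (suc i) → α i ≡ 0 → β i ≡ 1 →
    Below i
  down i tight αi βi = go i ≤-refl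
    (≤-reflexive (subst₂ (λ u v → S α i + u + S β i + 1 ≡ S β i + v + S α i) (sym αi) (sym βi)
      (lem (S α i) (S β i))))
    (λ p q → ⊥-elim (<-irrefl refl (<-≤-trans p q)))
    where
    lem : ∀ x y → x + 0 + y + 1 ≡ y + 1 + x
    lem = solve-∀
    strict : ∀ t → t ≤ i → S α (suc i) + S β t + 1 ≤ S β (suc i) + S α t → S ωl t + 1 ≤ S α t
    strict t t≤i J with S ωl t + 1 ≤? S α t
    ... | yes p = p
    ... | no n  = ⊥-elim (clash J (+-comm (S β (suc i)) (S α t))
      (≤-trans (+-mono-≤ (≤-from-≰ n) tight)
        (≤-trans (S-minor ωk≤ωl (m≤n⇒m≤1+n t≤i)) (+-mono-≤ (lo A (suc i)) (lo B t)))))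
    go : ∀ t → t ≤ i → S α (suc i) + S β t + 1 ≤ S β (suc i) + S α t →
      (∀ {t′} → t < t′ → t′ ≤ i → S ωl t′ + 1 ≤ S α t′) →
      Below i
    go zero t≤i J old with strict 0 t≤i J
    ... | ()
    go (suc t) t<i J old = case (exchange? (bin A t) (bin B t))
      where
      now : ∀ {t′} → t < t′ → t′ ≤ i → S ωl t′ + 1 ≤ S α t′
      now t<t′ t′≤i with m≤n⇒m<n∨m≡n t<t′
      ... | inj₁ t<  = old t< t′≤i
      ... | inj₂ refl = strict (suc t) t<i J
      case : (α t ≡ 1 × β t ≡ 0) ⊎ α t ≤ β t → Below i
      case (inj₁ (p , q)) = t , t<i , p , q , now
      case (inj₂ p) = go t (<⇒≤ t<i) (retreat {S α t} {S β t} {S α (suc i)} {S β (suc i)} p J) now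

module SplitStep {i : ℕ} (1≤i : 1 ≤ i) {ωk ωl : ℕ → ℕ} {k l : ℕ}
  (ωk≤1 : ∀ j → ωk j ≤ 1) (ωl≤1 : ∀ j → ωl j ≤ 1)
  (ωk-desc : ωk (suc i) ≤ ωk i) (ωl-desc : ωl (suc i) ≤ ωl i)
  (ωk≤ωl : ∀ j → ωk j ≤ ωl j) (E : ℕ) (k≤ : k ≤ S ωk E) (e : ℕ → ℕ) where

  module K = Step 1≤i {ωk} {k} ωk≤1 ωk-desc
  module L = Step 1≤i {ωl} {l} ωl≤1 ωl-desc

  Sp Sp′ : (e α β : ℕ → ℕ) → Set
  Sp  = Split ωk ωl k l
  Sp′ = Split (ωk ∘ s i) (ωl ∘ s i) k l

  -- The pairs subtracted in the recursion. The product of two factors has exponent s_i α + s_i β,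
  -- with (0 , 2) at i, i+1; π_i turns this into (1 , 1), which is α + s_i β.
  record Extra (α β : ℕ → ℕ) : Set where
    constructor mkExtra
    field
      exL  : 𝒜 ωl l α
      exL∉ : ¬ 𝒜 ωl l (α ∘ s i)
      exK  : 𝒜 ωk k β
      exK∉ : ¬ 𝒜 ωk k (β ∘ s i)
      exT  : ∀ j → α j + β (s i j) ≡ e j
  open Extra public

  -- α and β have the fewest elements ≤ i that A(w) allows, and s_i β has one fewer still; no
  -- splitting in A(w) can match that total.
  extra-excludes : ∀ {α β α̃ β̃} → Extra α β → ¬ Sp e α̃ β̃
  extra-excludes {α} {β} {α̃} {β̃} X Y = <-irrefl refl (begin-strict
    S α (suc i) + (S β i + 0)           <⟨ +-monoʳ-< (S α (suc i)) (+-monoʳ-< (S β i) (≤-reflexive (sym β-l))) ⟩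
    S α (suc i) + (S β i + β i)         ≤⟨ +-mono-≤ (L.tight (exL X) (exL∉ X)) (K.tight (exK X) (exK∉ X)) ⟩
    S ωl (suc i) + S ωk (suc i)         ≤⟨ +-mono-≤ (lo (inL Y) (suc i)) (lo (inK Y) (suc i)) ⟩
    S α̃ (suc i) + S β̃ (suc i)           ≡⟨ S-+ α̃ β̃ (suc i) ⟨
    S (λ j → α̃ j + β̃ j) (suc i)         ≡⟨ S-cong (λ j → trans (tot Y j) (sym (exT X j))) (suc i) ⟩
    S (λ j → α j + β (s i j)) (suc i)   ≡⟨ S-+ α (β ∘ s i) (suc i) ⟩
    S α (suc i) + S (β ∘ s i) (suc i)   ≡⟨ cong₂ (λ u v → S α (suc i) + (u + v))
                                              (S-tr-lo β (n<1+n i) ≤-refl) (trans (cong β (s-l i)) β-r) ⟩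
    S α (suc i) + (S β i + 0)           ∎)
    where
    open ≤-Reasoning
    β-l = proj₁ (K.leaves (exK X) (exK∉ X))
    β-r = proj₂ (K.leaves (exK X) (exK∉ X))

  -- `apart` excludes the coincidence α = s_i β, in which a split and its image under s_i are the
  -- same unordered pair. It is supplied later by counting sizes and squares.
  module _ (apart : ∀ {α β} → Sp′ e α β → α i ≡ 1 → β (suc i) ≡ 1 → ¬ α ≗ β ∘ s i)
           (e-l : e i ≡ 1) (e-r : e (suc i) ≡ 1) where

    private
      e∘s : e ∘ s i ≗ e
      e∘s j with trView i (suc i) j
      ... | atL     = trans (cong e (s-l i)) (trans e-r (sym e-l))
      ... | atR     = trans (cong e (s-r i)) (trans e-l (sym e-r))
      ... | off p q = cong e (tr-o p q)

      e∘tr : ∀ {a b} → e a ≡ 1 → e b ≡ 1 → e ∘ tr a b ≗ e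
      e∘tr {a} {b} p q j with trView a b j
      ... | atL     = trans (cong e (tr-l a b)) (trans q (sym p))
      ... | atR     = trans (cong e (tr-r a b)) (trans p (sym q))
      ... | off u v = cong e (tr-o u v)

      re-tot : ∀ {f g h : ℕ → ℕ} {e′ : ℕ → ℕ} → (∀ j → f j + g j ≡ e′ j) → e′ ≗ h → ∀ j → f j + g j ≡ h j
      re-tot t h j = trans (t j) (h j)

    -- The splits are (α , s_i β) and (s_i α , β), with equal totals because e takes the same value
    -- at i and i+1. They lie in A(s_i w), which is stable under s_i.
    extra⇒two : ∀ {α β} → Extra α β → TwoSplits (ωk ∘ s i) (ωl ∘ s i) k l e
    extra⇒two {α} {β} X = α , β ∘ s i , α ∘ s i , β , sp , sp₂ ,
      differ i α-l (trans (cong α (s-l i)) α-r) 1≢0 ,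
      (λ h → apart sp α-l (trans (cong β (s-r i)) β-l) (λ j → trans (h j) (cong β (sym (s-invol i j))))) ,
      (λ h → apart sp α-l (trans (cong β (s-r i)) β-l)
        (λ j → trans (cong α (sym (s-invol i j))) (sym (h (s i j))))) ,
      differ i (trans (cong β (s-l i)) β-r) β-l 0≢1
      where
      α-l = proj₁ (L.leaves (exL X) (exL∉ X))
      α-r = proj₂ (L.leaves (exL X) (exL∉ X))
      β-l = proj₁ (K.leaves (exK X) (exK∉ X))
      β-r = proj₂ (K.leaves (exK X) (exK∉ X))
      sp  = mkSplit (L.weaken (exL X)) (K.swap′ (K.weaken (exK X))) (exT X)
      sp₂ = mkSplit (L.swap′ (L.weaken (exL X))) (K.weaken (exK X))
        (λ j → trans (cong (λ v → α (s i j) + β v) (sym (s-invol i j))) (trans (exT X (s i j)) (e∘s j)))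

    module _ (noExtra : ∀ {α β} → ¬ Extra α β) where

      -- α and β ∘ s i lie in A(w); α ∘ s i and β need not.  If both do, (α , β) and its image
      -- under s i are two splits; if just one does, a second split is obtained by exchanging
      -- i+1 or i with the element found by Walk.
      crossing : ∀ {α β} → Sp′ e α β → α i ≡ 1 → α (suc i) ≡ 0 → β i ≡ 0 → β (suc i) ≡ 1 →
        TwoSplits ωk ωl k l e
      crossing {α} {β} Y α-l α-r β-l β-r = go (L.𝒜? (L.swap′ (inL Y))) (K.𝒜? (inK Y))
        where
        αA : 𝒜 ωl l α
        αA = L.strengthen-desc (inL Y) (subst (_≤ α i) (sym α-r) z≤n)
        sα-l : α (s i i) ≡ 0
        sα-l = trans (cong α (s-l i)) α-r
        sα-r : α (s i (suc i)) ≡ 1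
        sα-r = trans (cong α (s-r i)) α-l
        sβ-l : β (s i i) ≡ 1
        sβ-l = trans (cong β (s-l i)) β-r
        sβ-r : β (s i (suc i)) ≡ 0
        sβ-r = trans (cong β (s-r i)) β-l
        βA : 𝒜 ωk k (β ∘ s i)
        βA = K.strengthen-desc (K.swap′ (inK Y)) (subst (_≤ β (s i i)) (sym sβ-r) z≤n)
        β-ss : β ≗ β ∘ s i ∘ s i
        β-ss j = cong β (sym (s-invol i j))
        tot′ : ∀ j → α (s i j) + β (s i j) ≡ e j
        tot′ = re-tot {α ∘ s i} {β ∘ s i} (λ j → tot Y (s i j)) e∘s
        go : Dec (𝒜 ωl l (α ∘ s i)) → Dec (𝒜 ωk k β) → TwoSplits ωk ωl k l e
        go (no p) (no q) = ⊥-elim (noExtra {α} {β ∘ s i} (mkExtra αA p βA (λ a → q (𝒜-cong (λ j → sym (β-ss j)) a))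
          (λ j → trans (cong (λ v → α j + β v) (s-invol i j)) (tot Y j))))
        go (yes p) (yes q) = α , β , α ∘ s i , β ∘ s i , mkSplit αA q (tot Y) , mkSplit p βA tot′ ,
          differ i α-l sα-l 1≢0 , apart Y α-l β-r ,
          (λ h → apart Y α-l β-r (λ j → trans (cong α (sym (s-invol i j))) (sym (h (s i j))))) ,
          differ i β-l sβ-l 0≢1
        -- As s_i α is not in A(w), α is tight at `suc i`; the walk starts from i+1, which β has and
        -- α lacks. Both i+1 and the element found have multiplicity 1, so exchanging them keeps e.
        go (no p) (yes q) with Walk.up {ωk} {ωl} ωk≤ωl αA q (suc i) (L.tight αA p) α-r β-r {E} k≤
        ... | b , i<b , αb , βb , h =
          α , β , α ∘ τ , β ∘ τ , mkSplit αA q (tot Y) ,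
          mkSplit (𝒜-tr-down αA (s≤s z≤n) i<b (subst (_≤ α b) (sym α-r) z≤n))
            (𝒜-tr q (s≤s z≤n) i<b (λ {t} u v → subst₂ (λ x y → S ωk t + x ≤ S β t + y) (sym β-r) (sym βb)
              (subst (S ωk t + 1 ≤_) (sym (+-identityʳ _)) (h u v))))
            (re-tot {α ∘ τ} {β ∘ τ} (λ j → tot Y (τ j)) (e∘tr e-r (trans (sym (tot Y b)) (cong₂ _+_ αb βb)))) ,
          differ (suc i) α-r ατ-r 0≢1 , differ i α-l βτ-l 1≢0 , differ i β-l ατ-l 0≢1 , differ (suc i) β-r βτ-r 1≢0
          where
          τ = tr (suc i) b
          τi : τ i ≡ i
          τi = tr-o (<⇒≢ (n<1+n i)) (<⇒≢ (<-trans (n<1+n i) i<b))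
          ατ-l = trans (cong α τi) α-l
          βτ-l = trans (cong β τi) β-l
          ατ-r = trans (cong α (tr-l (suc i) b)) αb
          βτ-r = trans (cong β (tr-l (suc i) b)) βb
        -- Here the split at hand is (s_i α , s_i β), and s_i β is tight because applying s_i to it
        -- leads out of A(w); the walk descends from i.
        go (yes p) (no q) with Walk.down {ωk} {ωl} ωk≤ωl p βA i
          (K.tight βA (λ a → q (𝒜-cong (λ j → sym (β-ss j)) a))) sα-l sβ-l
        ... | b , b<i , αb , βb , h =
          α ∘ s i , β ∘ s i , α ∘ s i ∘ τ , β ∘ s i ∘ τ , mkSplit p βA tot′ ,
          mkSplit (𝒜-tr p 1≤b b<i (λ {t} u v → subst₂ (λ x y → S ωl t + x ≤ S (α ∘ s i) t + y) (sym αb) (sym sα-l)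
              (subst (S ωl t + 1 ≤_) (sym (+-identityʳ _)) (h u v))))
            (𝒜-tr-down βA 1≤b b<i (subst (_≤ β (s i i)) (sym βb) z≤n))
            (re-tot {α ∘ s i ∘ τ} {β ∘ s i ∘ τ} (λ j → tot′ (τ j)) (e∘tr (trans (sym (tot′ b)) (cong₂ _+_ αb βb)) e-l)) ,
          differ i sα-l ατ-l 0≢1 , differ (suc i) sα-r βτ-r 1≢0 , differ (suc i) sβ-r ατ-r 0≢1 , differ i sβ-l βτ-l 1≢0
          where
          τ = tr b i
          1≤b : 1 ≤ b
          1≤b = n≢0⇒n>0 (λ b≡0 → 0≢1 (trans (sym (at0 p)) (subst (λ b → α (s i b) ≡ 1) b≡0 αb)))
          τr : τ (suc i) ≡ suc i
          τr = tr-o (>⇒≢ (<-trans b<i (n<1+n i))) (>⇒≢ (n<1+n i))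
          ατ-l = trans (cong (α ∘ s i) (tr-r b i)) αb
          βτ-l = trans (cong (β ∘ s i) (tr-r b i)) βb
          ατ-r = trans (cong (α ∘ s i) τr) sα-r
          βτ-r = trans (cong (β ∘ s i) τr) sβ-r

      -- If i and i+1 lie in the same part of a split, it is already a split in A(w). If they are
      -- separated, `crossing` produces two splits in A(w) from this one alone.
      two-strengthen : TwoSplits (ωk ∘ s i) (ωl ∘ s i) k l e → TwoSplits ωk ωl k l e
      two-strengthen (α , β , α̃ , β̃ , Y , Ỹ , d) with resolve Y | resolve Ỹ
        where
        resolve : ∀ {α β} → Sp′ e α β → Sp e α β ⊎ TwoSplits ωk ωl k l e
        resolve {α} {β} Y = go (≤1-cases (bin (inL Y) i)) (≤1-cases (bin (inL Y) (suc i)))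
          where
          rest : ∀ {x y z} → x + y ≡ z → z ≡ 1 → (x ≡ 0 → y ≡ 1) × (x ≡ 1 → y ≡ 0)
          rest p refl = (λ { refl → p }) , (λ { refl → suc-injective p })
          β-l = rest (tot Y i) e-l
          β-r = rest (tot Y (suc i)) e-r
          keep : α i ≡ α (suc i) → β i ≡ β (suc i) → Sp e α β
          keep p q = mkSplit (L.strengthen-desc (inL Y) (≤-reflexive (sym p)))
            (K.strengthen-desc (inK Y) (≤-reflexive (sym q))) (tot Y)
          go : α i ≡ 0 ⊎ α i ≡ 1 → α (suc i) ≡ 0 ⊎ α (suc i) ≡ 1 → Sp e α β ⊎ TwoSplits ωk ωl k l e
          go (inj₁ p) (inj₁ q) = inj₁ (keep (trans p (sym q)) (trans (proj₁ β-l p) (sym (proj₁ β-r q))))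
          go (inj₂ p) (inj₂ q) = inj₁ (keep (trans p (sym q)) (trans (proj₂ β-l p) (sym (proj₂ β-r q))))
          go (inj₂ p) (inj₁ q) = inj₂ (crossing Y p q (proj₂ β-l p) (proj₁ β-r q))
          -- i and i+1 are separated the other way round; s_i applied to both parts reduces this to
          -- the previous case.
          go (inj₁ p) (inj₂ q) = inj₂ (crossing
            (mkSplit (L.swap′ (inL Y)) (K.swap′ (inK Y)) (re-tot {α ∘ s i} {β ∘ s i} (λ j → tot Y (s i j)) e∘s))
            (trans (cong α (s-l i)) q) (trans (cong α (s-r i)) p)
            (trans (cong β (s-l i)) (proj₂ β-r q)) (trans (cong β (s-r i)) (proj₁ β-l p)))
      ... | inj₂ t | _      = t
      ... | inj₁ _ | inj₂ t = t
      ... | inj₁ y | inj₁ ỹ = α , β , α̃ , β̃ , y , ỹ , d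

two-cong : ∀ {ωk ωl k l e e′} → e ≗ e′ → TwoSplits ωk ωl k l e → TwoSplits ωk ωl k l e′
two-cong h (α , β , α̃ , β̃ , mkSplit a b t , mkSplit ã b̃ t̃ , d) =
  α , β , α̃ , β̃ , mkSplit a b (λ j → trans (t j) (h j)) , mkSplit ã b̃ (λ j → trans (t̃ j) (h j)) , d

module SplitTransport {i : ℕ} (1≤i : 1 ≤ i) {ωk ωl : ℕ → ℕ} {k l : ℕ}
  (ωk≤1 : ∀ j → ωk j ≤ 1) (ωl≤1 : ∀ j → ωl j ≤ 1)
  (ωk-desc : ωk (suc i) ≤ ωk i) (ωl-desc : ωl (suc i) ≤ ωl i) where

  private
    module K = Step 1≤i {ωk} {k} ωk≤1 ωk-desc
    module L = Step 1≤i {ωl} {l} ωl≤1 ωl-desc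

    swap-≗ : ∀ {f g : ℕ → ℕ} → f ∘ s i ≗ g ∘ s i → f ≗ g
    swap-≗ {f} {g} h j = trans (cong f (sym (s-invol i j))) (trans (h (s i j)) (cong g (s-invol i j)))

  two-weaken : ∀ {e} → TwoSplits ωk ωl k l e → TwoSplits (ωk ∘ s i) (ωl ∘ s i) k l e
  two-weaken (α , β , α̃ , β̃ , mkSplit a b t , mkSplit ã b̃ t̃ , d) =
    α , β , α̃ , β̃ , mkSplit (L.weaken a) (K.weaken b) t , mkSplit (L.weaken ã) (K.weaken b̃) t̃ , d

  two-swap : ∀ {e} → TwoSplits (ωk ∘ s i) (ωl ∘ s i) k l e → TwoSplits (ωk ∘ s i) (ωl ∘ s i) k l (e ∘ s i)
  two-swap (α , β , α̃ , β̃ , mkSplit a b t , mkSplit ã b̃ t̃ , d₁ , d₂ , d₃ , d₄) =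
    α ∘ s i , β ∘ s i , α̃ ∘ s i , β̃ ∘ s i ,
    mkSplit (L.swap′ a) (K.swap′ b) (t ∘ s i) , mkSplit (L.swap′ ã) (K.swap′ b̃) (t̃ ∘ s i) ,
    d₁ ∘ swap-≗ , d₂ ∘ swap-≗ , d₃ ∘ swap-≗ , d₄ ∘ swap-≗

  private
    desc : ∀ {a a′ b b′ x y} → a ≤ 1 → b ≤ 1 → a + b ≡ x → a′ + b′ ≡ y → a′ ≤ 1 → y ≤ x → ¬ (x ≡ 1 × y ≡ 1) → a′ ≤ a
    desc (s≤s z≤n) _ _ _ a′≤1 _ _ = a′≤1
    desc z≤n b≤1 _ _ z≤n y≤x n = z≤n
    desc {b′ = b′} z≤n (s≤s z≤n) refl refl (s≤s z≤n) (s≤s z≤n) n = ⊥-elim (n (refl , refl))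

  -- A part with i+1 but without i would give e(i) ≤ 1 ≤ e(i+1) ≤ e(i), the excluded case (1 , 1).
  -- So `strengthen-desc` applies to both parts.
  two-sorted : ∀ {e} → e (suc i) ≤ e i → ¬ (e i ≡ 1 × e (suc i) ≡ 1) →
    TwoSplits (ωk ∘ s i) (ωl ∘ s i) k l e → TwoSplits ωk ωl k l e
  two-sorted {e} y≤x n (α , β , α̃ , β̃ , Y , Ỹ , d) = α , β , α̃ , β̃ , go Y , go Ỹ , d
    where
    go : ∀ {α β} → Split (ωk ∘ s i) (ωl ∘ s i) k l e α β → Split ωk ωl k l e α β
    go {α} {β} (mkSplit a b t) = mkSplit
      (L.strengthen-desc a (desc (bin a i) (bin b i) (t i) (t (suc i)) (bin a (suc i)) y≤x n))
      (K.strengthen-desc b (desc (bin b i) (bin a i) (trans (+-comm (β i) (α i)) (t i))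
        (trans (+-comm (β (suc i)) (α (suc i))) (t (suc i))) (bin b (suc i)) y≤x n)) t

-- Squared variables and the uniqueness of splittings

isTwo : ℕ → ℕ
isTwo n = if n ≡ᵇ 2 then 1 else 0

twos : (ℕ → ℕ) → ℕ → ℕ
twos e j = isTwo (e j)

isTwo-≤ : ∀ {a b x} → a ≤ 1 → b ≤ 1 → a + b ≡ x → isTwo x ≤ a
isTwo-≤ z≤n       z≤n       refl = z≤n
isTwo-≤ z≤n       (s≤s z≤n) refl = z≤n
isTwo-≤ (s≤s z≤n) z≤n       refl = z≤n
isTwo-≤ (s≤s z≤n) (s≤s z≤n) refl = ≤-refl

S-patch : ∀ {f g} i → (∀ j → j ≢ i → j ≢ suc i → f j ≡ g j) → ∀ {t} → suc i < t →
  S f t + (g i + g (suc i)) ≡ S g t + (f i + f (suc i))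
S-patch {f} {g} i h {suc t} (s≤s p) with m≤n⇒m<n∨m≡n p
... | inj₁ q = begin
    S f t + f t + (g i + g (suc i))   ≡⟨ lem (S f t) (f t) _ ⟩
    S f t + (g i + g (suc i)) + f t   ≡⟨ cong₂ _+_ (S-patch i h q) (h t (>⇒≢ (<-trans (n<1+n i) q)) (>⇒≢ q)) ⟩
    S g t + (f i + f (suc i)) + g t   ≡⟨ lem (S g t) (g t) _ ⟨
    S g t + g t + (f i + f (suc i))   ∎
  where
  open ≡-Reasoning
  lem : ∀ x y z → x + y + z ≡ x + z + y
  lem = solve-∀
... | inj₂ refl = trans (cong (λ u → u + f i + f (suc i) + (g i + g (suc i))) (below i ≤-refl))
    (lem (S g i) (f i) (f (suc i)) (g i) (g (suc i)))
  where
  lem : ∀ a b c d e → a + b + c + (d + e) ≡ a + d + e + (b + c)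
  lem = solve-∀
  below : ∀ t → t ≤ i → S f t ≡ S g t
  below zero    _ = refl
  below (suc t) q = cong₂ _+_ (below t (<⇒≤ q)) (h t (<⇒≢ q) (<⇒≢ (<-trans q (n<1+n i))))

≗-of-total : ∀ {f g K} → (∀ j → f j ≤ g j) → (∀ t → S g t ≤ K) → ∀ E → K ≤ S f E → f ≗ g
≗-of-total {f} {g} {K} f≤g g≤K E K≤f j with m≤n⇒m<n∨m≡n (f≤g j)
... | inj₂ p = p
... | inj₁ p = ⊥-elim (<-irrefl refl (begin-strict
    S f M             <⟨ gap j<M ⟩
    S g M             ≤⟨ g≤K M ⟩
    K                 ≤⟨ K≤f ⟩
    S f E             ≤⟨ S-monoʳ f (m≤m⊔n E (suc j)) ⟩
    S f M             ∎))
  where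
  open ≤-Reasoning
  M = E ⊔ suc j
  j<M : j < M
  j<M = m≤n⊔m E (suc j)
  gap : ∀ {t} → j < t → S f t < S g t
  gap {suc t} (s≤s q) with m≤n⇒m<n∨m≡n q
  ... | inj₂ refl = +-mono-≤-< (S-mono f≤g j) p
  ... | inj₁ r    = +-mono-<-≤ (gap r) (f≤g t)

find-≢ : ∀ (f g : ℕ → ℕ) E → (∀ {j} → j < E → f j ≡ g j) ⊎ ∃[ j ] (j < E × f j ≢ g j)
find-≢ f g zero    = inj₁ λ ()
find-≢ f g (suc E) with f E ≟ g E | find-≢ f g E
... | no n  | _      = inj₂ (E , ≤-refl , n)
... | yes p | inj₂ (j , j<E , n) = inj₂ (j , m≤n⇒m≤1+n j<E , n)
... | yes p | inj₁ h = inj₁ λ {j} j<sE → [ h , (λ { refl → p }) ]′ (m≤n⇒m<n∨m≡n (≤-pred j<sE))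

S-cong< : ∀ {f g} E → (∀ {j} → j < E → f j ≡ g j) → S f E ≡ S g E
S-cong< zero    h = refl
S-cong< (suc E) h = cong₂ _+_ (S-cong< E (λ p → h (m≤n⇒m≤1+n p))) (h ≤-refl)

δ : ℕ → ℕ → ℕ
δ p j = if j ≡ᵇ p then 1 else 0

δ-refl : ∀ p → δ p p ≡ 1
δ-refl p rewrite ≡ᵇ-true {p} refl = refl

δ-≢ : ∀ {p j} → j ≢ p → δ p j ≡ 0
δ-≢ n rewrite ≡ᵇ-false n = refl

S-δ-lo : ∀ {p} t → t ≤ p → S (δ p) t ≡ 0
S-δ-lo zero    _ = refl
S-δ-lo (suc t) h = cong₂ _+_ (S-δ-lo t (<⇒≤ h)) (δ-≢ (<⇒≢ h))

S-δ-hi : ∀ {p} t → p < t → S (δ p) t ≡ 1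
S-δ-hi {p} (suc t) (s≤s q) with m≤n⇒m<n∨m≡n q
... | inj₂ refl = cong₂ _+_ (S-δ-lo p ≤-refl) (δ-refl p)
... | inj₁ r    = cong₂ _+_ (S-δ-hi t r) (δ-≢ (>⇒≢ r))

Bin : (ℕ → ℕ) → Set
Bin f = ∀ j → f j ≤ 1

module _ {e : ℕ → ℕ} {K : ℕ} where

  -- All squared variables lie in g, and they are already as many as g may have elements.
  twos-forces : ∀ {g h} → Bin g → Bin h → (∀ j → g j + h j ≡ e j) →
    (∀ t → S g t ≤ K) → ∀ E → K ≤ S (twos e) E → twos e ≗ g
  twos-forces bg bh t g≤K E K≤ = ≗-of-total (λ j → isTwo-≤ (bg j) (bh j) (t j)) g≤K E K≤

  unique-first : ∀ {g h g̃ h̃} → Bin g → Bin h → Bin g̃ → Bin h̃ →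
    (∀ j → g j + h j ≡ e j) → (∀ j → g̃ j + h̃ j ≡ e j) →
    (∀ t → S g t ≤ K) → (∀ t → S g̃ t ≤ K) → ∀ E → K ≤ S (twos e) E → g ≗ g̃
  unique-first bg bh bg̃ bh̃ t t̃ a ã E K≤ j =
    trans (sym (twos-forces bg bh t a E K≤ j)) (twos-forces bg̃ bh̃ t̃ ã E K≤ j)

  -- Either g is the set of squares, which also fills g̃, or g has one further element p, of
  -- multiplicity 1. In the other splitting p lies in one of the parts; that part contains the
  -- squares and p and has no room for more.
  unique-pair : ∀ {g h g̃ h̃} → Bin g → Bin h → Bin g̃ → Bin h̃ →
    (∀ j → g j + h j ≡ e j) → (∀ j → g̃ j + h̃ j ≡ e j) →
    (∀ t → S g t ≤ K) → (∀ t → S g̃ t ≤ K) → (∀ t → S h̃ t ≤ K) →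
    ∀ E → K ≤ S g E → K ≤ S (twos e) E + 1 → g ≗ g̃ ⊎ g ≗ h̃
  unique-pair {g} {h} {g̃} {h̃} bg bh bg̃ bh̃ t t̃ a ã ã′ E K≤g K≤ with find-≢ (twos e) g E
  ... | inj₁ p = inj₁ (unique-first bg bh bg̃ bh̃ t t̃ a ã E (subst (K ≤_) (sym (S-cong< E p)) K≤g))
  ... | inj₂ (p , p<E , n) = go (≤1-cases (bg̃ p)) (≤1-cases (bh̃ p))
    where
    f : ℕ → ℕ
    f j = twos e j + δ p j
    Sf : K ≤ S f E
    Sf = subst (K ≤_) (sym (trans (S-+ (twos e) (δ p) E) (cong (S (twos e) E +_) (S-δ-hi E p<E)))) K≤
    at-p : ∀ {x y} → x ≤ 1 → y ≤ 1 → x + y ≡ e p → twos e p ≢ x → x ≡ 1 × twos e p ≡ 0 × e p ≡ 1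
    at-p z≤n       z≤n       q n rewrite sym q = ⊥-elim (n refl)
    at-p z≤n       (s≤s z≤n) q n rewrite sym q = ⊥-elim (n refl)
    at-p (s≤s z≤n) z≤n       q n rewrite sym q = refl , refl , refl
    at-p (s≤s z≤n) (s≤s z≤n) q n rewrite sym q = ⊥-elim (n refl)
    split-p = at-p (bg p) (bh p) (t p) n
    f≤ : ∀ {x y : ℕ → ℕ} → Bin x → Bin y → (∀ j → x j + y j ≡ e j) → x p ≡ 1 → ∀ j → f j ≤ x j
    f≤ {x} bx by q xp j with j ≟ p
    ... | yes refl = subst (_≤ x p) (sym (cong₂ _+_ (proj₁ (proj₂ split-p)) (δ-refl p))) (≤-reflexive (sym xp))
    ... | no j≢p   = subst (_≤ x j) (sym (trans (cong (twos e j +_) (δ-≢ j≢p)) (+-identityʳ _)))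
                       (isTwo-≤ (bx j) (by j) (q j))
    same : ∀ {x y : ℕ → ℕ} → Bin x → Bin y → (∀ j → x j + y j ≡ e j) → (∀ t → S x t ≤ K) → x p ≡ 1 → f ≗ x
    same bx by q a xp = ≗-of-total (f≤ bx by q xp) a E Sf
    g≗ : f ≗ g
    g≗ = same bg bh t a (proj₁ split-p)
    go : g̃ p ≡ 0 ⊎ g̃ p ≡ 1 → h̃ p ≡ 0 ⊎ h̃ p ≡ 1 → g ≗ g̃ ⊎ g ≗ h̃
    go (inj₂ q) _        = inj₁ λ j → trans (sym (g≗ j)) (same bg̃ bh̃ t̃ ã q j)
    go (inj₁ _) (inj₂ q) = inj₂ λ j → trans (sym (g≗ j))
      (same bh̃ bg̃ (λ j → trans (+-comm (h̃ j) (g̃ j)) (t̃ j)) ã′ q j)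
    go (inj₁ q) (inj₁ r) = ⊥-elim (0≢1 (trans (sym (cong₂ _+_ q r)) (trans (t̃ p) (proj₂ (proj₂ split-p)))))

-- Finite sets as sorted lists

∧-true : ∀ {a b} → (a ∧ b) ≡ true → a ≡ true × b ≡ true
∧-true {true} {true} _ = refl , refl

∧-intro : ∀ {a b} → a ≡ true → b ≡ true → (a ∧ b) ≡ true
∧-intro refl refl = refl

module _ {A : Set} (p : A → Bool) where

  ∈-filterᵇ⁺ : ∀ {x xs} → x ∈ xs → p x ≡ true → x ∈ filterᵇ p xs
  ∈-filterᵇ⁺ (here refl) px rewrite px = here refl
  ∈-filterᵇ⁺ {xs = y ∷ ys} (there q) px with p y
  ... | true  = there (∈-filterᵇ⁺ q px)
  ... | false = ∈-filterᵇ⁺ q px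

  ∈-filterᵇ⁻ : ∀ {x} xs → x ∈ filterᵇ p xs → x ∈ xs × p x ≡ true
  ∈-filterᵇ⁻ (y ∷ ys) q with p y in eq
  ∈-filterᵇ⁻ (y ∷ ys) (here refl) | true  = here refl , eq
  ∈-filterᵇ⁻ (y ∷ ys) (there q)   | true  = let a , b = ∈-filterᵇ⁻ ys q in there a , b
  ∈-filterᵇ⁻ (y ∷ ys) q           | false = let a , b = ∈-filterᵇ⁻ ys q in there a , b

  filterᵇ-unique : ∀ {xs} → Unique xs → Unique (filterᵇ p xs)
  filterᵇ-unique [] = []
  filterᵇ-unique {x ∷ xs} (h ∷ u) with p x
  ... | true  = All.tabulate (λ {y} q → All.lookup h (proj₁ (∈-filterᵇ⁻ xs q))) ∷ filterᵇ-unique u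
  ... | false = filterᵇ-unique u

∈-++-∷⁻ : ∀ {A : Set} {x z : A} as {bs} → z ∈ as ++ x ∷ bs → z ≡ x ⊎ z ∈ as ++ bs
∈-++-∷⁻ as q with ∈-++⁻ as q
... | inj₁ r         = inj₂ (∈-++⁺ˡ r)
... | inj₂ (here r)  = inj₁ r
... | inj₂ (there r) = inj₂ (∈-++⁺ʳ as r)

unique-⊆-length : ∀ {A : Set} {xs ys : List A} → Unique xs → (∀ {x} → x ∈ xs → x ∈ ys) → length xs ≤ length ys
unique-⊆-length [] _ = z≤n
unique-⊆-length {xs = x ∷ xs} (h ∷ u) sub with ∈-∃++ (sub (here refl))
... | as , bs , refl = subst (suc (length xs) ≤_) (sym (len as)) (s≤s (unique-⊆-length u sub′))
  where
  len : ∀ as → length (as ++ x ∷ bs) ≡ suc (length (as ++ bs))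
  len []       = refl
  len (_ ∷ as) = cong suc (len as)
  sub′ : ∀ {z} → z ∈ xs → z ∈ as ++ bs
  sub′ q with ∈-++-∷⁻ as (sub (there q))
  ... | inj₂ r    = r
  ... | inj₁ refl = ⊥-elim (All.lookup h q refl)

module _ {A B : Set} (g : A → List B) where

  -- The common shape of the list of candidate inversions in `invs` and of the list of factors of
  -- N_{w,i}.
  tagged : List A → List (A × B)
  tagged = concatMap (λ a → map (a ,_) (g a))

  ∈-tagged⁺ : ∀ {a b as} → a ∈ as → b ∈ g a → (a , b) ∈ tagged as
  ∈-tagged⁺ (here refl) q = ∈-++⁺ˡ (∈-map⁺ _ q)
  ∈-tagged⁺ {as = a ∷ as} (there p) q = ∈-++⁺ʳ (map (a ,_) (g a)) (∈-tagged⁺ p q)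

  ∈-tagged⁻ : ∀ {x} as → x ∈ tagged as → proj₁ x ∈ as × proj₂ x ∈ g (proj₁ x)
  ∈-tagged⁻ (a ∷ as) q with ∈-++⁻ (map (a ,_) (g a)) q
  ... | inj₂ r = let u , v = ∈-tagged⁻ as r in there u , v
  ... | inj₁ r with ∈-map⁻ (a ,_) r
  ...   | b , b∈ , refl = here refl , b∈

  tagged-unique : ∀ {as} → Unique as → (∀ a → Unique (g a)) → Unique (tagged as)
  tagged-unique [] _ = []
  tagged-unique {a ∷ as} (h ∷ u) gu = ++⁺ (map⁺ (λ { refl → refl }) (gu a)) (tagged-unique u gu) disj
    where
    disj : ∀ {x} → ¬ (x ∈ map (a ,_) (g a) × x ∈ tagged as)
    disj (p , q) with ∈-map⁻ (a ,_) p
    ... | b , _ , refl = All.lookup h (proj₁ (∈-tagged⁻ as q)) refl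

range1-unique : ∀ n → Unique (range1 n)
range1-unique n = map⁺ suc-injective (upTo⁺ n)

∈-range1⁺ : ∀ {x n} → 1 ≤ x → x ≤ n → x ∈ range1 n
∈-range1⁺ {suc x} _ p = ∈-map⁺ suc (∈-upTo⁺ p)

∈-range1⁻ : ∀ {x n} → x ∈ range1 n → 1 ≤ x × x ≤ n
∈-range1⁻ p with ∈-map⁻ suc p
... | y , q , refl = s≤s z≤n , ∈-upTo⁻ q

∈⇒≤maxL : ∀ {x xs} → x ∈ xs → x ≤ maxL xs
∈⇒≤maxL {xs = y ∷ ys} (here refl) = m≤m⊔n y (maxL ys)
∈⇒≤maxL {xs = y ∷ ys} (there p)   = ≤-trans (∈⇒≤maxL p) (m≤n⊔m y (maxL ys))

count : List ℕ → ℕ → ℕ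
count α j = cnt j α

count-∷ : ∀ x α j → count (x ∷ α) j ≡ δ x j + count α j
count-∷ x α j with x ≟ j
... | yes refl rewrite ≡ᵇ-true {x} refl = refl
... | no n rewrite ≡ᵇ-false n | ≡ᵇ-false (≢-sym n) = refl

S-count-∷ : ∀ x α t → S (count (x ∷ α)) t ≡ S (δ x) t + S (count α) t
S-count-∷ x α t = trans (S-cong (count-∷ x α) t) (S-+ (δ x) (count α) t)

S-δ≤1 : ∀ p t → S (δ p) t ≤ 1
S-δ≤1 p t with t ≤? p
... | yes q = subst (_≤ 1) (sym (S-δ-lo t q)) z≤n
... | no q  = ≤-reflexive (S-δ-hi t (≰⇒> q))

S-δ-anti : ∀ {x y} t → x ≤ y → S (δ y) t ≤ S (δ x) t
S-δ-anti {x} {y} t x≤y with t ≤? y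
... | yes q = subst (_≤ S (δ x) t) (sym (S-δ-lo t q)) z≤n
... | no q  = ≤-reflexive (trans (S-δ-hi t (≰⇒> q)) (sym (S-δ-hi t (≤-<-trans x≤y (≰⇒> q)))))

S-0 : ∀ t → S (λ _ → 0) t ≡ 0
S-0 zero    = refl
S-0 (suc t) = trans (+-identityʳ _) (S-0 t)

S-count≤length : ∀ α t → S (count α) t ≤ length α
S-count≤length []      t = ≤-reflexive (S-0 t)
S-count≤length (x ∷ α) t = subst (_≤ suc (length α)) (sym (S-count-∷ x α t))
  (+-mono-≤ (S-δ≤1 x t) (S-count≤length α t))

S-count-all : ∀ {α t} → All (_< t) α → S (count α) t ≡ length α
S-count-all {[]}    {t} [] = S-0 t
S-count-all {x ∷ α} {t} (p ∷ ps) = trans (S-count-∷ x α t) (cong₂ _+_ (S-δ-hi t p) (S-count-all ps))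

S-count-none : ∀ {α t} → All (t ≤_) α → S (count α) t ≡ 0
S-count-none {[]}    {t} [] = S-0 t
S-count-none {x ∷ α} {t} (p ∷ ps) = trans (S-count-∷ x α t) (cong₂ _+_ (S-δ-lo t p) (S-count-none ps))

count-none : ∀ {α j} → All (_≢ j) α → count α j ≡ 0
count-none [] = refl
count-none {x ∷ α} {j} (p ∷ ps) = trans (count-∷ x α j) (cong₂ _+_ (δ-≢ (≢-sym p)) (count-none ps))

count-∈ : ∀ {α j} → j ∈ α → 1 ≤ count α j
count-∈ {x ∷ α} {j} (here refl) = subst (1 ≤_) (sym (trans (count-∷ x α j) (cong (_+ count α j) (δ-refl j)))) (s≤s z≤n)
count-∈ {x ∷ α} {j} (there p) = subst (1 ≤_) (sym (count-∷ x α j)) (≤-trans (count-∈ p) (m≤n+m _ (δ x j)))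

count-insert : ∀ x ys j → count (insert x ys) j ≡ δ x j + count ys j
count-insert x []       j = count-∷ x [] j
count-insert x (y ∷ ys) j with x ≤ᵇ y
... | true  = count-∷ x (y ∷ ys) j
... | false = trans (count-∷ y (insert x ys) j) (trans (cong (δ y j +_) (count-insert x ys j))
  (trans (lem (δ y j) (δ x j) (count ys j)) (cong (δ x j +_) (sym (count-∷ y ys j)))))
  where
  lem : ∀ a b c → a + (b + c) ≡ b + (a + c)
  lem = solve-∀

count-sort : ∀ α j → count (sort α) j ≡ count α j
count-sort []      j = refl
count-sort (x ∷ α) j = trans (count-insert x (sort α) j)
  (trans (cong (δ x j +_) (count-sort α j)) (sym (count-∷ x α j)))

length-insert : ∀ x ys → length (insert x ys) ≡ suc (length ys)
length-insert x []       = refl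
length-insert x (y ∷ ys) with x ≤ᵇ y
... | true  = refl
... | false = cong suc (length-insert x ys)

length-sort : ∀ α → length (sort α) ≡ length α
length-sort []      = refl
length-sort (x ∷ α) = trans (length-insert x (sort α)) (cong suc (length-sort α))

Sorted Strict : List ℕ → Set
Sorted = AllPairs _≤_
Strict = AllPairs _<_

insert-All : ∀ {P : ℕ → Set} {x ys} → P x → All P ys → All P (insert x ys)
insert-All px [] = px ∷ []
insert-All {x = x} {y ∷ ys} px (py ∷ pys) with x ≤ᵇ y
... | true  = px ∷ py ∷ pys
... | false = py ∷ insert-All px pys

insert-sorted : ∀ x {ys} → Sorted ys → Sorted (insert x ys)
insert-sorted x [] = [] ∷ []
insert-sorted x {y ∷ ys} (h ∷ so) with x ≤ᵇ y in eq
... | true  = (x≤y ∷ All.map (≤-trans x≤y) h) ∷ h ∷ so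
  where x≤y = ≤ᵇ⇒≤ x y (≡→T eq)
... | false = insert-All (<⇒≤ (≰⇒> λ q → subst T eq (≤⇒≤ᵇ q))) h ∷ insert-sorted x so

sort-sorted : ∀ α → Sorted (sort α)
sort-sorted []      = []
sort-sorted (x ∷ α) = insert-sorted x (sort-sorted α)

strictInc-sound : ∀ α → strictInc α ≡ true → Strict α
strictInc-sound []           _ = []
strictInc-sound (x ∷ [])     _ = [] ∷ []
strictInc-sound (x ∷ y ∷ ys) p = consˢ (strictInc-sound (y ∷ ys) (proj₂ (∧-true {x <ᵇ y} p)))
  where
  x<y = <ᵇ⇒< x y (≡→T (proj₁ (∧-true {x <ᵇ y} p)))
  consˢ : Strict (y ∷ ys) → Strict (x ∷ y ∷ ys)
  consˢ (h ∷ st) = (x<y ∷ All.map (<-trans x<y) h) ∷ h ∷ st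

Strict⇒bin : ∀ {α} → Strict α → Bin (count α)
Strict⇒bin []             j = z≤n
Strict⇒bin {x ∷ α} (h ∷ st) j with j ≟ x
... | yes refl = subst (_≤ 1) (sym (trans (count-∷ x α x) (cong₂ _+_ (δ-refl x) (count-none (All.map >⇒≢ h))))) ≤-refl
... | no n     = subst (_≤ 1) (sym (trans (count-∷ x α j) (cong (_+ count α j) (δ-≢ n)))) (Strict⇒bin st j)

strictInc-complete : ∀ {α} → Sorted α → Bin (count α) → strictInc α ≡ true
strictInc-complete []                  _ = refl
strictInc-complete ([] ∷ [])           _ = refl
strictInc-complete {x ∷ y ∷ ys} ((x≤y ∷ _) ∷ so) b = ∧-intro
  (T→≡ (<⇒<ᵇ (≤∧≢⇒< x≤y x≢y)))
  (strictInc-complete so (λ j → ≤-trans (subst (count (y ∷ ys) j ≤_) (sym (count-∷ x (y ∷ ys) j)) (m≤n+m _ _)) (b j)))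
  where
  x≢y : x ≢ y
  x≢y refl = <-irrefl refl (≤-trans (s≤s (count-∈ {x ∷ ys} (here refl)))
    (subst (_≤ 1) (trans (count-∷ x (x ∷ ys) x) (cong (_+ count (x ∷ ys) x) (δ-refl x))) (b x)))

Strict-ext : ∀ {α β} → Strict α → Strict β → count α ≗ count β → α ≡ β
Strict-ext {[]}    {[]}    _ _ _ = refl
Strict-ext {[]}    {y ∷ β} _ _ h with subst (1 ≤_) (sym (h y)) (count-∈ {y ∷ β} (here refl))
... | ()
Strict-ext {x ∷ α} {[]}    _ _ h with subst (1 ≤_) (h x) (count-∈ {x ∷ α} (here refl))
... | ()
Strict-ext {x ∷ α} {y ∷ β} (hα ∷ sα) (hβ ∷ sβ) h = go (x≡y)
  where
  absent : ∀ {x y β} → x < y → All (y <_) β → count (y ∷ β) x ≡ 0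
  absent x<y h = count-none (>⇒≢ x<y ∷ All.map (λ q → >⇒≢ (<-trans x<y q)) h)
  x≡y : x ≡ y
  x≡y with <-cmp x y
  ... | tri≈ _ p _ = p
  ... | tri< p _ _ = ⊥-elim (n≮0 (subst (1 ≤_) (trans (h x) (absent p hβ)) (count-∈ {x ∷ α} (here refl))))
  ... | tri> _ _ p = ⊥-elim (n≮0 (subst (1 ≤_) (trans (sym (h y)) (absent p hα)) (count-∈ {y ∷ β} (here refl))))
  go : x ≡ y → x ∷ α ≡ y ∷ β
  go refl = cong (x ∷_) (Strict-ext sα sβ λ j →
    +-cancelˡ-≡ (δ x j) _ _ (trans (sym (count-∷ x α j)) (trans (h j) (count-∷ x β j))))

ptwLe-sound : ∀ α γ → ptwLe α γ ≡ true → ∀ t → S (count γ) t ≤ S (count α) t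
ptwLe-sound []      []      _ t = ≤-refl
ptwLe-sound (x ∷ α) (y ∷ γ) p t with ∧-true {x ≤ᵇ y} p
... | q , r = subst₂ _≤_ (sym (S-count-∷ y γ t)) (sym (S-count-∷ x α t))
  (+-mono-≤ (S-δ-anti t (≤ᵇ⇒≤ x y (≡→T q))) (ptwLe-sound α γ r t))

-- For the heads: y is counted below `suc y`, so some entry of α is, and x is its least. For the
-- tails: when t > y both heads are counted and cancel; when t ≤ y the tail of γ counts nothing.
ptwLe-complete : ∀ {α γ} → Sorted α → Sorted γ → length α ≡ length γ →
  (∀ t → S (count γ) t ≤ S (count α) t) → ptwLe α γ ≡ true
ptwLe-complete {[]}    {[]}    _ _ _ _ = refl
ptwLe-complete {x ∷ α} {y ∷ γ} (hα ∷ sα) (hγ ∷ sγ) len h =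
  ∧-intro (T→≡ (≤⇒≤ᵇ x≤y)) (ptwLe-complete sα sγ (suc-injective len) tails)
  where
  x≤y : x ≤ y
  x≤y with x ≤? y
  ... | yes p = p
  ... | no p  = ⊥-elim (n≮0 (subst₂ _≤_
    (trans (S-count-∷ y γ (suc y)) (cong (_+ S (count γ) (suc y)) (S-δ-hi (suc y) ≤-refl)))
    (S-count-none (≰⇒> p ∷ All.map (≤-trans (≰⇒> p)) hα)) (h (suc y))))
  tails : ∀ t → S (count γ) t ≤ S (count α) t
  tails t with t ≤? y
  ... | yes p = subst (_≤ S (count α) t) (sym (S-count-none (All.map (≤-trans p) hγ))) z≤n
  ... | no p  = +-cancelˡ-≤ 1 _ _ (subst₂ _≤_
    (trans (S-count-∷ y γ t) (cong (_+ S (count γ) t) (S-δ-hi t (≰⇒> p))))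
    (trans (S-count-∷ x α t) (cong (_+ S (count α) t) (S-δ-hi t (≤-<-trans x≤y (≰⇒> p)))))
    (h t))

ptwLe-bound : ∀ α γ → ptwLe α γ ≡ true → All (_≤ maxL γ) α
ptwLe-bound []      []      _ = []
ptwLe-bound (x ∷ α) (y ∷ γ) p with ∧-true {x ≤ᵇ y} p
... | q , r = ≤-trans (≤ᵇ⇒≤ x y (≡→T q)) (m≤m⊔n y _) ∷ All.map (λ u → ≤-trans u (m≤n⊔m y _)) (ptwLe-bound α γ r)

allPos-sound : ∀ α → allPos α ≡ true → All (1 ≤_) α
allPos-sound []      _ = []
allPos-sound (x ∷ α) p with ∧-true {1 ≤ᵇ x} p
... | q , r = ≤ᵇ⇒≤ 1 x (≡→T q) ∷ allPos-sound α r

allPos-complete : ∀ α → count α 0 ≡ 0 → allPos α ≡ true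
allPos-complete []          _ = refl
allPos-complete (zero ∷ α)  ()
allPos-complete (suc x ∷ α) p = allPos-complete α p

-- The sets A_l(w): lists versus indicator functions

ω : List ℕ → ℕ → ℕ → ℕ
ω w l = count (wˡ w l)

length-wˡ : ∀ w l → length (wˡ w l) ≡ l
length-wˡ w l = trans (length-sort (map (perm w) (range1 l)))
  (trans (length-map (perm w) (range1 l)) (trans (length-map suc (upTo l)) (length-upTo l)))

maxL-All : ∀ α → All (_< suc (maxL α)) α
maxL-All α = All.tabulate (λ p → s≤s (∈⇒≤maxL p))

ω-end : ∀ w l → S (ω w l) (suc (maxL (wˡ w l))) ≡ l
ω-end w l = trans (S-count-all (maxL-All (wˡ w l))) (length-wˡ w l)

record IsA (w : List ℕ) (l : ℕ) (α : List ℕ) : Set where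
  field
    len    : length α ≡ l
    strict : Strict α
    pos    : All (1 ≤_) α
    below  : ptwLe α (wˡ w l) ≡ true

InA-sound : ∀ {w l α} → InA w l α → IsA w l α
InA-sound {w} {l} {α} p with ∧-true {length α ≡ᵇ l} p
... | a , q with ∧-true {strictInc α} q
...   | b , r with ∧-true {allPos α} r
...     | c , d = record { len = ≡ᵇ-sound {length α} a ; strict = strictInc-sound α b ; pos = allPos-sound α c ; below = d }

InA⇒𝒜 : ∀ {w l α} → InA w l α → 𝒜 (ω w l) l (count α)
InA⇒𝒜 {w} {l} {α} p = mk𝒜 (Strict⇒bin strict) (ptwLe-sound α (wˡ w l) below)
  (λ t → subst (S (count α) t ≤_) len (S-count≤length α t)) (count-none (All.map >⇒≢ pos))
  where open IsA (InA-sound {w} {l} {α} p)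

-- The length is forced from both sides: by `hi` beyond the largest entry of α, and by `lo` beyond
-- the largest entry of w^l.
𝒜⇒InA : ∀ {w l α} → Sorted α → 𝒜 (ω w l) l (count α) → InA w l α
𝒜⇒InA {w} {l} {α} so A = ∧-intro (≡ᵇ-true len) (∧-intro (strictInc-complete so (bin A))
  (∧-intro (allPos-complete α (at0 A)) (ptwLe-complete so (sort-sorted (map (perm w) (range1 l)))
    (trans len (sym (length-wˡ w l))) (lo A))))
  where
  E = suc (maxL (wˡ w l))
  len : length α ≡ l
  len = ≤-antisym (subst (_≤ l) (S-count-all (maxL-All α)) (hi A (suc (maxL α))))
    (≤-trans (≤-reflexive (sym (ω-end w l))) (≤-trans (lo A E) (S-count≤length α E)))

count-map-s : ∀ i α j → count (map (s i) α) j ≡ count α (s i j)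
count-map-s i []      j = refl
count-map-s i (x ∷ α) j = trans (count-∷ (s i x) (map (s i) α) j)
  (trans (cong₂ _+_ δ-s (count-map-s i α j)) (sym (count-∷ x α (s i j))))
  where
  δ-s : δ (s i x) j ≡ δ x (s i j)
  δ-s with j ≟ s i x
  ... | yes refl = trans (δ-refl (s i x)) (sym (trans (cong (δ x) (s-invol i x)) (δ-refl x)))
  ... | no n     = trans (δ-≢ n) (sym (δ-≢ {x} {s i j} λ q → n (trans (sym (s-invol i j)) (cong (s i) q))))

count-sα : ∀ i α j → count (sα i α) j ≡ count α (s i j)
count-sα i α j = trans (count-sort (map (s i) α) j) (count-map-s i α j)

support : (ℕ → ℕ) → ℕ → ℕ → List ℕ
support χ a zero    = []
support χ a (suc n) = if χ a ≡ᵇ 1 then a ∷ support χ (suc a) n else support χ (suc a) n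

support-≥ : ∀ χ a n → All (a ≤_) (support χ a n)
support-≥ χ a zero    = []
support-≥ χ a (suc n) with χ a ≡ᵇ 1
... | true  = ≤-refl ∷ All.map <⇒≤ (support-≥ χ (suc a) n)
... | false = All.map <⇒≤ (support-≥ χ (suc a) n)

support-sorted : ∀ χ a n → Sorted (support χ a n)
support-sorted χ a zero    = []
support-sorted χ a (suc n) with χ a ≡ᵇ 1
... | true  = All.map <⇒≤ (support-≥ χ (suc a) n) ∷ support-sorted χ (suc a) n
... | false = support-sorted χ (suc a) n

count-support : ∀ {χ} → Bin χ → ∀ a n → (∀ {j} → a + n ≤ j → χ j ≡ 0) → ∀ {j} → a ≤ j → count (support χ a n) j ≡ χ j
count-support b a zero    z a≤j = sym (z (subst (_≤ _) (sym (+-identityʳ a)) a≤j))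
count-support {χ} b a (suc n) z {j} a≤j with ≤1-cases (b a) | m≤n⇒m<n∨m≡n a≤j
... | inj₁ q | inj₁ a<j rewrite q = count-support b (suc a) n (λ {j} p → z (subst (_≤ j) (sym (+-suc a n)) p)) a<j
... | inj₁ q | inj₂ refl rewrite q = count-none (All.map >⇒≢ (support-≥ χ (suc a) n))
... | inj₂ q | inj₁ a<j rewrite q = trans (count-∷ a (support χ (suc a) n) j)
  (cong₂ _+_ (δ-≢ (>⇒≢ a<j)) (count-support b (suc a) n (λ {j} p → z (subst (_≤ j) (sym (+-suc a n)) p)) a<j))
... | inj₂ q | inj₂ refl rewrite q = trans (count-∷ a (support χ (suc a) n) a)
  (cong₂ _+_ (δ-refl a) (count-none (All.map >⇒≢ (support-≥ χ (suc a) n))))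

-- All l elements of w^l, hence by `lo` at least l elements of χ, lie below E; `hi` leaves none
-- beyond, so listing χ up to E loses nothing.
𝒜-list : ∀ {w l χ} → 𝒜 (ω w l) l χ → ∃[ α ] (InA w l α × count α ≗ χ)
𝒜-list {w} {l} {χ} A = α , 𝒜⇒InA {w} {l} {α} (support-sorted χ 0 E) (𝒜-cong (λ j → sym (c j)) A) , c
  where
  E = suc (maxL (wˡ w l))
  α = support χ 0 E
  vanish : ∀ {j} → E ≤ j → χ j ≡ 0
  vanish {j} E≤j = n≤0⇒n≡0 (+-cancelˡ-≤ l _ _ (begin
    l + χ j        ≡⟨ cong (_+ χ j) (ω-end w l) ⟨
    S (ω w l) E + χ j ≤⟨ +-monoˡ-≤ (χ j) (≤-trans (lo A E) (S-monoʳ χ E≤j)) ⟩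
    S χ (suc j)    ≤⟨ hi A (suc j) ⟩
    l              ≡⟨ +-identityʳ l ⟨
    l + 0          ∎))
    where open ≤-Reasoning
  c : count α ≗ χ
  c j = count-support (bin A) 0 E vanish z≤n

choose-⊆ : ∀ k xs {α} → α ∈ choose k xs → All (_∈ xs) α
choose-⊆ zero    xs       (here refl) = []
choose-⊆ (suc k) (x ∷ xs) p with ∈-++⁻ (map (x ∷_) (choose k xs)) p
... | inj₂ q = All.map there (choose-⊆ (suc k) xs q)
... | inj₁ q with ∈-map⁻ (x ∷_) q
...   | α , r , refl = here refl ∷ All.map there (choose-⊆ k xs r)

choose-unique : ∀ k {xs} → Unique xs → Unique (choose k xs)
choose-unique zero    _ = [] ∷ []
choose-unique (suc k) [] = []
choose-unique (suc k) {x ∷ xs} (h ∷ u) = ++⁺ (map⁺ (λ { refl → refl }) (choose-unique k u)) (choose-unique (suc k) u) disj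
  where
  disj : ∀ {α} → ¬ (α ∈ map (x ∷_) (choose k xs) × α ∈ choose (suc k) xs)
  disj (p , q) with ∈-map⁻ (x ∷_) p
  ... | α , _ , refl with choose-⊆ (suc k) xs q
  ...   | x∈ ∷ _ = All.lookup h x∈ refl

choose-complete : ∀ {α xs} → Strict α → Strict xs → All (_∈ xs) α → α ∈ choose (length α) xs
choose-complete [] _ _ = here refl
choose-complete {xs = []} (_ ∷ _) _ (() ∷ _)
choose-complete {a ∷ α} {x ∷ xs} (hα ∷ sα) (hx ∷ sx) (here refl ∷ ps) =
  ∈-++⁺ˡ (∈-map⁺ (x ∷_) (choose-complete sα sx (All.tabulate λ q → drop (All.lookup ps q) (All.lookup hα q))))
  where
  drop : ∀ {y} → y ∈ x ∷ xs → x < y → y ∈ xs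
  drop (here refl) p = ⊥-elim (<-irrefl refl p)
  drop (there q)   _ = q
choose-complete {a ∷ α} {x ∷ xs} (hα ∷ sα) (hx ∷ sx) (there a∈ ∷ ps) =
  ∈-++⁺ʳ (map (x ∷_) (choose (length α) xs)) (choose-complete (hα ∷ sα) sx
    (a∈ ∷ All.tabulate λ q → drop (All.lookup ps q) (<-trans (All.lookup hx a∈) (All.lookup hα q))))
  where
  drop : ∀ {y} → y ∈ x ∷ xs → x < y → y ∈ xs
  drop (here refl) p = ⊥-elim (<-irrefl refl p)
  drop (there q)   _ = q

range1-strict : ∀ n → Strict (range1 n)
range1-strict n = APP.map⁺ (APP.applyUpTo⁺₁ id n (λ p _ → s≤s p))

enumA-unique : ∀ w l → Unique (enumA w l)
enumA-unique w l = filterᵇ-unique (inA w l) (choose-unique l (range1-unique _))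

∈-enumA⁻ : ∀ {w l α} → α ∈ enumA w l → InA w l α
∈-enumA⁻ {w} {l} p = proj₂ (∈-filterᵇ⁻ (inA w l) (choose l (range1 (maxL (wˡ w l)))) p)

∈-enumA⁺ : ∀ {w l α} → InA w l α → α ∈ enumA w l
∈-enumA⁺ {w} {l} {α} p = ∈-filterᵇ⁺ (inA w l)
  (subst (λ k → α ∈ choose k (range1 (maxL (wˡ w l)))) len
    (choose-complete strict (range1-strict _) (All.zipWith (λ (u , v) → ∈-range1⁺ u v) (pos , ptwLe-bound α (wˡ w l) below)))) p
  where open IsA (InA-sound {w} {l} {α} p)

-- Reduced words and inversions

inv : List ℕ → ℕ → ℕ
inv []      j = j
inv (i ∷ u) j = inv u (s i j)

perm-inv : ∀ u j → perm u (inv u j) ≡ j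
perm-inv []      j = refl
perm-inv (i ∷ u) j = trans (cong (s i) (perm-inv u (s i j))) (s-invol i j)

inv-perm : ∀ u j → inv u (perm u j) ≡ j
inv-perm []      j = refl
inv-perm (i ∷ u) j = trans (cong (inv u) (s-invol i (perm u j))) (inv-perm u j)

perm-injective : ∀ u {a b} → perm u a ≡ perm u b → a ≡ b
perm-injective u {a} {b} p = trans (sym (inv-perm u a)) (trans (cong (inv u) p) (inv-perm u b))

perm-fix : ∀ u {j} → suc (maxL u) < j → perm u j ≡ j
perm-fix []      _ = refl
perm-fix (i ∷ u) {j} p = trans (cong (s i) (perm-fix u (≤-<-trans (s≤s (m≤n⊔m i (maxL u))) p)))
  (tr-o (>⇒≢ (<-trans (n<1+n i) i<)) (>⇒≢ i<))
  where
  i< : suc i < j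
  i< = ≤-<-trans (s≤s (m≤m⊔n i (maxL u))) p

perm-zero : ∀ {u} → All (1 ≤_) u → perm u 0 ≡ 0
perm-zero []                = refl
perm-zero {i ∷ u} (p ∷ ps) = trans (cong (s i) (perm-zero ps)) (tr-o (<⇒≢ p) (λ ()))

inv-bound : ∀ u {j} → j ≤ suc (maxL u) → inv u j ≤ suc (maxL u)
inv-bound u {j} p with inv u j ≤? suc (maxL u)
... | yes q = q
... | no q  = ≤-trans (≤-reflexive (trans (sym (perm-fix u (≰⇒> q))) (perm-inv u j))) p

inv-pos : ∀ {u j} → All (1 ≤_) u → 1 ≤ j → 1 ≤ inv u j
inv-pos {u} {j} ps p = n≢0⇒n>0 λ q → >⇒≢ p (trans (sym (perm-inv u j)) (trans (cong (perm u) q) (perm-zero ps)))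

count-map-perm : ∀ u α j → count (map (perm u) α) j ≡ count α (inv u j)
count-map-perm u []      j = refl
count-map-perm u (x ∷ α) j = trans (count-∷ (perm u x) (map (perm u) α) j)
  (trans (cong₂ _+_ δ-perm (count-map-perm u α j)) (sym (count-∷ x α (inv u j))))
  where
  δ-perm : δ (perm u x) j ≡ δ x (inv u j)
  δ-perm with j ≟ perm u x
  ... | yes refl = trans (δ-refl (perm u x)) (sym (trans (cong (δ x) (inv-perm u x)) (δ-refl x)))
  ... | no n     = trans (δ-≢ n) (sym (δ-≢ {x} {inv u j} λ q → n (trans (sym (perm-inv u j)) (cong (perm u) q))))

ι : ℕ → ℕ → ℕ
ι l = count (range1 l)

ι-hi : ∀ {l j} → l < j → ι l j ≡ 0
ι-hi {l} p = count-none (All.tabulate λ q → <⇒≢ (≤-<-trans (proj₂ (∈-range1⁻ q)) p))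

ι-lo : ∀ {l j} → 1 ≤ j → j ≤ l → ι l j ≡ 1
ι-lo {l} p q = ≤-antisym (Strict⇒bin (range1-strict l) _) (count-∈ (∈-range1⁺ p q))

ι-mono : ∀ {k l} → k ≤ l → ∀ j → ι k j ≤ ι l j
ι-mono {k} {l} k≤l j with 1 ≤? j | j ≤? k
... | no p  | _     = subst (λ j → ι k j ≤ ι l j) (sym (n<1⇒n≡0 (≰⇒> p)))
  (subst (_≤ ι l 0) (sym (count-none {range1 k} (All.tabulate λ q → >⇒≢ (proj₁ (∈-range1⁻ q))))) z≤n)
... | yes p | no q  = subst (_≤ ι l j) (sym (ι-hi (≰⇒> q))) z≤n
... | yes p | yes q = ≤-reflexive (trans (ι-lo p q) (sym (ι-lo p (≤-trans q k≤l))))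

ω≡ι : ∀ w l j → ω w l j ≡ ι l (inv w j)
ω≡ι w l j = trans (count-sort (map (perm w) (range1 l)) j) (count-map-perm w (range1 l) j)

ω-bin : ∀ w l → Bin (ω w l)
ω-bin w l j = subst (_≤ 1) (sym (ω≡ι w l j)) (Strict⇒bin (range1-strict l) (inv w j))

ω-mono : ∀ w {k l} → k ≤ l → ∀ j → ω w k j ≤ ω w l j
ω-mono w {k} {l} p j = subst₂ _≤_ (sym (ω≡ι w k j)) (sym (ω≡ι w l j)) (ι-mono p (inv w j))

ω-step : ∀ i w l → ω (i ∷ w) l ≗ ω w l ∘ s i
ω-step i w l j = trans (ω≡ι (i ∷ w) l j) (sym (ω≡ι w l (s i j)))

-- i stands before i+1 in u, so it is among the first l values whenever i+1 is.
ω-desc : ∀ {i u} l → All (1 ≤_) u → 1 ≤ i → inv u i < inv u (suc i) → ω u l (suc i) ≤ ω u l i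
ω-desc {i} {u} l ps 1≤i p = subst₂ _≤_ (sym (ω≡ι u l (suc i))) (sym (ω≡ι u l i)) go
  where
  go : ι l (inv u (suc i)) ≤ ι l (inv u i)
  go with inv u i ≤? l
  ... | yes q = subst (ι l (inv u (suc i)) ≤_) (sym (ι-lo (inv-pos ps 1≤i) q)) (Strict⇒bin (range1-strict l) _)
  ... | no q  = subst (_≤ ι l (inv u i)) (sym (ι-hi (<-trans (≰⇒> q) p))) z≤n

ω-full : ∀ {i u} l → All (1 ≤_) u → suc (maxL (i ∷ u)) ≤ l → ω u l (suc i) ≡ 1
ω-full {i} {u} l ps p = trans (ω≡ι u l (suc i)) (ι-lo (inv-pos ps (s≤s z≤n)) inv≤)
  where
  inv≤ : inv u (suc i) ≤ l
  inv≤ with suc i ≤? suc (maxL u)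
  ... | yes q = ≤-trans (inv-bound u q) (≤-trans (s≤s (m≤n⊔m i (maxL u))) p)
  ... | no q  = ≤-trans (≤-reflexive fixed) (≤-trans (s≤s (m≤m⊔n i (maxL u))) p)
    where
    fixed : inv u (suc i) ≡ suc i
    fixed = trans (cong (inv u) (sym (perm-fix u (≰⇒> q)))) (inv-perm u (suc i))

S-injective : ∀ {f g} → (∀ t → S f t ≡ S g t) → f ≗ g
S-injective {f} {g} h j = +-cancelˡ-≡ (S f j) _ _ (trans (h (suc j)) (cong (_+ g j) (sym (h j))))

S-ι : ∀ {l} t → t ≤ l → S (ι l) (suc t) ≡ t
S-ι {l} zero    _ = count-none {range1 l} (All.tabulate λ q → >⇒≢ (proj₁ (∈-range1⁻ q)))
S-ι {l} (suc t) p = trans (cong₂ _+_ (S-ι t (<⇒≤ p)) (ι-lo (s≤s z≤n) p)) (+-comm t 1)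

-- Since 0 is excluded, at most t elements are ≤ t, and there are at most l in all; the lower bound
-- given by {1, ..., l} attains both limits.
𝒜-id : ∀ {l χ} → 𝒜 (ω [] l) l χ → χ ≗ ι l
𝒜-id {l} {χ} A = S-injective λ t → ≤-antisym (up t) (subst (_≤ S χ t) (S-cong (ω≡ι [] l) t) (lo A t))
  where
  cap : ∀ t → S χ (suc t) ≤ t
  cap zero    = ≤-reflexive (at0 A)
  cap (suc t) = subst (S χ (suc (suc t)) ≤_) (+-comm t 1) (+-mono-≤ (cap t) (bin A (suc t)))
  up : ∀ t → S χ t ≤ S (ι l) t
  up zero    = z≤n
  up (suc t) with t ≤? l
  ... | yes p = subst (S χ (suc t) ≤_) (sym (S-ι t p)) (cap t)
  ... | no p  = ≤-trans (hi A (suc t)) (≤-trans (≤-reflexive (sym (S-ι l ≤-refl))) (S-monoʳ (ι l) (s≤s (<⇒≤ (≰⇒> p)))))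

-- Arranged so that `ℓ u` is by definition the length of `invList (perm u) (suc (maxL u))`.
invList : (ℕ → ℕ) → ℕ → List (ℕ × ℕ)
invList f n = filterᵇ (λ p → f (proj₂ p) <ᵇ f (proj₁ p)) (tagged (λ a → filterᵇ (a <ᵇ_) (range1 n)) (range1 n))

invList-unique : ∀ f n → Unique (invList f n)
invList-unique f n = filterᵇ-unique _ (tagged-unique _ (range1-unique n) (λ a → filterᵇ-unique _ (range1-unique n)))

∈-invList⁻ : ∀ {f n a b} → (a , b) ∈ invList f n → 1 ≤ a × a < b × b ≤ n × f b < f a
∈-invList⁻ {f} {n} {a} {b} p =
  let q , r   = ∈-filterᵇ⁻ _ (tagged (λ a → filterᵇ (a <ᵇ_) (range1 n)) (range1 n)) p
      a∈ , b∈ = ∈-tagged⁻ _ (range1 n) q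
      b∈′ , t = ∈-filterᵇ⁻ (a <ᵇ_) (range1 n) b∈
  in proj₁ (∈-range1⁻ a∈) , <ᵇ⇒< a b (≡→T t) , proj₂ (∈-range1⁻ b∈′) , <ᵇ⇒< (f b) (f a) (≡→T r)

∈-invList⁺ : ∀ {f n a b} → 1 ≤ a → a < b → b ≤ n → f b < f a → (a , b) ∈ invList f n
∈-invList⁺ {f} {n} p q r t = ∈-filterᵇ⁺ _
  (∈-tagged⁺ _ (∈-range1⁺ p (≤-trans (<⇒≤ q) r))
    (∈-filterᵇ⁺ _ (∈-range1⁺ (≤-trans p (<⇒≤ q)) r) (T→≡ (<⇒<ᵇ q)))) (T→≡ (<⇒<ᵇ t))

s-reverses : ∀ {i x y} → x < y → s i y < s i x → x ≡ i × y ≡ suc i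
s-reverses {i} {x} {y} p q with trView i (suc i) x | trView i (suc i) y
... | atL | atL = ⊥-elim (<-irrefl refl p)
... | atL | atR = refl , refl
... | atL | off c d = ⊥-elim (<-irrefl refl (<-≤-trans p (≤-pred (subst₂ _<_ (tr-o c d) (s-l i) q))))
... | atR | atL = ⊥-elim (<-asym p (n<1+n i))
... | atR | atR = ⊥-elim (<-irrefl refl p)
... | atR | off a b = ⊥-elim (<-asym (<-trans (n<1+n i) p) (subst₂ _<_ (tr-o a b) (s-r i) q))
... | off a b | atL = ⊥-elim (<-asym (<-trans p (n<1+n i)) (subst₂ _<_ (s-l i) (tr-o a b) q))
... | off a b | atR = ⊥-elim (<-irrefl refl (<-≤-trans (subst₂ _<_ (s-r i) (tr-o a b) q) (≤-pred p)))
... | off a b | off c d = ⊥-elim (<-asym p (subst₂ _<_ (tr-o c d) (tr-o a b) q))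

module _ (i : ℕ) (u : List ℕ) where

  private
    f  = perm u
    n  = suc (maxL u)
    n′ = suc (maxL (i ∷ u))

  -- Composing with s_i exchanges two adjacent values, so only the positions of i and i+1 can form a
  -- new inversion. The difference between the ranges `n` and `n′` is harmless: positions beyond `n`
  -- are fixed by u and take part in no inversion of u.
  inversion-step : ∀ {a b} → (a , b) ∈ invList (perm (i ∷ u)) n′ →
    (a , b) ∈ invList f n ⊎ (a ≡ inv u i × b ≡ inv u (suc i) × a < b)
  inversion-step {a} {b} p with ∈-invList⁻ {perm (i ∷ u)} {n′} p
  ... | 1≤a , a<b , _ , sb<sa with <-cmp (f a) (f b)
  ...   | tri≈ _ q _ = ⊥-elim (<⇒≢ a<b (perm-injective u q))
  ...   | tri< q _ _ = inj₂ (trans (sym (inv-perm u a)) (cong (inv u) (proj₁ r)) ,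
                             trans (sym (inv-perm u b)) (cong (inv u) (proj₂ r)) , a<b)
    where r = s-reverses {i} q sb<sa
  ...   | tri> _ _ q = inj₁ (∈-invList⁺ {f} 1≤a a<b b≤n q)
    where
    b≤n : b ≤ n
    b≤n with b ≤? n
    ... | yes r = r
    ... | no r  = ⊥-elim (<-asym a<b (subst (b <_) a-fixed b<fa))
      where
      b<fa : b < f a
      b<fa = subst (_< f a) (perm-fix u (≰⇒> r)) q
      a-fixed : f a ≡ a
      a-fixed = perm-injective u (perm-fix u (<-trans (≰⇒> r) b<fa))

  ℓ-step : ℓ (i ∷ u) ≤ suc (ℓ u)
  ℓ-step = unique-⊆-length {ys = (inv u i , inv u (suc i)) ∷ invList f n} (invList-unique (perm (i ∷ u)) n′)
    λ p → [ there , (λ { (refl , refl , _) → here refl }) ]′ (inversion-step p)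

  ℓ-descent : ¬ inv u i < inv u (suc i) → ℓ (i ∷ u) ≤ ℓ u
  ℓ-descent h = unique-⊆-length (invList-unique (perm (i ∷ u)) n′)
    λ p → [ id , (λ { (refl , refl , q) → ⊥-elim (h q) }) ]′ (inversion-step p)

ℓ≤length : ∀ u → ℓ u ≤ length u
ℓ≤length []      = z≤n
ℓ≤length (i ∷ u) = ≤-trans (ℓ-step i u) (s≤s (ℓ≤length u))

-- ℓ grows by at most one per letter, and not at all when i does not precede i+1; a reduced word
-- needs the full growth at every letter.
reduced-tail : ∀ {i u} → ReducedWord (i ∷ u) → ReducedWord u × inv u i < inv u (suc i)
reduced-tail {i} {u} (_ ∷ ps , len) = (ps , ≤-antisym (≤-pred (subst (_≤ suc (ℓ u)) (sym len) (ℓ-step i u))) (ℓ≤length u)) , asc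
  where
  asc : inv u i < inv u (suc i)
  asc with inv u i <? inv u (suc i)
  ... | yes p = p
  ... | no p  = ⊥-elim (<-irrefl refl (subst (_≤ length u) (sym len) (≤-trans (ℓ-descent i u p) (ℓ≤length u))))

-- Polynomials as functionals on weights of monomials

pattern 0ℤ = ℤ.+ 0
pattern 1ℤ = ℤ.+ 1

Weight : Set
Weight = Exp → Exp → ℤ

-- Polynomials are unnormalised lists of terms, so they are compared only through the linear
-- functionals that weights of monomials define.
pair : Weight → Poly → ℤ
pair ψ []                = 0ℤ
pair ψ ((c , e , f) ∷ p) = c ℤ.* ψ e f ℤ.+ pair ψ p

ind : Bool → ℤ
ind true  = 1ℤ
ind false = 0ℤ

at : Exp → Exp → Weight
at e f e′ f′ = ind (eqE e e′ ∧ eqE f f′)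

coeff-pair : ∀ p e f → coeff p e f ≡ pair (at e f) p
coeff-pair [] e f = refl
coeff-pair ((c , e′ , f′) ∷ p) e f with eqE e e′ ∧ eqE f f′
... | true  = cong₂ ℤ._+_ (sym (ℤP.*-identityʳ c)) (coeff-pair p e f)
... | false = trans (coeff-pair p e f) (sym (trans (cong (ℤ._+ _) (ℤP.*-zeroʳ c)) (ℤP.+-identityˡ _)))

pair-cong-All : ∀ {ψ φ : Weight} {p} → All (λ (c , e , f) → ψ e f ≡ φ e f) p → pair ψ p ≡ pair φ p
pair-cong-All [] = refl
pair-cong-All {p = (c , _ , _) ∷ _} (h ∷ hs) = cong₂ ℤ._+_ (cong (c ℤ.*_) h) (pair-cong-All hs)

pair-cong : ∀ {ψ φ : Weight} → (∀ e f → ψ e f ≡ φ e f) → ∀ p → pair ψ p ≡ pair φ p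
pair-cong h p = pair-cong-All (All.universal (λ (c , e , f) → h e f) p)

pair-++ : ∀ ψ p q → pair ψ (p ++ q) ≡ pair ψ p ℤ.+ pair ψ q
pair-++ ψ []                q = sym (ℤP.+-identityˡ _)
pair-++ ψ ((c , e , f) ∷ p) q = trans (cong (ℤ._+_ (c ℤ.* ψ e f)) (pair-++ ψ p q)) (sym (ℤP.+-assoc (c ℤ.* ψ e f) _ _))

pair-zero : ∀ p → pair (λ _ _ → 0ℤ) p ≡ 0ℤ
pair-zero []                = refl
pair-zero ((c , e , f) ∷ p) = cong₂ ℤ._+_ (ℤP.*-zeroʳ c) (pair-zero p)

pair-+ : ∀ ψ φ p → pair (λ e f → ψ e f ℤ.+ φ e f) p ≡ pair ψ p ℤ.+ pair φ p
pair-+ ψ φ []                = refl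
pair-+ ψ φ ((c , e , f) ∷ p) = trans (cong (ℤ._+_ (c ℤ.* (ψ e f ℤ.+ φ e f))) (pair-+ ψ φ p))
  (lem c (ψ e f) (φ e f) (pair ψ p) (pair φ p))
  where
  lem : ∀ c x y z w → c ℤ.* (x ℤ.+ y) ℤ.+ (z ℤ.+ w) ≡ c ℤ.* x ℤ.+ z ℤ.+ (c ℤ.* y ℤ.+ w)
  lem = ℤR.solve-∀

pair-* : ∀ d ψ p → pair (λ e f → d ℤ.* ψ e f) p ≡ d ℤ.* pair ψ p
pair-* d ψ []                = sym (ℤP.*-zeroʳ d)
pair-* d ψ ((c , e , f) ∷ p) = trans (cong (ℤ._+_ (c ℤ.* (d ℤ.* ψ e f))) (pair-* d ψ p)) (lem c d (ψ e f) (pair ψ p))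
  where
  lem : ∀ c d x y → c ℤ.* (d ℤ.* x) ℤ.+ d ℤ.* y ≡ d ℤ.* (c ℤ.* x ℤ.+ y)
  lem = ℤR.solve-∀

pair-swap : ∀ (θ : Exp → Exp → Weight) p q →
  pair (λ e f → pair (θ e f) q) p ≡ pair (λ e′ f′ → pair (λ e f → θ e f e′ f′) p) q
pair-swap θ []                q = sym (pair-zero q)
pair-swap θ ((c , e , f) ∷ p) q = trans
  (cong₂ ℤ._+_ (sym (pair-* c (θ e f) q)) (pair-swap θ p q))
  (sym (pair-+ (λ e′ f′ → c ℤ.* θ e f e′ f′) (λ e′ f′ → pair (λ e f → θ e f e′ f′) p) q))

shift : Exp → Exp → Weight → Weight
shift e f ψ e′ f′ = ψ (addE e e′) (addE f f′)

pair-mul : ∀ ψ p q → pair ψ (p *P q) ≡ pair (λ e f → pair (shift e f ψ) q) p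
pair-mul ψ [] q = refl
pair-mul ψ ((c , e , f) ∷ p) q = trans (pair-++ ψ (map (mulT (c , e , f)) q) (p *P q)) (cong₂ ℤ._+_ (row q) (pair-mul ψ p q))
  where
  mulT : Term → Term → Term
  mulT (c , e , f) (d , e′ , f′) = c ℤ.* d , addE e e′ , addE f f′
  row : ∀ q → pair ψ (map (mulT (c , e , f)) q) ≡ c ℤ.* pair (shift e f ψ) q
  row [] = sym (ℤP.*-zeroʳ c)
  row ((d , e′ , f′) ∷ q) = trans (cong (ℤ._+_ (c ℤ.* d ℤ.* shift e f ψ e′ f′)) (row q))
    (lem c d (shift e f ψ e′ f′) (pair (shift e f ψ) q))
    where
    lem : ∀ c d x y → c ℤ.* d ℤ.* x ℤ.+ c ℤ.* y ≡ c ℤ.* (d ℤ.* x ℤ.+ y)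
    lem = ℤR.solve-∀

-- Exponent vectors up to trailing zeros

addE-[] : ∀ e → addE e [] ≡ e
addE-[] []      = refl
addE-[] (_ ∷ _) = refl

addE-assoc : ∀ e f g → addE (addE e f) g ≡ addE e (addE f g)
addE-assoc []      f       g       = refl
addE-assoc (x ∷ e) []      g       = refl
addE-assoc (x ∷ e) (y ∷ f) []      = refl
addE-assoc (x ∷ e) (y ∷ f) (z ∷ g) = cong₂ _∷_ (+-assoc x y z) (addE-assoc e f g)

addE-comm : ∀ e f → addE e f ≡ addE f e
addE-comm []      f       = sym (addE-[] f)
addE-comm (x ∷ e) []      = refl
addE-comm (x ∷ e) (y ∷ f) = cong₂ _∷_ (+-comm x y) (addE-comm e f)

getE-add : ∀ e f n → getE (addE e f) n ≡ getE e n + getE f n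
getE-add []      f       n       = refl
getE-add (x ∷ e) []      n       = sym (+-identityʳ _)
getE-add (x ∷ e) (y ∷ f) zero    = refl
getE-add (x ∷ e) (y ∷ f) (suc n) = getE-add e f n

sum-add : ∀ e f → sum (addE e f) ≡ sum e + sum f
sum-add []      f       = refl
sum-add (x ∷ e) []      = sym (+-identityʳ _)
sum-add (x ∷ e) (y ∷ f) rewrite sum-add e f = lem x y (sum e) (sum f)
  where
  lem : ∀ x y a b → x + y + (a + b) ≡ x + a + (y + b)
  lem = solve-∀

getE-set : ∀ e n v → getE (setE e n v) n ≡ v
getE-set []      zero    v = refl
getE-set []      (suc n) v = getE-set [] n v
getE-set (x ∷ e) zero    v = refl
getE-set (x ∷ e) (suc n) v = getE-set e n v

getE-set-≢ : ∀ e {n j} v → j ≢ n → getE (setE e n v) j ≡ getE e j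
getE-set-≢ []      {zero}  {zero}  v p = ⊥-elim (p refl)
getE-set-≢ []      {zero}  {suc j} v p = refl
getE-set-≢ []      {suc n} {zero}  v p = refl
getE-set-≢ []      {suc n} {suc j} v p = getE-set-≢ [] v (p ∘ cong suc)
getE-set-≢ (x ∷ e) {zero}  {zero}  v p = ⊥-elim (p refl)
getE-set-≢ (x ∷ e) {zero}  {suc j} v p = refl
getE-set-≢ (x ∷ e) {suc n} {zero}  v p = refl
getE-set-≢ (x ∷ e) {suc n} {suc j} v p = getE-set-≢ e v (p ∘ cong suc)

getE-unit : ∀ n j → getE (unitE n) j ≡ δ n j
getE-unit zero    zero    = refl
getE-unit zero    (suc j) = refl
getE-unit (suc n) zero    = refl
getE-unit (suc n) (suc j) = getE-unit n j

sum-unit : ∀ n → sum (unitE n) ≡ 1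
sum-unit zero    = refl
sum-unit (suc n) = sum-unit n

getE-mon : ∀ α → getE (monE α) ≗ count α
getE-mon []      j = refl
getE-mon (x ∷ α) j = trans (getE-add (unitE x) (monE α) j)
  (trans (cong₂ _+_ (getE-unit x j) (getE-mon α j)) (sym (count-∷ x α j)))

eqE-sound : ∀ e f → eqE e f ≡ true → getE e ≗ getE f
eqE-sound []      []      _ n       = refl
eqE-sound []      (y ∷ f) p zero    = sym (≡ᵇ-sound {y} (proj₁ (∧-true {y ≡ᵇ 0} p)))
eqE-sound []      (y ∷ f) p (suc n) = eqE-sound [] f (proj₂ (∧-true {y ≡ᵇ 0} p)) n
eqE-sound (x ∷ e) []      p zero    = ≡ᵇ-sound {x} (proj₁ (∧-true {x ≡ᵇ 0} p))
eqE-sound (x ∷ e) []      p (suc n) = eqE-sound e [] (proj₂ (∧-true {x ≡ᵇ 0} p)) n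
eqE-sound (x ∷ e) (y ∷ f) p zero    = ≡ᵇ-sound {x} (proj₁ (∧-true {x ≡ᵇ y} p))
eqE-sound (x ∷ e) (y ∷ f) p (suc n) = eqE-sound e f (proj₂ (∧-true {x ≡ᵇ y} p)) n

eqE-complete : ∀ e f → getE e ≗ getE f → eqE e f ≡ true
eqE-complete []      []      h = refl
eqE-complete []      (y ∷ f) h = ∧-intro (≡ᵇ-true (sym (h 0))) (eqE-complete [] f (h ∘ suc))
eqE-complete (x ∷ e) []      h = ∧-intro (≡ᵇ-true (h 0)) (eqE-complete e [] (h ∘ suc))
eqE-complete (x ∷ e) (y ∷ f) h = ∧-intro (≡ᵇ-true (h 0)) (eqE-complete e f (h ∘ suc))

sum-cong : ∀ e f → getE e ≗ getE f → sum e ≡ sum f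
sum-cong []      []      h = refl
sum-cong []      (y ∷ f) h = cong₂ _+_ (h 0) (sum-cong [] f (h ∘ suc))
sum-cong (x ∷ e) []      h = cong₂ _+_ (h 0) (sum-cong e [] (h ∘ suc))
sum-cong (x ∷ e) (y ∷ f) h = cong₂ _+_ (h 0) (sum-cong e f (h ∘ suc))

bool-iff : ∀ {a b} → (a ≡ true → b ≡ true) → (b ≡ true → a ≡ true) → a ≡ b
bool-iff {true}  {true}  _ _ = refl
bool-iff {true}  {false} p _ = sym (p refl)
bool-iff {false} {true}  _ q = q refl
bool-iff {false} {false} _ _ = refl

eqE-cong : ∀ {e e′ f f′} → getE e ≗ getE e′ → getE f ≗ getE f′ → eqE e f ≡ eqE e′ f′
eqE-cong {e} {e′} {f} {f′} p q = bool-iff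
  (λ r → eqE-complete e′ f′ λ n → trans (sym (p n)) (trans (eqE-sound e f r n) (q n)))
  (λ r → eqE-complete e f λ n → trans (p n) (trans (eqE-sound e′ f′ r n) (sym (q n))))

coeff-cong : ∀ p {e e′} f → getE e ≗ getE e′ → coeff p e f ≡ coeff p e′ f
coeff-cong p {e} {e′} f h = trans (coeff-pair p e f) (trans
  (pair-cong (λ x y → cong (λ b → ind (b ∧ eqE f y)) (eqE-cong {e} {e′} {x} h (λ _ → refl))) p)
  (sym (coeff-pair p e′ f)))

put : ℕ → Exp → ℕ → ℕ → Exp
put i e x y = setE (setE e i x) (suc i) y

getE-put-l : ∀ i e x y → getE (put i e x y) i ≡ x
getE-put-l i e x y = trans (getE-set-≢ (setE e i x) y (<⇒≢ (n<1+n i))) (getE-set e i x)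

getE-put-r : ∀ i e x y → getE (put i e x y) (suc i) ≡ y
getE-put-r i e x y = getE-set (setE e i x) (suc i) y

getE-put-o : ∀ i e x y {j} → j ≢ i → j ≢ suc i → getE (put i e x y) j ≡ getE e j
getE-put-o i e x y p q = trans (getE-set-≢ (setE e i x) y q) (getE-set-≢ e x p)

≗-split : ∀ i {f g : ℕ → ℕ} → f i ≡ g i → f (suc i) ≡ g (suc i) →
  (∀ {j} → j ≢ i → j ≢ suc i → f j ≡ g j) → f ≗ g
≗-split i p q r j with trView i (suc i) j
... | atL     = p
... | atR     = q
... | off u v = r u v

put-cong : ∀ i {e e′} x y → getE e ≗ getE e′ → getE (put i e x y) ≗ getE (put i e′ x y)
put-cong i {e} {e′} x y h = ≗-split i
  (trans (getE-put-l i e x y) (sym (getE-put-l i e′ x y)))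
  (trans (getE-put-r i e x y) (sym (getE-put-r i e′ x y)))
  (λ {j} p q → trans (getE-put-o i e x y p q) (trans (h j) (sym (getE-put-o i e′ x y p q))))

put-put : ∀ i e x y x′ y′ → getE (put i (put i e x y) x′ y′) ≗ getE (put i e x′ y′)
put-put i e x y x′ y′ = ≗-split i
  (trans (getE-put-l i (put i e x y) x′ y′) (sym (getE-put-l i e x′ y′)))
  (trans (getE-put-r i (put i e x y) x′ y′) (sym (getE-put-r i e x′ y′)))
  (λ p q → trans (getE-put-o i (put i e x y) x′ y′ p q)
    (trans (getE-put-o i e x y p q) (sym (getE-put-o i e x′ y′ p q))))

rest : ℕ → Exp → Exp → Bool
rest i e e′ = eqE (put i e 0 0) (put i e′ 0 0)

eqE-split : ∀ i e e′ → eqE e e′ ≡ (getE e i ≡ᵇ getE e′ i) ∧ ((getE e (suc i) ≡ᵇ getE e′ (suc i)) ∧ rest i e e′)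
eqE-split i e e′ = bool-iff
  (λ r → let h = eqE-sound e e′ r in ∧-intro (≡ᵇ-true (h i)) (∧-intro (≡ᵇ-true (h (suc i)))
    (eqE-complete (put i e 0 0) (put i e′ 0 0) (put-cong i {e} {e′} 0 0 h))))
  (λ r → let p , r′ = ∧-true {getE e i ≡ᵇ getE e′ i} r
             q , t  = ∧-true {getE e (suc i) ≡ᵇ getE e′ (suc i)} r′
         in eqE-complete e e′ (≗-split i (≡ᵇ-sound {getE e i} p) (≡ᵇ-sound {getE e (suc i)} q)
              λ {j} u v → trans (sym (getE-put-o i e 0 0 u v))
                (trans (eqE-sound (put i e 0 0) (put i e′ 0 0) t j) (getE-put-o i e′ 0 0 u v))))

eqE-putʳ : ∀ i e e′ x y → eqE e (put i e′ x y) ≡ (getE e i ≡ᵇ x) ∧ ((getE e (suc i) ≡ᵇ y) ∧ rest i e e′)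
eqE-putʳ i e e′ x y = trans (eqE-split i e (put i e′ x y)) (cong₂ _∧_
  (cong (getE e i ≡ᵇ_) (getE-put-l i e′ x y)) (cong₂ _∧_ (cong (getE e (suc i) ≡ᵇ_) (getE-put-r i e′ x y))
  (eqE-cong {put i e 0 0} {put i e 0 0} {put i (put i e′ x y) 0 0} {put i e′ 0 0} (λ _ → refl) (put-put i e′ x y 0 0))))

eqE-putˡ : ∀ i e e′ x y → eqE (put i e x y) e′ ≡ (x ≡ᵇ getE e′ i) ∧ ((y ≡ᵇ getE e′ (suc i)) ∧ rest i e e′)
eqE-putˡ i e e′ x y = trans (eqE-split i (put i e x y) e′) (cong₂ _∧_
  (cong (_≡ᵇ getE e′ i) (getE-put-l i e x y)) (cong₂ _∧_ (cong (_≡ᵇ getE e′ (suc i)) (getE-put-r i e x y))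
  (eqE-cong {put i (put i e x y) 0 0} {put i e 0 0} {put i e′ 0 0} {put i e′ 0 0} (put-put i e x y 0 0) (λ _ → refl))))

-- Divided differences acting on weights

infixl 6 _▹_

-- The transpose of π_i, see `pair-π`: coefficients of π_i p are read off from p itself.
_▹_ : Weight → ℕ → Weight
(ψ ▹ i) e f = pair ψ (πT i (1ℤ , e , f))

sumL : ∀ {A : Set} → (A → ℤ) → List A → ℤ
sumL g []       = 0ℤ
sumL g (x ∷ xs) = g x ℤ.+ sumL g xs

sumL-cong : ∀ {A : Set} {g h : A → ℤ} → (∀ x → g x ≡ h x) → ∀ xs → sumL g xs ≡ sumL h xs
sumL-cong p []       = refl
sumL-cong p (x ∷ xs) = cong₂ ℤ._+_ (p x) (sumL-cong p xs)

sumL-zero : ∀ {A : Set} {g : A → ℤ} {xs} → All (λ x → g x ≡ 0ℤ) xs → sumL g xs ≡ 0ℤ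
sumL-zero []       = refl
sumL-zero (p ∷ ps) = cong₂ ℤ._+_ p (sumL-zero ps)

-- The weight of π_i (x_i^a x_{i+1}^b), where g x y is the weight of x_i^x x_{i+1}^y.
πsum : (ℕ → ℕ → ℤ) → ℕ → ℕ → ℤ
πsum g a b = if b ≤ᵇ a
  then sumL (λ j → g (a ∸ j) (b + j)) (upTo (suc (a ∸ b)))
  else ℤ.- sumL (λ j → g (suc a + j) ((b ∸ 1) ∸ j)) (upTo ((b ∸ a) ∸ 1))

pair-map : ∀ ψ c (X : ℕ → Exp) f js → pair ψ (map (λ j → c , X j , f) js) ≡ c ℤ.* sumL (λ j → ψ (X j) f) js
pair-map ψ c X f []       = sym (ℤP.*-zeroʳ c)
pair-map ψ c X f (j ∷ js) = trans (cong (ℤ._+_ (c ℤ.* ψ (X j) f)) (pair-map ψ c X f js))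
  (sym (ℤP.*-distribˡ-+ c (ψ (X j) f) _))

pair-πT : ∀ ψ i c e f → pair ψ (πT i (c , e , f)) ≡ c ℤ.* πsum (λ x y → ψ (put i e x y) f) (getE e i) (getE e (suc i))
pair-πT ψ i c e f with getE e i | getE e (suc i)
... | a | b with b ≤ᵇ a
...   | true  = pair-map ψ c _ f (upTo (suc (a ∸ b)))
...   | false = trans (pair-map ψ (ℤ.- c) _ f (upTo ((b ∸ a) ∸ 1)))
  (trans (sym (ℤP.neg-distribˡ-* c _)) (ℤP.neg-distribʳ-* c _))

▹-πsum : ∀ ψ i e f → (ψ ▹ i) e f ≡ πsum (λ x y → ψ (put i e x y) f) (getE e i) (getE e (suc i))
▹-πsum ψ i e f = trans (pair-πT ψ i 1ℤ e f) (ℤP.*-identityˡ _)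

pair-π : ∀ ψ i p → pair ψ (πP i p) ≡ pair (ψ ▹ i) p
pair-π ψ i []                = refl
pair-π ψ i ((c , e , f) ∷ p) = trans (pair-++ ψ (πT i (c , e , f)) (πP i p))
  (cong₂ ℤ._+_ (trans (pair-πT ψ i c e f) (cong (c ℤ.*_) (sym (▹-πsum ψ i e f)))) (pair-π ψ i p))

πsum-cong : ∀ {g h} → (∀ x y → g x y ≡ h x y) → ∀ a b → πsum g a b ≡ πsum h a b
πsum-cong p a b with b ≤ᵇ a
... | true  = sumL-cong (λ j → p _ _) (upTo (suc (a ∸ b)))
... | false = cong ℤ.-_ (sumL-cong (λ j → p _ _) (upTo ((b ∸ a) ∸ 1)))

πsum-zero : ∀ {g} → (∀ x y → g x y ≡ 0ℤ) → ∀ a b → πsum g a b ≡ 0ℤ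
πsum-zero p a b with b ≤ᵇ a
... | true  = sumL-zero (All.universal (λ j → p _ _) (upTo (suc (a ∸ b))))
... | false = cong ℤ.-_ (sumL-zero (All.universal (λ j → p _ _) (upTo ((b ∸ a) ∸ 1))))

-- Lists that differ by trailing zeros are the same exponent; the weight must not tell them apart.
Respects : Weight → Set
Respects ψ = ∀ e e′ f f′ → getE e ≗ getE e′ → getE f ≗ getE f′ → ψ e f ≡ ψ e′ f′

VanishesFrom : ℕ → Weight → Set
VanishesFrom d ψ = ∀ e f → d ≤ sum f → ψ e f ≡ 0ℤ

▹-respects : ∀ {ψ} i → Respects ψ → Respects (ψ ▹ i)
▹-respects {ψ} i r e e′ f f′ p q = trans (▹-πsum ψ i e f) (trans
  (cong₂ (πsum (λ x y → ψ (put i e x y) f)) (p i) (p (suc i)))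
  (trans (πsum-cong (λ x y → r (put i e x y) (put i e′ x y) f f′ (put-cong i {e} {e′} x y p) q) (getE e′ i) (getE e′ (suc i)))
    (sym (▹-πsum ψ i e′ f′))))

▹-zero : ∀ ψ i e f → (∀ e → ψ e f ≡ 0ℤ) → (ψ ▹ i) e f ≡ 0ℤ
▹-zero ψ i e f h = trans (▹-πsum ψ i e f) (πsum-zero (λ x y → h (put i e x y)) (getE e i) (getE e (suc i)))

shift-respects : ∀ ψ e f → Respects ψ → Respects (λ e′ f′ → ψ (addE e′ e) (addE f′ f))
shift-respects ψ e f r e₁ e₂ f₁ f₂ p q = r _ _ _ _
  (λ n → trans (getE-add e₁ e n) (trans (cong (_+ getE e n) (p n)) (sym (getE-add e₂ e n))))
  (λ n → trans (getE-add f₁ f n) (trans (cong (_+ getE f n) (q n)) (sym (getE-add f₂ f n))))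

at-respects : ∀ e f → Respects (at e f)
at-respects e f e₁ e₂ f₁ f₂ p q = cong₂ (λ a b → ind (a ∧ b))
  (eqE-cong {e} {e} {e₁} {e₂} (λ _ → refl) p) (eqE-cong {f} {f} {f₁} {f₂} (λ _ → refl) q)

at-degree : ∀ e f e′ f′ → sum f ≢ sum f′ → at e f e′ f′ ≡ 0ℤ
at-degree e f e′ f′ n with eqE f f′ in eq
... | true  = ⊥-elim (n (sum-cong f f′ (eqE-sound f f′ eq)))
... | false = cong ind (∧-zeroʳ (eqE e e′))

-- Products of factors 1 − x^e T^f in low T-degree

prodP-++ : ∀ xs ys ψ → pair ψ (prodP (xs ++ ys)) ≡ pair ψ (prodP xs *P prodP ys)
prodP-++ []       ys ψ = sym (trans (pair-mul ψ oneP (prodP ys)) (trans (ℤP.+-identityʳ _) (ℤP.*-identityˡ _)))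
prodP-++ (p ∷ xs) ys ψ = begin
  pair ψ (p *P prodP (xs ++ ys))
    ≡⟨ pair-mul ψ p (prodP (xs ++ ys)) ⟩
  pair (λ e f → pair (shift e f ψ) (prodP (xs ++ ys))) p
    ≡⟨ pair-cong (λ e f → trans (prodP-++ xs ys (shift e f ψ)) (pair-mul (shift e f ψ) (prodP xs) (prodP ys))) p ⟩
  pair (λ e f → pair (λ e′ f′ → pair (shift e′ f′ (shift e f ψ)) (prodP ys)) (prodP xs)) p
    ≡⟨ pair-cong (λ e f → pair-cong (λ e′ f′ → pair-cong (λ e″ f″ →
         sym (cong₂ ψ (addE-assoc e e′ e″) (addE-assoc f f′ f″))) (prodP ys)) (prodP xs)) p ⟩
  pair (λ e f → pair (shift e f (λ e f → pair (shift e f ψ) (prodP ys))) (prodP xs)) p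
    ≡⟨ pair-mul (λ e f → pair (shift e f ψ) (prodP ys)) p (prodP xs) ⟨
  pair (λ e f → pair (shift e f ψ) (prodP ys)) (p *P prodP xs)
    ≡⟨ pair-mul ψ (p *P prodP xs) (prodP ys) ⟨
  pair ψ ((p *P prodP xs) *P prodP ys) ∎
  where open ≡-Reasoning

-- N_{w,i} is a product over l of products over α; a single list of factors makes it possible to
-- speak of pairs of factors.
prodP-flatten : ∀ {B : Set} (F : ℕ × B → Poly) (g : ℕ → List B) ls ψ →
  pair ψ (prodP (map (λ l → prodP (map (λ b → F (l , b)) (g l))) ls)) ≡ pair ψ (prodP (map F (tagged g ls)))
prodP-flatten F g []       ψ = refl
prodP-flatten F g (l ∷ ls) ψ = begin
  pair ψ (A *P prodP (map inner ls))
    ≡⟨ pair-mul ψ A (prodP (map inner ls)) ⟩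
  pair (λ e f → pair (shift e f ψ) (prodP (map inner ls))) A
    ≡⟨ pair-cong (λ e f → prodP-flatten F g ls (shift e f ψ)) A ⟩
  pair (λ e f → pair (shift e f ψ) (prodP (map F (tagged g ls)))) A
    ≡⟨ pair-mul ψ A (prodP (map F (tagged g ls))) ⟨
  pair ψ (A *P prodP (map F (tagged g ls)))
    ≡⟨ prodP-++ (map (λ b → F (l , b)) (g l)) (map F (tagged g ls)) ψ ⟨
  pair ψ (prodP (map (λ b → F (l , b)) (g l) ++ map F (tagged g ls)))
    ≡⟨ cong (λ xs → pair ψ (prodP (xs ++ map F (tagged g ls)))) (map-∘ (g l)) ⟩
  pair ψ (prodP (map F (map (l ,_) (g l)) ++ map F (tagged g ls)))
    ≡⟨ cong (pair ψ ∘ prodP) (map-++ F (map (l ,_) (g l)) (tagged g ls)) ⟨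
  pair ψ (prodP (map F (tagged g (l ∷ ls)))) ∎
  where
  open ≡-Reasoning
  inner = λ l → prodP (map (λ b → F (l , b)) (g l))
  A = inner l

pairSum : ∀ {A : Set} → (A → A → ℤ) → List A → ℤ
pairSum g []       = 0ℤ
pairSum g (x ∷ xs) = sumL (g x) xs ℤ.+ pairSum g xs

module Expand {I : Set} (mx mt : I → Exp) (deg : ∀ x → sum (mt x) ≡ 1) where

  F : I → Poly
  F x = oneP +P ((ℤ.- 1ℤ , mx x , mt x) ∷ [])

  Π : List I → Poly
  Π xs = prodP (map F xs)

  cons : ∀ ψ x xs → pair ψ (Π (x ∷ xs)) ≡ pair ψ (Π xs) ℤ.- pair (shift (mx x) (mt x) ψ) (Π xs)
  cons ψ x xs = trans (pair-mul ψ (F x) (Π xs)) (lem (pair ψ (Π xs)) _)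
    where
    lem : ∀ a b → 1ℤ ℤ.* a ℤ.+ (ℤ.- 1ℤ ℤ.* b ℤ.+ 0ℤ) ≡ a ℤ.- b
    lem = ℤR.solve-∀

  -- Choosing the monomial of a factor uses up one T-degree. Therefore a weight vanishing from
  -- T-degree d on sees only products of fewer than d monomials, as in the three expansions below.
  shift-vanishes : ∀ {ψ d} x → VanishesFrom (suc d) ψ → VanishesFrom d (shift (mx x) (mt x) ψ)
  shift-vanishes {d = d} x v e f p = v _ _
    (subst (suc d ≤_) (sym (trans (sum-add (mt x) f) (cong (_+ sum f) (deg x)))) (s≤s p))

  shift-[] : ∀ ψ x → shift (mx x) (mt x) ψ [] [] ≡ ψ (mx x) (mt x)
  shift-[] ψ x = cong₂ ψ (addE-[] (mx x)) (addE-[] (mt x))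

  expand₀ : ∀ {ψ} → VanishesFrom 1 ψ → ∀ xs → pair ψ (Π xs) ≡ ψ [] []
  expand₀ {ψ} v []       = trans (ℤP.+-identityʳ _) (ℤP.*-identityˡ _)
  expand₀ {ψ} v (x ∷ xs) = trans (cons ψ x xs) (trans (cong₂ ℤ._-_ (expand₀ v xs)
    (trans (pair-cong (λ e f → shift-vanishes x v e f z≤n) (Π xs)) (pair-zero (Π xs))))
    (ℤP.+-identityʳ _))

  expand₁ : ∀ {ψ} → VanishesFrom 2 ψ → ∀ xs → pair ψ (Π xs) ≡ ψ [] [] ℤ.- sumL (λ x → ψ (mx x) (mt x)) xs
  expand₁ {ψ} v []       = lem (ψ [] [])
    where
    lem : ∀ a → 1ℤ ℤ.* a ℤ.+ 0ℤ ≡ a ℤ.- 0ℤ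
    lem = ℤR.solve-∀
  expand₁ {ψ} v (x ∷ xs) = trans (cons ψ x xs) (trans (cong₂ ℤ._-_ (expand₁ v xs)
    (trans (expand₀ (shift-vanishes x v) xs) (shift-[] ψ x)))
    (lem (ψ [] []) (sumL (λ x → ψ (mx x) (mt x)) xs) (ψ (mx x) (mt x))))
    where
    lem : ∀ a b c → a ℤ.- b ℤ.- c ≡ a ℤ.- (c ℤ.+ b)
    lem = ℤR.solve-∀

  expand₂ : ∀ {ψ} → VanishesFrom 3 ψ → ∀ xs → pair ψ (Π xs) ≡
    ψ [] [] ℤ.- sumL (λ x → ψ (mx x) (mt x)) xs ℤ.+
    pairSum (λ x y → ψ (addE (mx x) (mx y)) (addE (mt x) (mt y))) xs
  expand₂ {ψ} v []       = lem (ψ [] [])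
    where
    lem : ∀ a → 1ℤ ℤ.* a ℤ.+ 0ℤ ≡ a ℤ.- 0ℤ ℤ.+ 0ℤ
    lem = ℤR.solve-∀
  expand₂ {ψ} v (x ∷ xs) = trans (cons ψ x xs) (trans (cong₂ ℤ._-_ (expand₂ v xs)
    (trans (expand₁ (shift-vanishes x v) xs) (cong (ℤ._- sumL (λ y → shift (mx x) (mt x) ψ (mx y) (mt y)) xs) (shift-[] ψ x))))
    (lem (ψ [] []) (sumL (λ x → ψ (mx x) (mt x)) xs) (pairSum (λ x y → ψ (addE (mx x) (mx y)) (addE (mt x) (mt y))) xs) (ψ (mx x) (mt x))
      (sumL (λ y → shift (mx x) (mt x) ψ (mx y) (mt y)) xs)))
    where
    lem : ∀ a b c d e → a ℤ.- b ℤ.+ c ℤ.- (d ℤ.- e) ≡ a ℤ.- (d ℤ.+ b) ℤ.+ (e ℤ.+ c)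
    lem = ℤR.solve-∀

-- Sums of indicators that count at most one object

sumL-none : ∀ {A : Set} {p : A → Bool} {xs} → (∀ {z} → z ∈ xs → p z ≡ false) → sumL (ind ∘ p) xs ≡ 0ℤ
sumL-none h = sumL-zero (All.tabulate (λ q → cong ind (h q)))

≢true : ∀ {b} → b ≢ true → b ≡ false
≢true {true}  n = ⊥-elim (n refl)
≢true {false} n = refl

sumL-one : ∀ {A : Set} {p : A → Bool} {xs y} → Unique xs → y ∈ xs → p y ≡ true →
  (∀ {z} → z ∈ xs → p z ≡ true → z ≡ y) → sumL (ind ∘ p) xs ≡ 1ℤ
sumL-one {p = p} {x ∷ xs} (h ∷ u) (here refl) py only rewrite py =
  cong (ℤ._+_ 1ℤ) (sumL-none λ q → ≢true λ pz → All.lookup h q (sym (only (there q) pz)))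
sumL-one {p = p} {x ∷ xs} (h ∷ u) (there q) py only with p x in eq
... | true  = ⊥-elim (All.lookup h q (only (here refl) eq))
... | false = trans (ℤP.+-identityˡ _) (sumL-one u q py (only ∘ there))

search : ∀ {A : Set} (p : A → Bool) xs → (∃[ y ] (y ∈ xs × p y ≡ true)) ⊎ (∀ {z} → z ∈ xs → p z ≡ false)
search p []       = inj₂ λ ()
search p (x ∷ xs) with p x in eq | search p xs
... | true  | _      = inj₁ (x , here refl , eq)
... | false | inj₁ (y , q , py) = inj₁ (y , there q , py)
... | false | inj₂ h = inj₂ λ { (here refl) → eq ; (there q) → h q }

module PairCount {A : Set} (q : A → A → Bool) (q-sym : ∀ x y → q x y ≡ q y x) where

  Same : (x y x′ y′ : A) → Set
  Same x y x′ y′ = (x ≡ x′ × y ≡ y′) ⊎ (x ≡ y′ × y ≡ x′)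

  AtMostOne : List A → Set
  AtMostOne xs = ∀ {x y x′ y′} → x ∈ xs → y ∈ xs → x′ ∈ xs → y′ ∈ xs → x ≢ y → x′ ≢ y′ →
    q x y ≡ true → q x′ y′ ≡ true → Same x y x′ y′

  NoPair : List A → Set
  NoPair xs = ∀ {x y} → x ∈ xs → y ∈ xs → x ≢ y → q x y ≡ false

  SomePair : List A → Set
  SomePair xs = ∃[ x ] ∃[ y ] (x ∈ xs × y ∈ xs × x ≢ y × q x y ≡ true)

  total : List A → ℤ
  total = pairSum (λ x y → ind (q x y))

  total-none : ∀ {xs} → Unique xs → NoPair xs → total xs ≡ 0ℤ
  total-none [] _ = refl
  total-none (h ∷ u) n = cong₂ ℤ._+_ (sumL-none λ z∈ → n (here refl) (there z∈) (All.lookup h z∈))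
    (total-none u λ x∈ y∈ → n (there x∈) (there y∈))

  count-pairs : ∀ {xs} → Unique xs → AtMostOne xs → (total xs ≡ 0ℤ × NoPair xs) ⊎ (total xs ≡ 1ℤ × SomePair xs)
  count-pairs [] _ = inj₁ (refl , λ ())
  count-pairs {x ∷ xs} (h ∷ u) one with search (q x) xs
  ... | inj₁ (y , y∈ , qxy) = inj₂
    ( cong₂ ℤ._+_ (sumL-one u y∈ qxy λ z∈ qxz →
          [ (λ (_ , p) → sym p) , (λ (p , _) → ⊥-elim (All.lookup h z∈ p)) ]′
          (one (here refl) (there y∈) (here refl) (there z∈) (All.lookup h y∈) (All.lookup h z∈) qxy qxz))
        (total-none u λ a∈ b∈ a≢b → ≢true λ qab →
          [ (λ (p , _) → All.lookup h a∈ p) , (λ (p , _) → All.lookup h b∈ p) ]′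
          (one (here refl) (there y∈) (there a∈) (there b∈) (All.lookup h y∈) a≢b qxy qab))
    , x , y , here refl , there y∈ , All.lookup h y∈ , qxy )
  ... | inj₂ none with count-pairs u (λ a b c d → one (there a) (there b) (there c) (there d))
  ...   | inj₂ (p , a , b , a∈ , b∈ , r) = inj₂
    (trans (cong₂ ℤ._+_ (sumL-none none) p) refl , a , b , there a∈ , there b∈ , r)
  ...   | inj₁ (p , n) = inj₁ (trans (cong₂ ℤ._+_ (sumL-none none) p) refl , λ
    { (here refl) (here refl) a≢b → ⊥-elim (a≢b refl)
    ; (here refl) (there b∈)  _   → none b∈
    ; (there a∈)  (here refl) _   → trans (q-sym _ _) (none a∈)
    ; (there a∈)  (there b∈)  a≢b → n a∈ b∈ a≢b })

pairSum-cong : ∀ {A : Set} {G : A → Set} {g h : A → A → ℤ} {xs} → (∀ {x y} → G x → G y → g x y ≡ h x y) →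
  All G xs → pairSum g xs ≡ pairSum h xs
pairSum-cong p [] = refl
pairSum-cong {A} {G} {g} {h} p (gx ∷ gs) = cong₂ ℤ._+_ (row gs) (pairSum-cong p gs)
  where
  row : ∀ {ys} → All G ys → sumL (g _) ys ≡ sumL (h _) ys
  row [] = refl
  row (gy ∷ gs) = cong₂ ℤ._+_ (p gx gy) (row gs)

pairSum-neg : ∀ {A : Set} (g : A → A → ℤ) xs → pairSum (λ x y → ℤ.- g x y) xs ≡ ℤ.- pairSum g xs
pairSum-neg g []       = refl
pairSum-neg g (x ∷ xs) = trans (cong₂ ℤ._+_ (row xs) (pairSum-neg g xs)) (sym (ℤP.neg-distrib-+ (sumL (g x) xs) _))
  where
  row : ∀ ys → sumL (λ y → ℤ.- g x y) ys ≡ ℤ.- sumL (g x) ys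
  row []       = refl
  row (y ∷ ys) = trans (cong (ℤ._+_ (ℤ.- g x y)) (row ys)) (sym (ℤP.neg-distrib-+ (g x y) _))

-- The recursion for P in T-degree at most 2

module Factors (i : ℕ) (u : List ℕ) where

  Item : Set
  Item = ℕ × List ℕ

  mx mt : Item → Exp
  mx (l , α) = monE (sα i α)
  mt (l , α) = unitE l

  bound : ℕ
  bound = suc (suc (maxL (i ∷ u)))

  items : List Item
  items = tagged (λ l → enumAli u l i) (range1 bound)

  open Expand mx mt (λ (l , _) → sum-unit l) public

  pair-N : ∀ ψ → pair ψ (N u i) ≡ pair ψ (Π items)
  pair-N ψ = prodP-flatten F (λ l → enumAli u l i) (range1 bound) ψ

  items-unique : Unique items
  items-unique = tagged-unique (λ l → enumAli u l i) (range1-unique bound) (λ l → filterᵇ-unique _ (enumA-unique u l))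

  ∈-items⁻ : ∀ {l α} → (l , α) ∈ items → InA u l α × ¬ InA u l (sα i α)
  ∈-items⁻ {l} {α} p = ∈-enumA⁻ {u} {l} (proj₁ q) , λ r → notTrue (proj₂ q) r
    where
    q = ∈-filterᵇ⁻ (λ α → not (inA u l (sα i α))) (enumA u l) (proj₂ (∈-tagged⁻ (λ l → enumAli u l i) (range1 bound) p))
    notTrue : ∀ {b} → not b ≡ true → b ≢ true
    notTrue {false} _ ()

  ∈-items⁺ : ∀ {l α} → 1 ≤ l → l ≤ bound → InA u l α → ¬ InA u l (sα i α) → (l , α) ∈ items
  ∈-items⁺ {l} {α} 1≤l l≤ p n = ∈-tagged⁺ (λ l → enumAli u l i) (∈-range1⁺ 1≤l l≤)
    (∈-filterᵇ⁺ (λ α → not (inA u l (sα i α))) (∈-enumA⁺ {u} {l} p) (cong not (≢true n)))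

  getE-mx : ∀ x j → getE (mx x) j ≡ count (proj₂ x) (s i j)
  getE-mx (l , α) j = trans (getE-mon (sα i α) j) (count-sα i α j)

  -- The weight on the monomials of N that remains after the terms of P_u have been summed out, so
  -- that only the product N has to be expanded.
  Φ : Weight → Weight
  Φ χ e′ f′ = pair (λ e f → χ (addE e e′) (addE f f′)) (P u)

  pair-P : ∀ ψ → pair ψ (P (i ∷ u)) ≡ pair (Φ (ψ ▹ i)) (Π items)
  pair-P ψ = trans (pair-π ψ i (P u *P N u i)) (trans (pair-mul (ψ ▹ i) (P u) (N u i))
    (trans (pair-swap (λ e f e′ f′ → (ψ ▹ i) (addE e e′) (addE f f′)) (P u) (N u i)) (pair-N (Φ (ψ ▹ i)))))

module _ {i : ℕ} {u : List ℕ} (1≤i : 1 ≤ i) (pos : All (1 ≤_) u) (asc : inv u i < inv u (suc i)) where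
  open Factors i u

  item-leaves : ∀ {l α} → (l , α) ∈ items →
    𝒜 (ω u l) l (count α) × ¬ 𝒜 (ω u l) l (count α ∘ s i) × count α i ≡ 1 × count α (suc i) ≡ 0
  item-leaves {l} {α} p = A , n , Step.leaves 1≤i {ω u l} {l} (ω-bin u l) (ω-desc l pos 1≤i asc) A n
    where
    A = InA⇒𝒜 {u} {l} {α} (proj₁ (∈-items⁻ p))
    n : ¬ 𝒜 (ω u l) l (count α ∘ s i)
    n A′ = proj₂ (∈-items⁻ p) (𝒜⇒InA {u} {l} {sα i α} (sort-sorted (map (s i) α)) (𝒜-cong (λ j → sym (count-sα i α j)) A′))

  Exps : Item → Set
  Exps x = getE (mx x) i ≡ 0 × getE (mx x) (suc i) ≡ 1

  items-exps : All Exps items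
  items-exps = All.tabulate λ {x} p →
    let _ , _ , a , b = item-leaves p in
    trans (getE-mx x i) (trans (cong (count (proj₂ x)) (s-l i)) b) ,
    trans (getE-mx x (suc i)) (trans (cong (count (proj₂ x)) (s-r i)) a)

-- Below T-degree 2 the product N contributes 1 and its single factor monomials; π_i kills the
-- latter and fixes 1. P_u is replaced by 1 inductively.
pair-P-low : ∀ u → ReducedWord u → ∀ {ψ} → Respects ψ → VanishesFrom 2 ψ → pair ψ (P u) ≡ ψ [] []
pair-P-low []      _ {ψ} _ _ = trans (ℤP.+-identityʳ _) (ℤP.*-identityˡ _)
pair-P-low (i ∷ u) rw@(1≤i ∷ _ , _) {ψ} r v with reduced-tail rw
... | rw′@(pos , _) , asc = begin
    pair ψ (P (i ∷ u))                                       ≡⟨ pair-P ψ ⟩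
    pair (Φ χ) (Π items)                                     ≡⟨ pair-cong Φχ (Π items) ⟩
    pair χ (Π items)                                         ≡⟨ expand₁ χ-vanishes items ⟩
    χ [] [] ℤ.- sumL (λ x → χ (mx x) (mt x)) items           ≡⟨ cong (ℤ._-_ (χ [] [])) (sumL-zero (All.map (λ {x} → killed {x}) (items-exps 1≤i pos asc))) ⟩
    χ [] [] ℤ.- 0ℤ                                           ≡⟨ ℤP.+-identityʳ _ ⟩
    χ [] []                                                  ≡⟨ trans (▹-πsum ψ i [] []) (ℤP.+-identityʳ _) ⟩
    ψ (put i [] 0 0) []                                      ≡⟨ r (put i [] 0 0) [] [] [] zeros (λ _ → refl) ⟩
    ψ [] []                                                  ∎
  where
  open ≡-Reasoning
  open Factors i u
  χ = ψ ▹ i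
  χ-vanishes : VanishesFrom 2 χ
  χ-vanishes e f p = ▹-zero ψ i e f (λ e → v e f p)
  Φχ : ∀ e f → Φ χ e f ≡ χ e f
  Φχ e f = pair-P-low u rw′ (shift-respects χ e f (▹-respects i r))
    (λ e′ f′ p → χ-vanishes (addE e′ e) (addE f′ f) (≤-trans p (subst (sum f′ ≤_) (sym (sum-add f′ f)) (m≤m+n _ _))))
  killed : ∀ {x} → getE (mx x) i ≡ 0 × getE (mx x) (suc i) ≡ 1 → χ (mx x) (mt x) ≡ 0ℤ
  killed {x} (p , q) = trans (▹-πsum ψ i (mx x) (mt x)) (cong₂ (πsum (λ x′ y → ψ (put i (mx x) x′ y) (mt x))) p q)
  zeros : getE (put i [] 0 0) ≗ getE []
  zeros = ≗-split i (getE-put-l i [] 0 0) (getE-put-r i [] 0 0) (getE-put-o i [] 0 0)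

module Recursion {i : ℕ} {u : List ℕ} (rw : ReducedWord (i ∷ u)) where
  open Factors i u

  private
    1≤i : 1 ≤ i
    1≤i = All.head (proj₁ rw)
    rw′ : ReducedWord u
    rw′ = proj₁ (reduced-tail rw)
    asc : inv u i < inv u (suc i)
    asc = proj₂ (reduced-tail {i} {u} rw)

  -- The product of two factor monomials has exponents (0 , 2) at i, i+1, and π_i turns it into
  -- minus the monomial with (1 , 1) there.
  q : Exp → Exp → Item → Item → Bool
  q e f x y = eqE e (put i (addE (mx x) (mx y)) 1 1) ∧ eqE f (addE (mt x) (mt y))

  -- T-degree 2 receives three contributions: P_u with the 1 of N; one factor with the T-degree 1
  -- part of P_u, which is 0, as π_i of a single factor would need the wrong degree; two factors
  -- with the constant term 1 of P_u.
  coeff-step : ∀ e f → sum f ≡ 2 →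
    coeff (P (i ∷ u)) e f ≡ pair (at e f ▹ i) (P u) ℤ.- pairSum (λ x y → ind (q e f x y)) items
  coeff-step e f deg = begin
    coeff (P (i ∷ u)) e f  ≡⟨ coeff-pair (P (i ∷ u)) e f ⟩
    pair (at e f) (P (i ∷ u)) ≡⟨ pair-P (at e f) ⟩
    pair (Φ χ) (Π items) ≡⟨ expand₂ Φ-vanishes items ⟩
    Φ χ [] [] ℤ.- sumL (λ x → Φ χ (mx x) (mt x)) items ℤ.+
      pairSum (λ x y → Φ χ (addE (mx x) (mx y)) (addE (mt x) (mt y))) items
        ≡⟨ cong₂ ℤ._+_ (cong₂ ℤ._-_ Φ₀ (sumL-zero (All.universal Φ₁ items)))
            (trans (pairSum-cong (λ {x} {y} → Φ₂ {x} {y}) (items-exps 1≤i (proj₁ rw′) asc)) (pairSum-neg (λ x y → ind (q e f x y)) items)) ⟩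
    pair χ (P u) ℤ.- 0ℤ ℤ.+ ℤ.- pairSum (λ x y → ind (q e f x y)) items ≡⟨ cong (ℤ._- pairSum (λ x y → ind (q e f x y)) items) (ℤP.+-identityʳ (pair χ (P u))) ⟩
    pair χ (P u) ℤ.- pairSum (λ x y → ind (q e f x y)) items ∎
    where
    open ≡-Reasoning
    χ = at e f ▹ i
    χ-degree : ∀ e′ f′ → 2 ≢ sum f′ → χ e′ f′ ≡ 0ℤ
    χ-degree e′ f′ n = ▹-zero (at e f) i e′ f′ λ e″ → at-degree e f e″ f′ (λ r → n (trans (sym deg) r))
    2≢ : ∀ {n} → 3 ≤ n → 2 ≢ n
    2≢ (s≤s (s≤s ())) refl
    Φ-vanishes : VanishesFrom 3 (Φ χ)
    Φ-vanishes e′ f′ p = trans (pair-cong (λ e″ f″ → χ-degree (addE e″ e′) (addE f″ f′) (2≢ (≤-trans p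
      (subst (sum f′ ≤_) (sym (sum-add f″ f′)) (m≤n+m (sum f′) (sum f″)))))) (P u)) (pair-zero (P u))
    Φ₀ : Φ χ [] [] ≡ pair χ (P u)
    Φ₀ = pair-cong (λ e f → cong₂ χ (addE-[] e) (addE-[] f)) (P u)
    Φ-low : ∀ e′ f′ → 1 ≤ sum f′ → Φ χ e′ f′ ≡ χ e′ f′
    Φ-low e′ f′ p = pair-P-low u rw′ (shift-respects χ e′ f′ (▹-respects i (at-respects e f)))
      (λ e″ f″ r → χ-degree (addE e″ e′) (addE f″ f′) (2≢ (subst (3 ≤_) (sym (sum-add f″ f′)) (+-mono-≤ r p))))
    Φ₁ : ∀ x → Φ χ (mx x) (mt x) ≡ 0ℤ
    Φ₁ x@(l , _) = trans (Φ-low (mx x) (mt x) (≤-reflexive (sym (sum-unit l))))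
      (χ-degree (mx x) (mt x) (λ r → 2≢1 (trans r (sum-unit l))))
      where
      2≢1 : 2 ≢ 1
      2≢1 ()
    Φ₂ : ∀ {x y} → Exps 1≤i (proj₁ rw′) asc x → Exps 1≤i (proj₁ rw′) asc y →
      Φ χ (addE (mx x) (mx y)) (addE (mt x) (mt y)) ≡ ℤ.- ind (q e f x y)
    Φ₂ {x} {y} (p , p′) (r , r′) = trans (Φ-low X (addE (mt x) (mt y))
        (subst (1 ≤_) (sym (trans (sum-add (mt x) (mt y)) (cong₂ _+_ (sum-unit (proj₁ x)) (sum-unit (proj₁ y))))) (s≤s z≤n)))
      (trans (▹-πsum (at e f) i X (addE (mt x) (mt y)))
      (trans (cong₂ (πsum (λ a b → at e f (put i X a b) (addE (mt x) (mt y)))) (trans (getE-add (mx x) (mx y) i) (cong₂ _+_ p r))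
                             (trans (getE-add (mx x) (mx y) (suc i)) (cong₂ _+_ p′ r′)))
        (cong ℤ.-_ (ℤP.+-identityʳ _))))
      where X = addE (mx x) (mx y)

-- Exponents are bounded by the T-degree

Bounded : Poly → Set
Bounded = All (λ (c , e , f) → ∀ n → getE e n ≤ sum f)

bounded-mul : ∀ {p q} → Bounded p → Bounded q → Bounded (p *P q)
bounded-mul [] _ = []
bounded-mul {(c , e , f) ∷ p} {q} (b ∷ bs) bq = AllP.++⁺ (AllP.map⁺ (All.map
  (λ {t} b′ n → subst₂ _≤_ (sym (getE-add e (proj₁ (proj₂ t)) n)) (sym (sum-add f (proj₂ (proj₂ t)))) (+-mono-≤ (b n) (b′ n))) bq))
  (bounded-mul bs bq)

getE-[] : ∀ n → getE [] n ≤ 0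
getE-[] n = z≤n

bounded-one : Bounded oneP
bounded-one = getE-[] ∷ []

bounded-prod : ∀ {ps} → All Bounded ps → Bounded (prodP ps)
bounded-prod []       = bounded-one
bounded-prod (b ∷ bs) = bounded-mul b (bounded-prod bs)

bounded-N : ∀ u i → Bounded (N u i)
bounded-N u i = bounded-prod {map row (range1 bound)} (AllP.map⁺ (All.universal bounded-row (range1 bound)))
  where
  open Factors i u
  row : ℕ → Poly
  row l = prodP (map (λ α → F (l , α)) (enumAli u l i))
  bounded-F : ∀ l {α} → α ∈ enumAli u l i → Bounded (F (l , α))
  bounded-F l {α} p = getE-[] ∷ (λ n → subst₂ _≤_ (sym (getE-mx (l , α) n)) (sym (sum-unit l)) (bin A (s i n))) ∷ []
    where
    A : 𝒜 (ω u l) l (count α)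
    A = InA⇒𝒜 {u} {l} {α} (∈-enumA⁻ {u} {l} (proj₁ (∈-filterᵇ⁻ (λ α → not (inA u l (sα i α))) (enumA u l) p)))
  bounded-row : ∀ l → Bounded (row l)
  bounded-row l = bounded-prod {map (λ α → F (l , α)) (enumAli u l i)} (AllP.map⁺ (All.tabulate (bounded-F l)))

getE-put-≤ : ∀ i e x y {M} → (∀ n → getE e n ≤ M) → x ≤ M → y ≤ M → ∀ n → getE (put i e x y) n ≤ M
getE-put-≤ i e x y {M} h p q n with trView i (suc i) n
... | atL     = subst (_≤ M) (sym (getE-put-l i e x y)) p
... | atR     = subst (_≤ M) (sym (getE-put-r i e x y)) q
... | off a b = subst (_≤ M) (sym (getE-put-o i e x y a b)) (h n)

bounded-πT : ∀ i c e f → (∀ n → getE e n ≤ sum f) → Bounded (πT i (c , e , f))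
bounded-πT i c e f h = go (getE e i) (getE e (suc i)) (h i) (h (suc i))
  where
  branch : ℕ → ℕ → Poly
  branch a b = if b ≤ᵇ a
    then map (λ j → c , put i e (a ∸ j) (b + j) , f) (upTo (suc (a ∸ b)))
    else map (λ j → ℤ.- c , put i e (suc a + j) ((b ∸ 1) ∸ j) , f) (upTo ((b ∸ a) ∸ 1))
  go : ∀ a b → a ≤ sum f → b ≤ sum f → Bounded (branch a b)
  go a b a≤ b≤ with b ≤ᵇ a in eq
  ... | true  = AllP.map⁺ (All.tabulate λ {j} p → getE-put-≤ i e (a ∸ j) (b + j) h (≤-trans (m∸n≤m a j) a≤)
    (≤-trans (≤-trans (+-monoʳ-≤ b (≤-pred (∈-upTo⁻ p))) (≤-reflexive (m+[n∸m]≡n (≤ᵇ⇒≤ b a (≡→T eq))))) a≤))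
  ... | false = AllP.map⁺ (All.tabulate λ {j} p → getE-put-≤ i e (suc a + j) ((b ∸ 1) ∸ j) h (high b (∈-upTo⁻ p) b≤)
    (≤-trans (m∸n≤m (b ∸ 1) j) (≤-trans (m∸n≤m b 1) b≤)))
    where
    high : ∀ b {j} → j < b ∸ a ∸ 1 → b ≤ sum f → suc a + j ≤ sum f
    high b {j} p q = begin
      suc a + j            ≡⟨ +-suc a j ⟨
      a + suc j            ≤⟨ +-monoʳ-≤ a p ⟩
      a + (b ∸ a ∸ 1)      ≤⟨ +-monoʳ-≤ a (m∸n≤m (b ∸ a) 1) ⟩
      a + (b ∸ a)          ≡⟨ m+[n∸m]≡n (<⇒≤ (m<n∸m′ p)) ⟩
      b                    ≤⟨ q ⟩
      sum f                ∎
      where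
      open ≤-Reasoning
      m<n∸m′ : j < b ∸ a ∸ 1 → a < b
      m<n∸m′ r = m∸n≢0⇒n<m {b} {a} λ z → n≮0 (subst (λ d → j < d ∸ 1) z r)

-- The monomials of the factors of N are squarefree in x and linear in T, and π_i creates no
-- exponent above the larger of the two it acts on. In T-degree 2 exponents are at most 2, and π_i
-- becomes a finite table.
bounded-P : ∀ u → Bounded (P u)
bounded-P []      = bounded-one
bounded-P (i ∷ u) = go (bounded-mul (bounded-P u) (bounded-N u i))
  where
  go : ∀ {p} → Bounded p → Bounded (πP i p)
  go [] = []
  go {(c , e , f) ∷ p} (b ∷ bs) = AllP.++⁺ (bounded-πT i c e f b) (go bs)

coeff-high : ∀ u e f n → sum f < getE e n → coeff (P u) e f ≡ 0ℤ
coeff-high u e f n lt = trans (coeff-pair (P u) e f) (trans (pair-cong-All (All.map (λ {t} → no-match {t}) (bounded-P u))) (pair-zero (P u)))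
  where
  no-match : ∀ {t} → (∀ n → getE (proj₁ (proj₂ t)) n ≤ sum (proj₂ (proj₂ t))) → at e f (proj₁ (proj₂ t)) (proj₂ (proj₂ t)) ≡ 0ℤ
  no-match {c , e′ , f′} b = cong ind (≢true λ p → let p₁ , p₂ = ∧-true {eqE e e′} p in
    <-irrefl refl (<-≤-trans lt (subst₂ _≤_ (sym (eqE-sound e e′ p₁ n)) (sym (sum-cong f f′ (eqE-sound f f′ p₂))) (b n))))

-- [x_i^a x_{i+1}^b] π_i (x_i^a′ x_{i+1}^b′) for exponents at most 2; ρ tells whether the other
-- exponents agree.
match : ℕ → ℕ → Bool → ℕ → ℕ → ℤ
match a b ρ x y = ind ((a ≡ᵇ x) ∧ ((b ≡ᵇ y) ∧ ρ))

crossed : Bool → ℕ → ℕ → ℤ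
crossed ρ a b = match 2 0 ρ a b ℤ.+ match 1 1 ρ a b ℤ.- match 0 2 ρ a b

bothOne : ℕ → ℕ → Bool
bothOne a b = (a ≡ᵇ 1) ∧ (b ≡ᵇ 1)

π-matrix : ℕ → ℕ → Bool → ℕ → ℕ → ℤ
π-matrix a b ρ a′ b′ = if bothOne a b then crossed ρ a′ b′ else match (a ⊔ b) (a ⊓ b) ρ a′ b′

-- A finite check by evaluation on `Fin 3`. The bound 2 matters: π_i (x_{i+1}³), for instance, would
-- contribute to x_i² x_{i+1}.
π-matrix-correct : ∀ {a b a′ b′} ρ → a ≤ 2 → b ≤ 2 → a′ ≤ 2 → b′ ≤ 2 →
  πsum (match a b ρ) a′ b′ ≡ π-matrix a b ρ a′ b′
π-matrix-correct {a} {b} {a′} {b′} ρ p q p′ q′ = from ρ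
  where
  Fin≤2 : ∀ {n} → n ≤ 2 → ∃[ x ] toℕ {3} x ≡ n
  Fin≤2 h = fromℕ< (s≤s h) , toℕ-fromℕ< (s≤s h)
  Correct : Bool → Fin 3 → Fin 3 → Fin 3 → Fin 3 → Set
  Correct ρ a b a′ b′ = πsum (match (toℕ a) (toℕ b) ρ) (toℕ a′) (toℕ b′) ≡ π-matrix (toℕ a) (toℕ b) ρ (toℕ a′) (toℕ b′)
  table : ∀ ρ → Dec (∀ a b a′ b′ → Correct ρ a b a′ b′)
  table ρ = all? λ a → all? λ b → all? λ a′ → all? λ b′ → _ ℤ.≟ _
  from : ∀ ρ → πsum (match a b ρ) a′ b′ ≡ π-matrix a b ρ a′ b′
  from ρ with Fin≤2 p | Fin≤2 q | Fin≤2 p′ | Fin≤2 q′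
  from true  | x , refl | y , refl | x′ , refl | y′ , refl = toWitness {a? = table true} _ x y x′ y′
  from false | x , refl | y , refl | x′ , refl | y′ , refl = toWitness {a? = table false} _ x y x′ y′

pair-sub : ∀ ψ φ p → pair (λ e f → ψ e f ℤ.- φ e f) p ≡ pair ψ p ℤ.- pair φ p
pair-sub ψ φ []                = refl
pair-sub ψ φ ((c , e , f) ∷ p) = trans (cong (ℤ._+_ (c ℤ.* (ψ e f ℤ.- φ e f))) (pair-sub ψ φ p))
  (lem c (ψ e f) (φ e f) (pair ψ p) (pair φ p))
  where
  lem : ∀ c x y z w → c ℤ.* (x ℤ.- y) ℤ.+ (z ℤ.- w) ≡ c ℤ.* x ℤ.+ z ℤ.- (c ℤ.* y ℤ.+ w)
  lem = ℤR.solve-∀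

match-false : ∀ a b x y → match a b false x y ≡ 0ℤ
match-false a b x y = cong ind (trans (cong ((a ≡ᵇ x) ∧_) (∧-zeroʳ (b ≡ᵇ y))) (∧-zeroʳ (a ≡ᵇ x)))

π-matrix-false : ∀ a b x y → π-matrix a b false x y ≡ 0ℤ
π-matrix-false a b x y with bothOne a b
... | true  = cong₂ ℤ._-_ (cong₂ ℤ._+_ (match-false 2 0 x y) (match-false 1 1 x y)) (match-false 0 2 x y)
... | false = match-false (a ⊔ b) (a ⊓ b) x y

at-putʳ : ∀ i e f e′ f′ x y →
  at e f (put i e′ x y) f′ ≡ match (getE e i) (getE e (suc i)) (rest i e e′ ∧ eqE f f′) x y
at-putʳ i e f e′ f′ x y = cong ind (trans (cong (_∧ eqE f f′) (eqE-putʳ i e e′ x y))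
  (trans (∧-assoc (getE e i ≡ᵇ x) _ (eqE f f′)) (cong ((getE e i ≡ᵇ x) ∧_) (∧-assoc (getE e (suc i) ≡ᵇ y) _ (eqE f f′)))))

at-putˡ : ∀ i e f e′ f′ x y →
  at (put i e x y) f e′ f′ ≡ match x y (rest i e e′ ∧ eqE f f′) (getE e′ i) (getE e′ (suc i))
at-putˡ i e f e′ f′ x y = cong ind (trans (cong (_∧ eqE f f′) (eqE-putˡ i e e′ x y))
  (trans (∧-assoc (x ≡ᵇ getE e′ i) _ (eqE f f′)) (cong ((x ≡ᵇ getE e′ i) ∧_) (∧-assoc (y ≡ᵇ getE e′ (suc i)) _ (eqE f f′)))))

▹-matrix : ∀ i e f {e′ f′} → sum f ≡ 2 → getE e i ≤ 2 → getE e (suc i) ≤ 2 → (∀ n → getE e′ n ≤ sum f′) →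
  (at e f ▹ i) e′ f′ ≡ π-matrix (getE e i) (getE e (suc i)) (rest i e e′ ∧ eqE f f′) (getE e′ i) (getE e′ (suc i))
▹-matrix i e f {e′} {f′} deg p q h = trans (▹-πsum (at e f) i e′ f′)
  (trans (πsum-cong (at-putʳ i e f e′ f′) (getE e′ i) (getE e′ (suc i))) go)
  where
  a = getE e i
  b = getE e (suc i)
  a′ = getE e′ i
  b′ = getE e′ (suc i)
  go : πsum (match a b (rest i e e′ ∧ eqE f f′)) a′ b′ ≡ π-matrix a b (rest i e e′ ∧ eqE f f′) a′ b′
  go with eqE f f′ in eq
  ... | true  = π-matrix-correct (rest i e e′ ∧ true) p q (≤2 i) (≤2 (suc i))
    where
    ≤2 : ∀ n → getE e′ n ≤ 2
    ≤2 n = subst (getE e′ n ≤_) (trans (sym (sum-cong f f′ (eqE-sound f f′ eq))) deg) (h n)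
  ... | false rewrite ∧-zeroʳ (rest i e e′) =
    trans (πsum-zero (match-false a b) a′ b′) (sym (π-matrix-false a b a′ b′))

module _ {i : ℕ} {u : List ℕ} (rw : ReducedWord (i ∷ u)) where
  open Factors i u
  open Recursion rw

  q-sym : ∀ e f x y → q e f x y ≡ q e f y x
  q-sym e f x y = cong₂ (λ X T → eqE e (put i X 1 1) ∧ eqE f T) (addE-comm (mx x) (mx y)) (addE-comm (mt x) (mt y))

  -- Away from (1 , 1), and with exponents at most 2, the only source is the monomial with the
  -- larger exponent at i. Pairs of factors produce (1 , 1) and do not contribute.
  coeff-sorted : ∀ e f → sum f ≡ 2 → getE e i ≤ 2 → getE e (suc i) ≤ 2 →
    bothOne (getE e i) (getE e (suc i)) ≡ false →
    coeff (P (i ∷ u)) e f ≡ coeff (P u) (put i e (getE e i ⊔ getE e (suc i)) (getE e i ⊓ getE e (suc i))) f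
  coeff-sorted e f deg p r n = trans (coeff-step e f deg) (trans (cong₂ ℤ._-_
    (trans (pair-cong-All (All.map (λ {(c , e′ , f′)} → term {e′} {f′}) (bounded-P u)))
      (sym (coeff-pair (P u) (put i e (getE e i ⊔ getE e (suc i)) (getE e i ⊓ getE e (suc i))) f)))
    (total-none items-unique (λ {x} {y} _ _ _ → off-diagonal x y))) (ℤP.+-identityʳ _))
    where
    open PairCount (q e f) (q-sym e f)
    term : ∀ {e′ f′} → (∀ n → getE e′ n ≤ sum f′) → (at e f ▹ i) e′ f′ ≡
      at (put i e (getE e i ⊔ getE e (suc i)) (getE e i ⊓ getE e (suc i))) f e′ f′
    term {e′} {f′} h = trans (▹-matrix i e f deg p r h) (trans
      (cong (λ b → if b then crossed ρ (getE e′ i) (getE e′ (suc i)) else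
        match (getE e i ⊔ getE e (suc i)) (getE e i ⊓ getE e (suc i)) ρ (getE e′ i) (getE e′ (suc i))) n)
      (sym (at-putˡ i e f e′ f′ (getE e i ⊔ getE e (suc i)) (getE e i ⊓ getE e (suc i)))))
      where ρ = rest i e e′ ∧ eqE f f′
    off-diagonal : ∀ x y → q e f x y ≡ false
    off-diagonal x y = ≢true λ t →
      let h = eqE-sound e (put i (addE (mx x) (mx y)) 1 1) (proj₁ (∧-true t))
          yes′ = ∧-intro (≡ᵇ-true (trans (h i) (getE-put-l i (addE (mx x) (mx y)) 1 1)))
                         (≡ᵇ-true (trans (h (suc i)) (getE-put-r i (addE (mx x) (mx y)) 1 1)))
      in false≢true (trans (sym n) yes′)
      where
      false≢true : false ≢ true
      false≢true ()

  -- x_i x_{i+1} occurs in π_i of x_i², x_i x_{i+1} and x_{i+1}², with coefficients 1, 1 and -1.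
  coeff-crossed : ∀ e f → sum f ≡ 2 → getE e i ≡ 1 → getE e (suc i) ≡ 1 →
    coeff (P (i ∷ u)) e f ≡
      coeff (P u) (put i e 2 0) f ℤ.+ coeff (P u) (put i e 1 1) f ℤ.- coeff (P u) (put i e 0 2) f
      ℤ.- pairSum (λ x y → ind (q e f x y)) items
  coeff-crossed e f deg p r = trans (coeff-step e f deg) (cong (ℤ._- pairSum (λ x y → ind (q e f x y)) items)
    (trans (pair-cong-All (All.map (λ {(c , e′ , f′)} → term {e′} {f′}) (bounded-P u)))
    (trans (pair-sub (λ e′ f′ → at (put i e 2 0) f e′ f′ ℤ.+ at (put i e 1 1) f e′ f′) (at (put i e 0 2) f) (P u))
      (cong₂ ℤ._-_ (trans (pair-+ (at (put i e 2 0) f) (at (put i e 1 1) f) (P u))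
        (cong₂ ℤ._+_ (sym (coeff-pair (P u) (put i e 2 0) f)) (sym (coeff-pair (P u) (put i e 1 1) f))))
        (sym (coeff-pair (P u) (put i e 0 2) f))))))
    where
    term : ∀ {e′ f′} → (∀ n → getE e′ n ≤ sum f′) → (at e f ▹ i) e′ f′ ≡
      at (put i e 2 0) f e′ f′ ℤ.+ at (put i e 1 1) f e′ f′ ℤ.- at (put i e 0 2) f e′ f′
    term {e′} {f′} h = trans (▹-matrix i e f deg (subst (_≤ 2) (sym p) (s≤s z≤n)) (subst (_≤ 2) (sym r) (s≤s z≤n)) h)
      (trans (cong₂ (λ a b → π-matrix a b (rest i e e′ ∧ eqE f f′) (getE e′ i) (getE e′ (suc i))) p r)
      (sym (cong₂ ℤ._-_ (cong₂ ℤ._+_ (at-putˡ i e f e′ f′ 2 0) (at-putˡ i e f e′ f′ 1 1)) (at-putˡ i e f e′ f′ 0 2))))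

twos-put : ∀ i e x y {t} → suc i < t →
  S (twos (getE (put i e x y))) t + (isTwo (getE e i) + isTwo (getE e (suc i))) ≡
  S (twos (getE e)) t + (isTwo x + isTwo y)
twos-put i e x y {t} p = trans
  (S-patch {twos (getE (put i e x y))} {twos (getE e)} i (λ j u v → cong isTwo (getE-put-o i e x y u v)) p)
  (cong₂ (λ a b → S (twos (getE e)) t + (isTwo a + isTwo b)) (getE-put-l i e x y) (getE-put-r i e x y))

beyond : ℕ → ℕ → ℕ
beyond i E = E ⊔ suc (suc i)

beyond-≥ : ∀ i E → E ≤ beyond i E
beyond-≥ i E = m≤m⊔n E (suc (suc i))

beyond-> : ∀ i E → suc i < beyond i E
beyond-> i E = m≤n⊔m E (suc (suc i))

𝒜-ω-cong : ∀ {ω ω′ l χ} → ω ≗ ω′ → 𝒜 ω l χ → 𝒜 ω′ l χ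
𝒜-ω-cong {χ = χ} h A = mk𝒜 (bin A) (λ t → subst (_≤ S χ t) (S-cong h t) (lo A t)) (hi A) (at0 A)

two-ω-cong : ∀ {ωk ωk′ ωl ωl′ k l e} → ωk ≗ ωk′ → ωl ≗ ωl′ → TwoSplits ωk ωl k l e → TwoSplits ωk′ ωl′ k l e
two-ω-cong p q (α , β , α̃ , β̃ , mkSplit a b t , mkSplit ã b̃ t̃ , d) =
  α , β , α̃ , β̃ , mkSplit (𝒜-ω-cong q a) (𝒜-ω-cong p b) t , mkSplit (𝒜-ω-cong q ã) (𝒜-ω-cong p b̃) t̃ , d

bothOne-false : ∀ {a b} → bothOne a b ≡ false → ¬ (a ≡ 1 × b ≡ 1)
bothOne-false () (refl , refl)

δ-injective : ∀ {p q} → (∀ j → δ p j ≡ δ q j) → p ≡ q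
δ-injective {p} {q} g with p ≟ q
... | yes r = r
... | no n  = ⊥-elim (1≢0 (trans (sym (δ-refl p)) (trans (g p) (δ-≢ n))))

unit-pair : ∀ {k l l₁ l₂} → (∀ j → δ k j + δ l j ≡ δ l₁ j + δ l₂ j) → (l₁ ≡ k × l₂ ≡ l) ⊎ (l₁ ≡ l × l₂ ≡ k)
unit-pair {k} {l} {l₁} {l₂} h with k ≟ l₁
... | yes refl = inj₁ (refl , δ-injective λ j → sym (+-cancelˡ-≡ (δ k j) _ _ (h j)))
... | no n with k ≟ l₂
...   | no n′    = ⊥-elim (1+n≢0 (trans (cong (_+ δ l k) (sym (δ-refl k))) (trans (h k) (cong₂ _+_ (δ-≢ n) (δ-≢ n′)))))
...   | yes refl = inj₂ (δ-injective (λ j → sym (+-cancelˡ-≡ (δ k j) _ _ (trans (h j) (+-comm (δ l₁ j) (δ k j))))) , refl)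

-- c is 0 for k < l and 1 for k = l.  For an exponent with n squared variables, Heavy says
-- n ≥ k − c, while Light and Exact together say n = k − c − 1, as in the theorem.
module Main (k l c : ℕ) (k≤l : k ≤ l) (kind : (c ≡ 0 × k < l) ⊎ (c ≡ 1 × l ≡ k)) where

  f : Exp
  f = addE (unitE k) (unitE l)

  deg-f : sum f ≡ 2
  deg-f = trans (sum-add (unitE k) (unitE l)) (cong₂ _+_ (sum-unit k) (sum-unit l))

  Heavy Light Exact : (ℕ → ℕ) → Set
  Heavy e = ∃[ E ] k ≤ S (twos e) E + c
  Light e = ∀ t → S (twos e) t + suc c ≤ k
  Exact e = ∃[ E ] k ≤ S (twos e) E + suc c

  Two : List ℕ → (ℕ → ℕ) → Set
  Two w = TwoSplits (ω w k) (ω w l) k l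

  -- Needed beside `Value` because the recursion at (1 , 1) calls on the exponents with (2 , 0) and
  -- (0 , 2), which have one square more.
  Zero : List ℕ → Set
  Zero w = ∀ e → Heavy (getE e) → coeff (P w) e f ≡ 0ℤ

  Value : List ℕ → Set
  Value w = ∀ e → Light (getE e) → Exact (getE e) →
    (Two w (getE e) → coeff (P w) e f ≡ ℤ.- 1ℤ) × (¬ Two w (getE e) → coeff (P w) e f ≡ 0ℤ)

  module Inductive {i : ℕ} {u : List ℕ} (rw : ReducedWord (i ∷ u)) where
    open Factors i u
    open Recursion rw using (q)

    1≤i : 1 ≤ i
    1≤i = All.head (proj₁ rw)

    rw′ : ReducedWord u
    rw′ = proj₁ (reduced-tail {i} {u} rw)

    asc : inv u i < inv u (suc i)
    asc = proj₂ (reduced-tail {i} {u} rw)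

    ω↓ : ∀ l → ω u l (suc i) ≤ ω u l i
    ω↓ l = ω-desc l (proj₁ rw′) 1≤i asc

    module St l = Step 1≤i {ω u l} {l} (ω-bin u l) (ω↓ l)

    E₀ : ℕ → ℕ
    E₀ l = suc (maxL (wˡ u l))

    swapped : ∀ {l α} → 𝒜 (ω u l) l α → 𝒜 (ω u l ∘ s i) l (α ∘ s i)
    swapped {l} A = St.swap′ l (St.weaken l A)

    full-total : ∀ {l χ} → 𝒜 (ω u l ∘ s i) l χ → l ≤ S χ (beyond i (E₀ l))
    full-total {l} {χ} A = begin
      l                                     ≡⟨ ω-end u l ⟨
      S (ω u l) (E₀ l)                      ≤⟨ S-monoʳ (ω u l) (beyond-≥ i (E₀ l)) ⟩
      S (ω u l) (beyond i (E₀ l))           ≡⟨ St.S-away l _ (>⇒≢ (beyond-> i (E₀ l))) ⟨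
      S (ω u l ∘ s i) (beyond i (E₀ l))     ≤⟨ lo A (beyond i (E₀ l)) ⟩
      S χ (beyond i (E₀ l))                 ∎
      where open ≤-Reasoning

    -- A pair of factors that hits x^e T_k T_l, sorted into its k-set and its l-set; `order`
    -- remembers which factor is which.
    record Decoded (e : Exp) (x y : Item) : Set where
      field
        αk αl : List ℕ
        K∈    : (k , αk) ∈ items
        L∈    : (l , αl) ∈ items
        order : (x ≡ (k , αk) × y ≡ (l , αl)) ⊎ (x ≡ (l , αl) × y ≡ (k , αk))
        sums  : ∀ {j} → j ≢ i → j ≢ suc i → count αk j + count αl j ≡ getE e j
        e-l   : getE e i ≡ 1
        e-r   : getE e (suc i) ≡ 1

      A-k : 𝒜 (ω u k) k (count αk)
      A-k = proj₁ (item-leaves 1≤i (proj₁ rw′) asc K∈)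

      A-l : 𝒜 (ω u l) l (count αl)
      A-l = proj₁ (item-leaves 1≤i (proj₁ rw′) asc L∈)

      out-k : ¬ 𝒜 (ω u k) k (count αk ∘ s i) × count αk i ≡ 1 × count αk (suc i) ≡ 0
      out-k = proj₂ (item-leaves 1≤i (proj₁ rw′) asc K∈)

      out-l : ¬ 𝒜 (ω u l) l (count αl ∘ s i) × count αl i ≡ 1 × count αl (suc i) ≡ 0
      out-l = proj₂ (item-leaves 1≤i (proj₁ rw′) asc L∈)

      -- The exponent before π_i is applied, with (0 , 2) in place of (1 , 1) and so with one square
      -- more than e.
      tops : ∀ j → count αk (s i j) + count αl (s i j) ≡ getE (put i e 0 2) j
      tops = ≗-split i
        (trans (cong (λ v → count αk v + count αl v) (s-l i))
          (trans (cong₂ _+_ (proj₂ (proj₂ out-k)) (proj₂ (proj₂ out-l))) (sym (getE-put-l i e 0 2))))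
        (trans (cong (λ v → count αk v + count αl v) (s-r i))
          (trans (cong₂ _+_ (proj₁ (proj₂ out-k)) (proj₁ (proj₂ out-l))) (sym (getE-put-r i e 0 2))))
        (λ {j} p r → trans (cong (λ v → count αk v + count αl v) (tr-o p r))
          (trans (sums p r) (sym (getE-put-o i e 0 2 p r))))

    decode : ∀ {e x y} → x ∈ items → y ∈ items → q e f x y ≡ true → Decoded e x y
    decode {e} {x@(l₁ , α₁)} {y@(l₂ , α₂)} x∈ y∈ t = go (unit-pair λ j →
        trans (sym (units k l j)) (trans (eqE-sound f (addE (mt x) (mt y)) (proj₂ (∧-true {eqE e E} t)) j) (units l₁ l₂ j)))
      where
      X E : Exp
      X = addE (mx x) (mx y)
      E = put i X 1 1
      units : ∀ a b j → getE (addE (unitE a) (unitE b)) j ≡ δ a j + δ b j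
      units a b j = trans (getE-add (unitE a) (unitE b) j) (cong₂ _+_ (getE-unit a j) (getE-unit b j))
      h : getE e ≗ getE E
      h = eqE-sound e E (proj₁ (∧-true t))
      el : getE e i ≡ 1
      el = trans (h i) (getE-put-l i X 1 1)
      er : getE e (suc i) ≡ 1
      er = trans (h (suc i)) (getE-put-r i X 1 1)
      sm : ∀ {j} → j ≢ i → j ≢ suc i → count α₁ j + count α₂ j ≡ getE e j
      sm {j} p r = begin
        count α₁ j + count α₂ j               ≡⟨ cong (λ v → count α₁ v + count α₂ v) (tr-o p r) ⟨
        count α₁ (s i j) + count α₂ (s i j)   ≡⟨ cong₂ _+_ (getE-mx x j) (getE-mx y j) ⟨
        getE (mx x) j + getE (mx y) j         ≡⟨ getE-add (mx x) (mx y) j ⟨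
        getE X j                              ≡⟨ getE-put-o i X 1 1 p r ⟨
        getE E j                              ≡⟨ h j ⟨
        getE e j                              ∎
        where open ≡-Reasoning
      go : (l₁ ≡ k × l₂ ≡ l) ⊎ (l₁ ≡ l × l₂ ≡ k) → Decoded e x y
      go (inj₁ (refl , refl)) = record { αk = α₁ ; αl = α₂ ; K∈ = x∈ ; L∈ = y∈ ; order = inj₁ (refl , refl)
        ; sums = sm ; e-l = el ; e-r = er }
      go (inj₂ (refl , refl)) = record { αk = α₂ ; αl = α₁ ; K∈ = y∈ ; L∈ = x∈ ; order = inj₂ (refl , refl)
        ; sums = λ {j} p r → trans (+-comm (count α₂ j) (count α₁ j)) (sm p r) ; e-l = el ; e-r = er }

    item-ext : ∀ {l α l′ α′} → (l , α) ∈ items → (l′ , α′) ∈ items → count α ∘ s i ≗ count α′ ∘ s i → α ≡ α′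
    item-ext {l} {α} {l′} {α′} p p′ h = Strict-ext
      (IsA.strict (InA-sound {u} {l} {α} (proj₁ (∈-items⁻ p))))
      (IsA.strict (InA-sound {u} {l′} {α′} (proj₁ (∈-items⁻ p′))))
      (λ j → trans (cong (count α) (sym (s-invol i j))) (trans (h (s i j)) (cong (count α′) (s-invol i j))))

    -- (1 , 1) contributes no square and its replacement exactly one, which pays for lowering
    -- `suc d` to `d`.
    crossed-heavy : ∀ e x y {K d} → getE e i ≡ 1 → getE e (suc i) ≡ 1 → isTwo x + isTwo y ≡ 1 →
      ∀ E → K ≤ S (twos (getE e)) E + suc d → K ≤ S (twos (getE (put i e x y))) (beyond i E) + d
    crossed-heavy e x y {K} {d} p r h E K≤ = begin
      K                                                   ≤⟨ K≤ ⟩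
      S (twos (getE e)) E + suc d                         ≤⟨ +-monoˡ-≤ (suc d) (S-monoʳ (twos (getE e)) (beyond-≥ i E)) ⟩
      S (twos (getE e)) E′ + suc d                        ≡⟨ lem (S (twos (getE e)) E′) d ⟩
      S (twos (getE e)) E′ + 1 + d                        ≡⟨ cong (_+ d) (trans (cong (S (twos (getE e)) E′ +_) (sym h)) (sym (twos-put i e x y (beyond-> i E)))) ⟩
      S (twos (getE (put i e x y))) E′ + (isTwo (getE e i) + isTwo (getE e (suc i))) + d
        ≡⟨ cong (λ v → S (twos (getE (put i e x y))) E′ + v + d) (cong₂ (λ a b → isTwo a + isTwo b) p r) ⟩
      S (twos (getE (put i e x y))) E′ + 0 + d            ≡⟨ cong (_+ d) (+-identityʳ _) ⟩
      S (twos (getE (put i e x y))) E′ + d                ∎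
      where
      open ≤-Reasoning
      E′ = beyond i E
      lem : ∀ a d → a + suc d ≡ a + 1 + d
      lem = solve-∀

    module Pairs (e : Exp) = PairCount (q e f) (q-sym rw e f)

    -- Both pairs split the same exponent τ, which has at least k - c squares. For c = 0 the squares
    -- are the whole k-set, and the l-set is the remainder; for c = 1 at most one element is
    -- missing, and `unique-pair` determines the pair up to order.
    at-most-one : ∀ {e} → Exact (getE e) → Pairs.AtMostOne e items
    at-most-one {e} (E , K≤) x∈ y∈ x̃∈ ỹ∈ _ _ t t̃ = combine (decode {e} x∈ y∈ t) (decode {e} x̃∈ ỹ∈ t̃)
      where
      open Pairs e
      open Decoded
      combine : ∀ {x y x̃ ỹ} → Decoded e x y → Decoded e x̃ ỹ → Same x y x̃ ỹ
      combine {x} {y} {x̃} {ỹ} D D̃ = reorder (order D) (order D̃) same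
        where
        τ : ℕ → ℕ
        τ = getE (put i e 0 2)
        E′ = beyond i E
        K≤′ : k ≤ S (twos τ) E′ + c
        K≤′ = crossed-heavy e 0 2 (e-l D) (e-r D) refl E K≤
        gk = swapped (A-k D)
        gl = swapped (A-l D)
        g̃k = swapped (A-k D̃)
        g̃l = swapped (A-l D̃)
        τ-minus : ∀ {a b a′ b′ n} → a + b ≡ n → a′ + b′ ≡ n → a ≡ a′ → b ≡ b′
        τ-minus {a} p p′ refl = +-cancelˡ-≡ a _ _ (trans p (sym p′))
        lists : ∀ {a b αk′ αl′} → (a , αk′) ∈ items → (b , αl′) ∈ items →
          (∀ j → count αk′ (s i j) + count αl′ (s i j) ≡ τ j) →
          count (αk D) ∘ s i ≗ count αk′ ∘ s i → αk D ≡ αk′ × αl D ≡ αl′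
        lists k∈ l∈ tp h = item-ext (K∈ D) k∈ h , item-ext (L∈ D) l∈ (λ j → τ-minus (tops D j) (tp j) (h j))
        same-kind : (c ≡ 0 × k < l) ⊎ (c ≡ 1 × l ≡ k) → Same (k , αk D) (l , αl D) (k , αk D̃) (l , αl D̃)
        same-kind (inj₁ (c≡0 , _)) = inj₁ (cong (k ,_) (proj₁ eqs) , cong (l ,_) (proj₂ eqs))
          where
          eqs = lists (K∈ D̃) (L∈ D̃) (tops D̃) (unique-first {τ} {k} (bin gk) (bin gl) (bin g̃k) (bin g̃l)
            (tops D) (tops D̃) (hi gk) (hi g̃k) E′ (subst (k ≤_) (trans (cong (S (twos τ) E′ +_) c≡0) (+-identityʳ _)) K≤′))
        same-kind (inj₂ (c≡1 , l≡k)) = [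
            (λ h → let p , r = lists (K∈ D̃) (L∈ D̃) (tops D̃) h in inj₁ (cong (k ,_) p , cong (l ,_) r)) ,
            (λ h → let p , r = lists (L∈ D̃) (K∈ D̃) (λ j → trans (+-comm (count (αl D̃) (s i j)) _) (tops D̃ j)) h
                   in inj₂ (cong₂ _,_ (sym l≡k) p , cong₂ _,_ l≡k r)) ]′
          (unique-pair {τ} {k} (bin gk) (bin gl) (bin g̃k) (bin g̃l)
            (tops D) (tops D̃) (hi gk) (hi g̃k) (λ t → subst (S (count (αl D̃) ∘ s i) t ≤_) l≡k (hi g̃l t)) M
            (≤-trans (full-total gk) (S-monoʳ (count (αk D) ∘ s i) (m≤m⊔n (beyond i (E₀ k)) E′)))
            (≤-trans K≤′ (≤-trans (≤-reflexive (cong (S (twos τ) E′ +_) c≡1))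
              (+-monoˡ-≤ 1 (S-monoʳ (twos τ) (m≤n⊔m (beyond i (E₀ k)) E′))))))
          where M = beyond i (E₀ k) ⊔ E′
        same : Same (k , αk D) (l , αl D) (k , αk D̃) (l , αl D̃)
        same = same-kind kind
        reorder : ∀ {K L K̃ L̃ : Item} → (x ≡ K × y ≡ L) ⊎ (x ≡ L × y ≡ K) → (x̃ ≡ K̃ × ỹ ≡ L̃) ⊎ (x̃ ≡ L̃ × ỹ ≡ K̃) →
          Same K L K̃ L̃ → Same x y x̃ ỹ
        reorder (inj₁ (refl , refl)) (inj₁ (refl , refl)) r = r
        reorder (inj₁ (refl , refl)) (inj₂ (refl , refl)) (inj₁ r) = inj₂ r
        reorder (inj₁ (refl , refl)) (inj₂ (refl , refl)) (inj₂ r) = inj₁ r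
        reorder (inj₂ (refl , refl)) (inj₁ (refl , refl)) (inj₁ (a , b)) = inj₂ (b , a)
        reorder (inj₂ (refl , refl)) (inj₁ (refl , refl)) (inj₂ (a , b)) = inj₁ (b , a)
        reorder (inj₂ (refl , refl)) (inj₂ (refl , refl)) (inj₁ (a , b)) = inj₁ (b , a)
        reorder (inj₂ (refl , refl)) (inj₂ (refl , refl)) (inj₂ (a , b)) = inj₂ (b , a)

    -- Now τ has more than k - c squares. For c = 0 they do not fit into a k-set. For c = 1 they
    -- fill both sets, so the two factors coincide, while the sum is over distinct ones.
    no-pair-heavy : ∀ {e} → Heavy (getE e) → Pairs.NoPair e items
    no-pair-heavy {e} (E , K≤) x∈ y∈ x≢y = ≢true λ t → absurd (decode {e} x∈ y∈ t) x≢y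
      where
      open Decoded
      absurd : ∀ {x y} → Decoded e x y → x ≢ y → ⊥
      absurd {x} {y} D x≢y = go kind (crossed-heavy e 0 2 {suc k} {c} (e-l D) (e-r D) refl E
          (subst (suc k ≤_) (sym (+-suc _ c)) (s≤s K≤)))
        where
        τ : ℕ → ℕ
        τ = getE (put i e 0 2)
        E′ = beyond i E
        gk = swapped (A-k D)
        gl = swapped (A-l D)
        tops′ : ∀ j → count (αl D) (s i j) + count (αk D) (s i j) ≡ τ j
        tops′ j = trans (+-comm (count (αl D) (s i j)) _) (tops D j)
        clash : (x ≡ (k , αk D) × y ≡ (l , αl D)) ⊎ (x ≡ (l , αl D) × y ≡ (k , αk D)) → (k , αk D) ≡ (l , αl D) → ⊥
        clash (inj₁ (p , r)) eq = x≢y (trans p (trans eq (sym r)))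
        clash (inj₂ (p , r)) eq = x≢y (trans p (trans (sym eq) (sym r)))
        go : (c ≡ 0 × k < l) ⊎ (c ≡ 1 × l ≡ k) → suc k ≤ S (twos τ) E′ + c → ⊥
        go (inj₁ (c≡0 , _)) h = <-irrefl refl (≤-trans (subst (suc k ≤_) (trans (cong (S (twos τ) E′ +_) c≡0) (+-identityʳ _)) h)
          (≤-trans (S-mono (λ j → isTwo-≤ (bin gk j) (bin gl j) (tops D j)) E′) (hi gk E′)))
        go (inj₂ (c≡1 , l≡k)) h = clash (order D) (cong₂ _,_ (sym l≡k) (item-ext (K∈ D) (L∈ D) λ j →
            trans (sym (twos-forces {τ} {k} (bin gk) (bin gl) (tops D) (hi gk) E′ h′ j))
                  (twos-forces {τ} {k} (bin gl) (bin gk) tops′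
                    (λ t → subst (S (count (αl D) ∘ s i) t ≤_) l≡k (hi gl t)) E′ h′ j)))
          where
          h′ : k ≤ S (twos τ) E′
          h′ = ≤-pred (subst (suc k ≤_) (trans (cong (S (twos τ) E′ +_) c≡1) (+-comm _ 1)) h)

    sort-at : Exp → Exp
    sort-at e = put i e (getE e i ⊔ getE e (suc i)) (getE e i ⊓ getE e (suc i))

    data Sorting (e : Exp) : Set where
      kept    : getE (sort-at e) ≗ getE e → Sorting e
      flipped : getE (sort-at e) ≗ getE e ∘ s i → Sorting e

    sorting : ∀ e → Sorting e
    sorting e with ≤-total (getE e (suc i)) (getE e i)
    ... | inj₁ b≤a = kept (≗-split i
      (trans (getE-put-l i e _ _) (m≥n⇒m⊔n≡m b≤a)) (trans (getE-put-r i e _ _) (m≥n⇒m⊓n≡n b≤a))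
      (getE-put-o i e _ _))
    ... | inj₂ a≤b = flipped (≗-split i
      (trans (getE-put-l i e _ _) (trans (m≤n⇒m⊔n≡n a≤b) (cong (getE e) (sym (s-l i)))))
      (trans (getE-put-r i e _ _) (trans (m≤n⇒m⊓n≡m a≤b) (cong (getE e) (sym (s-r i)))))
      (λ {j} p r → trans (getE-put-o i e _ _ p r) (cong (getE e) (sym (tr-o p r)))))

    twos-sort-at : ∀ e {t} → suc i < t → S (twos (getE (sort-at e))) t ≡ S (twos (getE e)) t
    twos-sort-at e {t} p with sorting e
    ... | kept h    = S-cong (cong isTwo ∘ h) t
    ... | flipped h = trans (S-cong (cong isTwo ∘ h) t) (S-tr-hi (twos (getE e)) (n<1+n i) p)

    sort-at-low : ∀ e {K d} → (∃[ E ] K ≤ S (twos (getE e)) E + d) → ∃[ E ] K ≤ S (twos (getE (sort-at e))) E + d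
    sort-at-low e {K} {d} (E , h) = beyond i E , ≤-trans h (+-monoˡ-≤ d
      (≤-trans (S-monoʳ (twos (getE e)) (beyond-≥ i E)) (≤-reflexive (sym (twos-sort-at e (beyond-> i E))))))

    sort-at-light : ∀ e → Light (getE e) → Light (getE (sort-at e))
    sort-at-light e h t = ≤-trans (+-monoˡ-≤ (suc c)
      (≤-trans (S-monoʳ (twos (getE (sort-at e))) (beyond-≥ i t)) (≤-reflexive (twos-sort-at e (beyond-> i t))))) (h (beyond i t))

    data Shape (e : Exp) : Set where
      high   : ∀ n → 2 < getE e n → Shape e
      oneOne : getE e i ≡ 1 → getE e (suc i) ≡ 1 → Shape e
      plain  : getE e i ≤ 2 → getE e (suc i) ≤ 2 → bothOne (getE e i) (getE e (suc i)) ≡ false → Shape e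

    shape : ∀ e → Shape e
    shape e with getE e i ≤? 2 | getE e (suc i) ≤? 2 | bothOne (getE e i) (getE e (suc i)) in eq
    ... | no p  | _     | _     = high i (≰⇒> p)
    ... | yes _ | no p  | _     = high (suc i) (≰⇒> p)
    ... | yes p | yes r | false = plain p r eq
    ... | yes p | yes r | true  = oneOne (≡ᵇ-sound {getE e i} (proj₁ (∧-true eq)))
      (≡ᵇ-sound {getE e (suc i)} (proj₂ (∧-true {getE e i ≡ᵇ 1} eq)))

    coeff-of-high : ∀ w e n → 2 < getE e n → coeff (P w) e f ≡ 0ℤ
    coeff-of-high w e n p = coeff-high w e f n (subst (_< getE e n) (sym deg-f) p)

    put-self : ∀ e → getE e i ≡ 1 → getE e (suc i) ≡ 1 → getE (put i e 1 1) ≗ getE e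
    put-self e p r = ≗-split i (trans (getE-put-l i e 1 1) (sym p)) (trans (getE-put-r i e 1 1) (sym r)) (getE-put-o i e 1 1)

    zero-step : Zero u → Zero (i ∷ u)
    zero-step IH e H@(E , K≤) = go (shape e)
      where
      go : Shape e → coeff (P (i ∷ u)) e f ≡ 0ℤ
      go (high n p)    = coeff-of-high (i ∷ u) e n p
      go (plain p r n) = trans (coeff-sorted rw e f deg-f p r n) (IH (sort-at e) (sort-at-low e H))
      go (oneOne p r) = trans (coeff-crossed rw e f deg-f p r) (cong₂ ℤ._-_
        (cong₂ ℤ._-_ (cong₂ ℤ._+_ (more 2 0 refl) (trans (coeff-cong (P u) {put i e 1 1} {e} f (put-self e p r)) (IH e H))) (more 0 2 refl))
        (Pairs.total-none e items-unique (no-pair-heavy {e} H)))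
        where
        more : ∀ x y → isTwo x + isTwo y ≡ 1 → coeff (P u) (put i e x y) f ≡ 0ℤ
        more x y h = IH (put i e x y) (beyond i E ,
          crossed-heavy e x y {k} {c} p r h E (≤-trans K≤ (+-monoʳ-≤ (S (twos (getE e)) E) (n≤1+n c))))

    to-step : ∀ {e} → Two (i ∷ u) e → TwoSplits (ω u k ∘ s i) (ω u l ∘ s i) k l e
    to-step = two-ω-cong (ω-step i u k) (ω-step i u l)

    from-step : ∀ {e} → TwoSplits (ω u k ∘ s i) (ω u l ∘ s i) k l e → Two (i ∷ u) e
    from-step = two-ω-cong (λ j → sym (ω-step i u k j)) (λ j → sym (ω-step i u l j))

    module S₂ = SplitTransport 1≤i {ω u k} {ω u l} {k} {l} (ω-bin u k) (ω-bin u l) (ω↓ k) (ω↓ l)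

    two-bound : ∀ {ωk ωl e} → TwoSplits ωk ωl k l e → ∀ n → e n ≤ 2
    two-bound (_ , _ , _ , _ , Y , _) n = subst (_≤ 2) (tot Y n) (+-mono-≤ (bin (inL Y) n) (bin (inK Y) n))

    -- A(s_i w) is stable under s_i, so the splits can be moved to the sorted exponent; there, away
    -- from (1 , 1), they lie in A(w).
    plain-forth : ∀ e → bothOne (getE e i) (getE e (suc i)) ≡ false → Two (i ∷ u) (getE e) → Two u (getE (sort-at e))
    plain-forth e n t = S₂.two-sorted desc not11 (moved (sorting e))
      where
      desc : getE (sort-at e) (suc i) ≤ getE (sort-at e) i
      desc = subst₂ _≤_ (sym (getE-put-r i e _ _)) (sym (getE-put-l i e _ _)) (≤-trans (m⊓n≤m _ _) (m≤m⊔n _ (getE e (suc i))))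
      not11 : ¬ (getE (sort-at e) i ≡ 1 × getE (sort-at e) (suc i) ≡ 1)
      not11 (p , r) = go (sorting e)
        where
        go : Sorting e → ⊥
        go (kept h)    = bothOne-false n (trans (sym (h i)) p , trans (sym (h (suc i))) r)
        go (flipped h) = bothOne-false n (trans (cong (getE e) (sym (s-r i))) (trans (sym (h (suc i))) r) ,
                                     trans (cong (getE e) (sym (s-l i))) (trans (sym (h i)) p))
      moved : Sorting e → TwoSplits (ω u k ∘ s i) (ω u l ∘ s i) k l (getE (sort-at e))
      moved (kept h)    = two-cong (λ j → sym (h j)) (to-step t)
      moved (flipped h) = two-cong (λ j → sym (h j)) (S₂.two-swap (to-step t))

    plain-back : ∀ e → Two u (getE (sort-at e)) → Two (i ∷ u) (getE e)
    plain-back e t = from-step (moved (sorting e))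
      where
      moved : Sorting e → TwoSplits (ω u k ∘ s i) (ω u l ∘ s i) k l (getE e)
      moved (kept h)    = two-cong h (S₂.two-weaken t)
      moved (flipped h) = two-cong (λ j → trans (h (s i j)) (cong (getE e) (s-invol i j))) (S₂.two-swap (S₂.two-weaken t))

    module S₁ (e : ℕ → ℕ) = SplitStep 1≤i {ω u k} {ω u l} {k} {l} (ω-bin u k) (ω-bin u l) (ω↓ k) (ω↓ l)
      (ω-mono u k≤l) (E₀ k) (≤-reflexive (sym (ω-end u k))) e

    -- For k < l the sizes differ. For k = l, if α = s_i β then every element of α except i is
    -- squared in e, giving at least l - 1 squares, whereas `Light` allows k - 2.
    apart : ∀ {e} → Light e → e i ≡ 1 → e (suc i) ≡ 1 → ∀ {α β} → S₁.Sp′ e e α β → α i ≡ 1 → β (suc i) ≡ 1 → ¬ α ≗ β ∘ s i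
    apart {e} light p r {α} {β} Y α-l β-r h = go kind
      where
      E = beyond i (E₀ l)
      l≤ : l ≤ S α E
      l≤ = full-total (inL Y)
      α-r : α (suc i) ≡ 0
      α-r = trans (h (suc i)) (trans (cong β (s-r i))
        (+-cancelˡ-≡ 1 _ _ (trans (cong (_+ β i) (sym α-l)) (trans (tot Y i) p))))
      doubled : ∀ {a} → a ≤ 1 → isTwo (a + a) ≡ a
      doubled z≤n       = refl
      doubled (s≤s z≤n) = refl
      away : ∀ j → j ≢ i → j ≢ suc i → twos e j ≡ α j
      away j u v = trans (cong isTwo (trans (sym (tot Y j)) (cong (α j +_) (sym (trans (h j) (cong β (tr-o u v)))))))
        (doubled (bin (inL Y) j))
      S-twos : S (twos e) E + 1 ≡ S α E
      S-twos = trans (cong (S (twos e) E +_) (sym (cong₂ _+_ α-l α-r))) (trans (S-patch i away (beyond-> i (E₀ l)))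
        (trans (cong (S α E +_) (cong₂ (λ a b → isTwo a + isTwo b) p r)) (+-identityʳ _)))
      go : (c ≡ 0 × k < l) ⊎ (c ≡ 1 × l ≡ k) → ⊥
      go (inj₁ (_ , k<l)) = <-irrefl refl (<-≤-trans k<l (≤-trans l≤ (subst (_≤ k) (sym (S-cong h E)) (hi (St.swap′ k (inK Y)) E))))
      go (inj₂ (c≡1 , l≡k)) = <-irrefl refl (begin-strict
        l                    ≤⟨ l≤ ⟩
        S α E                ≡⟨ S-twos ⟨
        S (twos e) E + 1     <⟨ +-monoʳ-< (S (twos e) E) (s≤s (≤-reflexive (sym c≡1))) ⟩
        S (twos e) E + suc c ≤⟨ light E ⟩
        k                    ≡⟨ l≡k ⟨
        l                    ∎)
        where open ≤-Reasoning

    pair⇒extra : ∀ {e x y} → Decoded e x y → ∃[ α ] ∃[ β ] S₁.Extra (getE e) α β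
    pair⇒extra {e} D = count (αl D) , count (αk D) , S₁.mkExtra (A-l D) (proj₁ (out-l D)) (A-k D) (proj₁ (out-k D))
      (≗-split i
        (trans (cong₂ _+_ (proj₁ (proj₂ (out-l D))) (trans (cong (count (αk D)) (s-l i)) (proj₂ (proj₂ (out-k D))))) (sym (e-l D)))
        (trans (cong₂ _+_ (proj₂ (proj₂ (out-l D))) (trans (cong (count (αk D)) (s-r i)) (proj₁ (proj₂ (out-k D))))) (sym (e-r D)))
        (λ {j} p r → trans (cong (λ v → count (αl D) j + count (αk D) v) (tr-o p r))
          (trans (+-comm (count (αl D) j) _) (sums D p r))))
      where open Decoded

    to-item : ∀ {a χ} → 1 ≤ a → 𝒜 (ω u a) a χ → ¬ 𝒜 (ω u a) a (χ ∘ s i) → ∃[ α ] ((a , α) ∈ items × count α ≗ χ)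
    to-item {a} {χ} 1≤a A n with 𝒜-list {u} {a} A
    ... | α , α∈ , h = α , ∈-items⁺ 1≤a a≤ α∈ out , h
      where
      out : ¬ InA u a (sα i α)
      out p = n (𝒜-cong (λ j → trans (count-sα i α j) (h (s i j))) (InA⇒𝒜 {u} {a} {sα i α} p))
      a≤ : a ≤ bound
      a≤ with a ≤? bound
      ... | yes p = p
      -- Beyond `bound` the set of the first a values contains i+1, so nothing can leave.
      ... | no p  = ⊥-elim (n (St.swap-full a A (ω-full {i} {u} a (proj₁ rw′) (≤-trans (n≤1+n _) (<⇒≤ (≰⇒> p))))))

    -- The two indicator functions are realised by factors in `items`; that these are different
    -- factors is again due to `apart`.
    no-pair⇒no-extra : ∀ {e} → Light (getE e) → getE e i ≡ 1 → getE e (suc i) ≡ 1 → Pairs.NoPair e items →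
      ∀ {α β} → ¬ S₁.Extra (getE e) α β
    no-pair⇒no-extra {e} light p r none {α} {β} X = refute (to-item 1≤k (S₁.exK X) (S₁.exK∉ X)) (to-item (≤-trans 1≤k k≤l) (S₁.exL X) (S₁.exL∉ X))
      where
      1≤k : 1 ≤ k
      1≤k = ≤-trans (s≤s z≤n) (light 0)
      α-lr = St.leaves l (S₁.exL X) (S₁.exL∉ X)
      β-lr = St.leaves k (S₁.exK X) (S₁.exK∉ X)
      α≢β : ¬ α ≗ β
      α≢β h = apart light p r
        (mkSplit (St.weaken l (S₁.exL X)) (swapped (S₁.exK X)) (S₁.exT X)) (proj₁ α-lr)
        (trans (cong β (s-r i)) (proj₁ β-lr)) (λ j → trans (h j) (cong β (sym (s-invol i j))))
      true≢false : true ≢ false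
      true≢false ()
      refute : ∃[ b ] ((k , b) ∈ items × count b ≗ β) → ∃[ a ] ((l , a) ∈ items × count a ≗ α) → ⊥
      refute (b , b∈ , hb) (a , a∈ , ha) = true≢false (trans (sym hit) (none b∈ a∈ λ eq →
          α≢β λ j → trans (sym (ha j)) (trans (cong (λ γ → count γ j) (sym (,-injectiveʳ eq))) (hb j))))
        where
        Z : Exp
        Z = addE (mx (k , b)) (mx (l , a))
        getE-Z : ∀ j → getE Z j ≡ β (s i j) + α (s i j)
        getE-Z j = trans (getE-add (mx (k , b)) (mx (l , a)) j)
          (cong₂ _+_ (trans (getE-mx (k , b) j) (hb (s i j))) (trans (getE-mx (l , a) j) (ha (s i j))))
        hit : Recursion.q rw e f (k , b) (l , a) ≡ true
        hit = ∧-intro (eqE-complete e (put i Z 1 1) (≗-split i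
            (trans p (sym (getE-put-l i Z 1 1))) (trans r (sym (getE-put-r i Z 1 1)))
            λ {j} u v → trans (sym (S₁.exT X j)) (trans (+-comm (α j) _)
              (trans (cong (λ w → β (s i j) + α w) (sym (tr-o u v)))
              (trans (sym (getE-Z j)) (sym (getE-put-o i Z 1 1 u v)))))))
          (eqE-complete f f (λ _ → refl))

    value-step : Zero u → Value u → Value (i ∷ u)
    value-step Z IH e light exact@(E , K≤) = go (shape e)
      where
      go : Shape e → (Two (i ∷ u) (getE e) → coeff (P (i ∷ u)) e f ≡ ℤ.- 1ℤ) × (¬ Two (i ∷ u) (getE e) → coeff (P (i ∷ u)) e f ≡ 0ℤ)
      go (high n p) = (λ t → ⊥-elim (<-irrefl refl (<-≤-trans p (two-bound t n)))) , λ _ → coeff-of-high (i ∷ u) e n p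
      go (plain p r n) = (λ t → trans same (proj₁ ih (plain-forth e n t))) , λ ¬t → trans same (proj₂ ih (λ t → ¬t (plain-back e t)))
        where
        same = coeff-sorted rw e f deg-f p r n
        ih = IH (sort-at e) (sort-at-light e light) (sort-at-low e exact)
      go (oneOne p r) = by-count (Pairs.count-pairs e items-unique (at-most-one {e} exact))
        where
        open Pairs e
        ih = IH e light exact
        vanish : ∀ x y → isTwo x + isTwo y ≡ 1 → coeff (P u) (put i e x y) f ≡ 0ℤ
        vanish x y h = Z (put i e x y) (beyond i E , crossed-heavy e x y {k} {c} p r h E K≤)
        reduce : coeff (P (i ∷ u)) e f ≡ coeff (P u) e f ℤ.- total items
        reduce = trans (coeff-crossed rw e f deg-f p r) (cong (ℤ._- total items) (trans
          (cong₂ ℤ._-_ (cong₂ ℤ._+_ (vanish 2 0 refl) (coeff-cong (P u) {put i e 1 1} {e} f (put-self e p r))) (vanish 0 2 refl))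
          (trans (ℤP.+-identityʳ (0ℤ ℤ.+ coeff (P u) e f)) (ℤP.+-identityˡ (coeff (P u) e f)))))
        by-count : (total items ≡ 0ℤ × NoPair items) ⊎ (total items ≡ 1ℤ × SomePair items) →
          (Two (i ∷ u) (getE e) → coeff (P (i ∷ u)) e f ≡ ℤ.- 1ℤ) × (¬ Two (i ∷ u) (getE e) → coeff (P (i ∷ u)) e f ≡ 0ℤ)
        -- Without a pair neither the coefficient nor the existence of two splits changes.
        by-count (inj₁ (t≡0 , none)) =
          (λ t → trans reduce (cong₂ ℤ._-_ (proj₁ ih (S₁.two-strengthen (getE e) (apart light p r) p r
            (no-pair⇒no-extra {e} light p r none) (to-step t))) t≡0)) ,
          (λ ¬t → trans reduce (cong₂ ℤ._-_ (proj₂ ih (λ t → ¬t (from-step (S₂.two-weaken t)))) t≡0))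
        -- With a pair, e has no split in A(w), so the coefficient was 0 and drops to -1, while
        -- A(s_i w) gives two splits.
        by-count (inj₂ (t≡1 , x , y , x∈ , y∈ , _ , hit)) with pair⇒extra {e} (decode {e} x∈ y∈ hit)
        ... | α , β , X =
          (λ _ → trans reduce (cong₂ ℤ._-_ (proj₂ ih λ (_ , _ , _ , _ , Y , _) → S₁.extra-excludes (getE e) X Y) t≡1)) ,
          (λ ¬t → ⊥-elim (¬t (from-step (S₁.extra⇒two (getE e) (apart light p r) p r X))))

  coeff-one : ∀ e → coeff (P []) e f ≡ 0ℤ
  coeff-one e = trans (coeff-pair oneP e f) (cong (λ v → 1ℤ ℤ.* v ℤ.+ 0ℤ) (at-degree e f [] [] (λ h → 1+n≢0 (trans (sym deg-f) h))))

  zero-P : ∀ w → ReducedWord w → Zero w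
  zero-P []      _  e _ = coeff-one e
  zero-P (i ∷ u) rw = Inductive.zero-step rw (zero-P u (proj₁ (reduced-tail {i} {u} rw)))

  value-P : ∀ w → ReducedWord w → Value w
  -- A_l(Id) has a single element, so two splits would have equal first parts.
  value-P []      _  e _ _ = (λ (α , β , α̃ , β̃ , Y , Ỹ , n , _) →
      ⊥-elim (n λ j → trans (𝒜-id (inL Y) j) (sym (𝒜-id (inL Ỹ) j)))) , λ _ → coeff-one e
  value-P (i ∷ u) rw = Inductive.value-step rw (zero-P u rw′) (value-P u rw′)
    where rw′ = proj₁ (reduced-tail {i} {u} rw)

-- The theorem for sets given as lists

count-∈⁻ : ∀ {α j} → count α j ≡ 1 → j ∈ α
count-∈⁻ {x ∷ α} {j} h with j ≟ x
... | yes refl = here refl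
... | no n     = there (count-∈⁻ (trans (sym (trans (count-∷ x α j) (cong (_+ count α j) (δ-≢ n)))) h))

module _ {w : List ℕ} {k l : ℕ} {η₁ η₂ : List ℕ} {e : ℕ → ℕ} (e-mult : ∀ j → multη η₁ η₂ j ≡ e j) where

  InB⇒Two : InB k l w η₁ η₂ → TwoSplits (ω w k) (ω w l) k l e
  InB⇒Two (α , α̃ , β , β̃ , a , ã , b , b̃ , t , t̃ , n₁ , n₂ , n₃ , n₄) =
    count α , count β , count α̃ , count β̃ ,
    mkSplit (InA⇒𝒜 {w} {l} {α} a) (InA⇒𝒜 {w} {k} {β} b) (λ j → trans (t j) (e-mult j)) ,
    mkSplit (InA⇒𝒜 {w} {l} {α̃} ã) (InA⇒𝒜 {w} {k} {β̃} b̃) (λ j → trans (t̃ j) (e-mult j)) ,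
    (λ h → n₁ (Strict-ext (st a) (st ã) h)) , (λ h → n₂ (Strict-ext (st a) (st b̃) h)) ,
    (λ h → n₃ (Strict-ext (st b) (st ã) h)) , (λ h → n₄ (Strict-ext (st b) (st b̃) h))
    where
    st : ∀ {l γ} → InA w l γ → Strict γ
    st {l} {γ} p = IsA.strict (InA-sound {w} {l} {γ} p)

  Two⇒InB : TwoSplits (ω w k) (ω w l) k l e → InB k l w η₁ η₂
  Two⇒InB (_ , _ , _ , _ , mkSplit a b t , mkSplit ã b̃ t̃ , n₁ , n₂ , n₃ , n₄)
    with 𝒜-list {w} a | 𝒜-list {w} b | 𝒜-list {w} ã | 𝒜-list {w} b̃
  ... | α , α∈ , hα | β , β∈ , hβ | α̃ , α̃∈ , hα̃ | β̃ , β̃∈ , hβ̃ =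
    α , α̃ , β , β̃ , α∈ , α̃∈ , β∈ , β̃∈ ,
    (λ j → trans (cong₂ _+_ (hα j) (hβ j)) (trans (t j) (sym (e-mult j)))) ,
    (λ j → trans (cong₂ _+_ (hα̃ j) (hβ̃ j)) (trans (t̃ j) (sym (e-mult j)))) ,
    (λ { refl → n₁ (λ j → trans (sym (hα j)) (hα̃ j)) }) , (λ { refl → n₂ (λ j → trans (sym (hα j)) (hβ̃ j)) }) ,
    (λ { refl → n₃ (λ j → trans (sym (hβ j)) (hα̃ j)) }) , (λ { refl → n₄ (λ j → trans (sym (hβ j)) (hβ̃ j)) })

theorem5p2 : (w : List ℕ) → ReducedWord w →
    (k l : ℕ) → k ≤ l →
    (η₁ η₂ : List ℕ) → IsSet η₁ → IsSet η₂ → Disjoint η₁ η₂ →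
    length η₁ + 2 * length η₂ ≡ k + l →
    ((k < l × k ≡ length η₂ + 1) ⊎ (l ≡ k × k ≡ length η₂ + 2)) →
    (InB k l w η₁ η₂ → m k l η₁ η₂ w ≡ Data.Integer.+ 1)
    × (¬ InB k l w η₁ η₂ → m k l η₁ η₂ w ≡ Data.Integer.+ 0)
theorem5p2 w rw k l k≤l η₁ η₂ (inc₁ , _) (inc₂ , _) disj _ = by-case
  where
  e : Exp
  e = addE (monE η₁) (addE (monE η₂) (monE η₂))
  e-mult : ∀ j → multη η₁ η₂ j ≡ getE e j
  e-mult j = sym (trans (getE-add (monE η₁) (addE (monE η₂) (monE η₂)) j) (cong₂ _+_ (getE-mon η₁ j)
    (trans (getE-add (monE η₂) (monE η₂) j) (cong₂ _+_ (getE-mon η₂ j) (trans (getE-mon η₂ j) (sym (+-identityʳ _)))))))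
  bin₁ = Strict⇒bin (Linked⇒AllPairs <-trans inc₁)
  bin₂ = Strict⇒bin (Linked⇒AllPairs <-trans inc₂)
  twos-e : twos (getE e) ≗ count η₂
  twos-e j = trans (cong isTwo (sym (e-mult j))) (go (≤1-cases (bin₁ j)) (≤1-cases (bin₂ j)))
    where
    go : count η₁ j ≡ 0 ⊎ count η₁ j ≡ 1 → count η₂ j ≡ 0 ⊎ count η₂ j ≡ 1 → isTwo (multη η₁ η₂ j) ≡ count η₂ j
    go (inj₁ p) (inj₁ q) rewrite p | q = refl
    go (inj₁ p) (inj₂ q) rewrite p | q = refl
    go (inj₂ p) (inj₁ q) rewrite p | q = refl
    go (inj₂ p) (inj₂ q) = ⊥-elim (disj j (count-∈⁻ p) (count-∈⁻ q))
  conclude : ∀ c → (c ≡ 0 × k < l) ⊎ (c ≡ 1 × l ≡ k) → k ≡ length η₂ + suc c →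
    (InB k l w η₁ η₂ → m k l η₁ η₂ w ≡ 1ℤ) × (¬ InB k l w η₁ η₂ → m k l η₁ η₂ w ≡ 0ℤ)
  conclude c kind k≡ =
    (λ b → cong ℤ.-_ (proj₁ value (InB⇒Two {w} {η₁ = η₁} {η₂} e-mult b))) ,
    (λ ¬b → cong ℤ.-_ (proj₂ value (λ t → ¬b (Two⇒InB {w} {η₁ = η₁} {η₂} e-mult t))))
    where
    -- |η₂| = k - c - 1 yields both bounds: the partial counts of η₂ never exceed it and reach it
    -- past the largest entry.
    light : ∀ t → S (twos (getE e)) t + suc c ≤ k
    light t = subst₂ _≤_ (cong (_+ suc c) (sym (S-cong twos-e t))) (sym k≡) (+-monoˡ-≤ (suc c) (S-count≤length η₂ t))
    exact : k ≤ S (twos (getE e)) (suc (maxL η₂)) + suc c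
    exact = ≤-reflexive (trans k≡ (cong (_+ suc c) (sym (trans (S-cong twos-e _) (S-count-all (maxL-All η₂))))))
    value = Main.value-P k l c k≤l kind w rw e light (suc (maxL η₂) , exact)
  by-case : ((k < l × k ≡ length η₂ + 1) ⊎ (l ≡ k × k ≡ length η₂ + 2)) →
    (InB k l w η₁ η₂ → m k l η₁ η₂ w ≡ 1ℤ) × (¬ InB k l w η₁ η₂ → m k l η₁ η₂ w ≡ 0ℤ)
  by-case (inj₁ (k<l , k≡)) = conclude 0 (inj₁ (refl , k<l)) k≡
  by-case (inj₂ (l≡k , k≡)) = conclude 1 (inj₂ (refl , l≡k)) k≡
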